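{- Let $e_1,e_2,e_3\in\mathbb{Z}[t]$ and let $E=E(t): y^2=(x-e_1)(x-e_2)(x-e_3)$ be a nonconstant elliptic curve over $\mathbb{Q}(t)$. Let $t_0\in\mathbb{Q}$ be such that the specialization $E(t_0)$ of $E(t)$ is an elliptic curve over $\mathbb{Q}$. Assume that $t_0$ satisfies the following condition: for every nonconstant square-free divisor $h$ in $\mathbb{Z}[t]$ of $(e_1-e_2)(e_1-e_3)$, or of $(e_2-e_1)(e_2-e_3)$, or of $(e_3-e_1)(e_3-e_2)$, the rational number $h(t_0)$ is not a square in $\mathbb{Q}$. Then the specialization homomorphism $\sigma: E(\mathbb{Q}(t))\to E(t_0)(\mathbb{Q})$ is injective.
   Context: An elliptic curve over $\mathbb{Q}(t)$ is nonconstant (non-isotrivial) if it is not isomorphic over $\mathbb{Q}(t)$ to an elliptic curve defined over $\mathbb{Q}$. The specialization $E(t_0)$ is the curve obtained by substituting $t=t_0$ in the coefficients; it is an elliptic curve when $(e_1-e_2)(e_2-e_3)(e_3-e_1)(t_0)\neq 0$. The specialization homomorphism $\sigma=\sigma_{t_0}$ sends a point of $E(\mathbb{Q}(t))$ to the point of $E(t_0)(\mathbb{Q})$ obtained by evaluating its (projective) coordinates at $t=t_0$ (points whose $x$-coordinate has a pole at $t_0$ go to the point at infinity $O$). Divisibility and square-freeness are taken in the UFD $\mathbb{Z}[t]$. -}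

module Defs where

open import Level using (Level; _⊔_; 0ℓ)
open import Algebra.Bundles using (CommutativeRing; RawRing)
open import Algebra.Morphism.Structures using (module RingMorphisms)
import Algebra.Definitions.RawSemiring as RawSemiringDefinitions
import Algebra.Properties.Group as GroupProperties
import Algebra.Properties.AbelianGroup as AbelianGroupProperties
import Algebra.Properties.CommutativeSemigroup as CommutativeSemigroupProperties
import Algebra.Properties.Ring as RingProperties
import Algebra.Solver.Ring.NaturalCoefficients.Default as SemiringSolver
open import Data.Empty using (⊥-elim)
open import Data.Integer.Base as ℤ using (ℤ)
import Data.Integer.Properties as ℤₚ
open import Data.List.Base using (List; []; _∷_; length; map)
open import Data.Nat.Base as ℕ using (ℕ; zero; suc; z≤n; s≤s)
import Data.Nat.Properties as ℕₚ
open import Data.Product.Base using (_×_; _,_; ∃-syntax; proj₁; proj₂)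
open import Data.Rational.Base as ℚ using (ℚ; 0ℚ; 1ℚ)
import Data.Rational.Properties as ℚₚ
open import Data.Sum.Base using (_⊎_; inj₁; inj₂; [_,_]′)
open import Function.Base using (_∘_)
open import Relation.Binary.PropositionalEquality as ≡ using (_≡_; _≢_)
open import Relation.Nullary.Decidable.Core using (Dec; yes; no)
open import Relation.Nullary.Negation.Core using (¬_)
import Relation.Binary.Reasoning.Setoid as SetoidReasoning

private
  variable
    c ℓ c′ ℓ′ : Level

-- A polynomial is its list of coefficients, constant term first.
-- Trailing zeros are allowed, so equality compares coefficients rather
-- than lists.

module Polynomial (R : CommutativeRing c ℓ) where

  open CommutativeRing R hiding (zero)
  open RingProperties ring using (-0#≈0#; -‿distribˡ-*)
  open GroupProperties +-group using (inverseʳ-unique)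
  open SemiringSolver commutativeSemiring using (solve; _:=_; _:+_; _:*_; con)

  Poly : Set c
  Poly = List Carrier

  coeff : Poly → ℕ → Carrier
  coeff []      _       = 0#
  coeff (a ∷ p) zero    = a
  coeff (a ∷ p) (suc n) = coeff p n

  infix 4 _≋_

  record _≋_ (p q : Poly) : Set ℓ where
    constructor coeffwise
    field
      at : ∀ n → coeff p n ≈ coeff q n

  open _≋_ public

  infixl 6 _⊕_
  infixl 7 _⊛_

  _⊕_ : Poly → Poly → Poly
  []      ⊕ q       = q
  (a ∷ p) ⊕ []      = a ∷ p
  (a ∷ p) ⊕ (b ∷ q) = (a + b) ∷ (p ⊕ q)

  ⊖_ : Poly → Poly
  ⊖_ = map (λ a → - a)

  scale : Carrier → Poly → Poly
  scale a = map (a *_)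

  _⊛_ : Poly → Poly → Poly
  []      ⊛ q = []
  (a ∷ p) ⊛ q = scale a q ⊕ (0# ∷ (p ⊛ q))

  const : Carrier → Poly
  const a = a ∷ []

  ≋-refl : ∀ {p} → p ≋ p
  ≋-refl .at n = refl

  ≋-sym : ∀ {p q} → p ≋ q → q ≋ p
  ≋-sym e .at n = sym (at e n)

  ≋-trans : ∀ {p q r} → p ≋ q → q ≋ r → p ≋ r
  ≋-trans e f .at n = trans (at e n) (at f n)

  ∷-cong : ∀ {a b p q} → a ≈ b → p ≋ q → (a ∷ p) ≋ (b ∷ q)
  ∷-cong a≈b p≋q .at zero    = a≈b
  ∷-cong a≈b p≋q .at (suc n) = at p≋q n

  head-≈ : ∀ {a b p q} → (a ∷ p) ≋ (b ∷ q) → a ≈ b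
  head-≈ e = at e zero

  tail-≋ : ∀ {a b p q} → (a ∷ p) ≋ (b ∷ q) → p ≋ q
  tail-≋ e .at n = at e (suc n)

  tail-≋[] : ∀ {a p} → (a ∷ p) ≋ [] → p ≋ []
  tail-≋[] e .at n = at e (suc n)

  ∷-≋[] : ∀ {a p} → a ≈ 0# → p ≋ [] → (a ∷ p) ≋ []
  ∷-≋[] a≈0 p≋0 .at zero    = a≈0
  ∷-≋[] a≈0 p≋0 .at (suc n) = at p≋0 n

  coeff-⊕ : ∀ p q n → coeff (p ⊕ q) n ≈ coeff p n + coeff q n
  coeff-⊕ []      q       n       = sym (+-identityˡ _)
  coeff-⊕ (a ∷ p) []      n       = sym (+-identityʳ _)
  coeff-⊕ (a ∷ p) (b ∷ q) zero    = refl
  coeff-⊕ (a ∷ p) (b ∷ q) (suc n) = coeff-⊕ p q n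

  coeff-⊖ : ∀ p n → coeff (⊖ p) n ≈ - coeff p n
  coeff-⊖ []      n       = sym -0#≈0#
  coeff-⊖ (a ∷ p) zero    = refl
  coeff-⊖ (a ∷ p) (suc n) = coeff-⊖ p n

  coeff-scale : ∀ a p n → coeff (scale a p) n ≈ a * coeff p n
  coeff-scale a []      n       = sym (zeroʳ a)
  coeff-scale a (b ∷ p) zero    = refl
  coeff-scale a (b ∷ p) (suc n) = coeff-scale a p n

  ⊕-cong : ∀ {p p′ q q′} → p ≋ p′ → q ≋ q′ → p ⊕ q ≋ p′ ⊕ q′
  ⊕-cong {p} {p′} {q} {q′} e f .at n =
    trans (coeff-⊕ p q n) (trans (+-cong (at e n) (at f n)) (sym (coeff-⊕ p′ q′ n)))

  ⊕-assoc : ∀ p q r → (p ⊕ q) ⊕ r ≋ p ⊕ (q ⊕ r)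
  ⊕-assoc p q r .at n = begin
    coeff ((p ⊕ q) ⊕ r) n               ≈⟨ coeff-⊕ (p ⊕ q) r n ⟩
    coeff (p ⊕ q) n + coeff r n         ≈⟨ +-congʳ (coeff-⊕ p q n) ⟩
    coeff p n + coeff q n + coeff r n   ≈⟨ +-assoc _ _ _ ⟩
    coeff p n + (coeff q n + coeff r n) ≈⟨ +-congˡ (coeff-⊕ q r n) ⟨
    coeff p n + coeff (q ⊕ r) n         ≈⟨ coeff-⊕ p (q ⊕ r) n ⟨
    coeff (p ⊕ (q ⊕ r)) n               ∎
    where open SetoidReasoning setoid

  ⊕-comm : ∀ p q → p ⊕ q ≋ q ⊕ p
  ⊕-comm p q .at n =
    trans (coeff-⊕ p q n) (trans (+-comm _ _) (sym (coeff-⊕ q p n)))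

  ⊕-identityʳ : ∀ p → p ⊕ [] ≋ p
  ⊕-identityʳ p = ⊕-comm p []

  ⊖-cong : ∀ {p q} → p ≋ q → ⊖ p ≋ ⊖ q
  ⊖-cong {p} {q} e .at n =
    trans (coeff-⊖ p n) (trans (-‿cong (at e n)) (sym (coeff-⊖ q n)))

  ⊖-inverseˡ : ∀ p → (⊖ p) ⊕ p ≋ []
  ⊖-inverseˡ p .at n =
    trans (coeff-⊕ (⊖ p) p n) (trans (+-congʳ (coeff-⊖ p n)) (-‿inverseˡ _))

  ⊖-inverseʳ : ∀ p → p ⊕ (⊖ p) ≋ []
  ⊖-inverseʳ p = ≋-trans (⊕-comm p (⊖ p)) (⊖-inverseˡ p)

  scale-cong : ∀ {a b p q} → a ≈ b → p ≋ q → scale a p ≋ scale b q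
  scale-cong {a} {b} {p} {q} a≈b e .at n =
    trans (coeff-scale a p n) (trans (*-cong a≈b (at e n)) (sym (coeff-scale b q n)))

  scale-⊕ : ∀ a p q → scale a (p ⊕ q) ≋ scale a p ⊕ scale a q
  scale-⊕ a p q .at n = begin
    coeff (scale a (p ⊕ q)) n                   ≈⟨ coeff-scale a (p ⊕ q) n ⟩
    a * coeff (p ⊕ q) n                         ≈⟨ *-congˡ (coeff-⊕ p q n) ⟩
    a * (coeff p n + coeff q n)                 ≈⟨ distribˡ _ _ _ ⟩
    a * coeff p n + a * coeff q n               ≈⟨ +-cong (coeff-scale a p n) (coeff-scale a q n) ⟨
    coeff (scale a p) n + coeff (scale a q) n   ≈⟨ coeff-⊕ (scale a p) (scale a q) n ⟨
    coeff (scale a p ⊕ scale a q) n             ∎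
    where open SetoidReasoning setoid

  scale-scale : ∀ a b p → scale (a * b) p ≋ scale a (scale b p)
  scale-scale a b p .at n = begin
    coeff (scale (a * b) p) n       ≈⟨ coeff-scale (a * b) p n ⟩
    a * b * coeff p n               ≈⟨ *-assoc _ _ _ ⟩
    a * (b * coeff p n)             ≈⟨ *-congˡ (coeff-scale b p n) ⟨
    a * coeff (scale b p) n         ≈⟨ coeff-scale a (scale b p) n ⟨
    coeff (scale a (scale b p)) n   ∎
    where open SetoidReasoning setoid

  scale-0 : ∀ p → scale 0# p ≋ []
  scale-0 p .at n = trans (coeff-scale 0# p n) (zeroˡ _)

  scale-1 : ∀ p → scale 1# p ≋ p
  scale-1 p .at n = trans (coeff-scale 1# p n) (*-identityˡ _)

  ⊕-interchange : ∀ p q r s → (p ⊕ q) ⊕ (r ⊕ s) ≋ (p ⊕ r) ⊕ (q ⊕ s)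
  ⊕-interchange p q r s .at n = begin
    coeff ((p ⊕ q) ⊕ (r ⊕ s)) n
      ≈⟨ trans (coeff-⊕ (p ⊕ q) (r ⊕ s) n) (+-cong (coeff-⊕ p q n) (coeff-⊕ r s n)) ⟩
    (coeff p n + coeff q n) + (coeff r n + coeff s n)
      ≈⟨ solve 4 (λ x y z w → (x :+ y) :+ (z :+ w) := (x :+ z) :+ (y :+ w)) refl _ _ _ _ ⟩
    (coeff p n + coeff r n) + (coeff q n + coeff s n)
      ≈⟨ trans (coeff-⊕ (p ⊕ r) (q ⊕ s) n) (+-cong (coeff-⊕ p r n) (coeff-⊕ q s n)) ⟨
    coeff ((p ⊕ r) ⊕ (q ⊕ s)) n ∎
    where open SetoidReasoning setoid

  ⊛-congˡ : ∀ p {q q′} → q ≋ q′ → p ⊛ q ≋ p ⊛ q′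
  ⊛-congˡ []      e = ≋-refl
  ⊛-congˡ (a ∷ p) e = ⊕-cong (scale-cong refl e) (∷-cong refl (⊛-congˡ p e))

  ⊛-zeroʳ : ∀ p → p ⊛ [] ≋ []
  ⊛-zeroʳ []      = ≋-refl
  ⊛-zeroʳ (a ∷ p) = ∷-≋[] refl (⊛-zeroʳ p)

  ⊛-distribˡ : ∀ p q r → p ⊛ (q ⊕ r) ≋ (p ⊛ q) ⊕ (p ⊛ r)
  ⊛-distribˡ []      q r = ≋-refl
  ⊛-distribˡ (a ∷ p) q r = ≋-trans
    (⊕-cong (scale-⊕ a q r) (∷-cong (sym (+-identityˡ 0#)) (⊛-distribˡ p q r)))
    (⊕-interchange (scale a q) (scale a r) (0# ∷ (p ⊛ q)) (0# ∷ (p ⊛ r)))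

  ⊛-∷ : ∀ p b q → p ⊛ (b ∷ q) ≋ scale b p ⊕ (0# ∷ (p ⊛ q))
  ⊛-∷ []      b q = ≋-sym (∷-≋[] refl ≋-refl)
  ⊛-∷ (a ∷ p) b q = ∷-cong (+-congʳ (*-comm a b))
    (≋-trans (⊕-cong (≋-refl {scale a q}) (⊛-∷ p b q))
    (≋-trans (≋-sym (⊕-assoc (scale a q) (scale b p) _))
    (≋-trans (⊕-cong (⊕-comm (scale a q) (scale b p)) ≋-refl)
             (⊕-assoc (scale b p) (scale a q) _))))

  ⊛-comm : ∀ p q → p ⊛ q ≋ q ⊛ p
  ⊛-comm []      q = ≋-sym (⊛-zeroʳ q)
  ⊛-comm (a ∷ p) q = ≋-trans
    (⊕-cong (≋-refl {scale a q}) (∷-cong refl (⊛-comm p q)))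
    (≋-sym (⊛-∷ q a p))

  ⊛-congʳ : ∀ {p p′} q → p ≋ p′ → p ⊛ q ≋ p′ ⊛ q
  ⊛-congʳ {p} {p′} q e =
    ≋-trans (⊛-comm p q) (≋-trans (⊛-congˡ q e) (⊛-comm q p′))

  ⊛-cong : ∀ {p p′ q q′} → p ≋ p′ → q ≋ q′ → p ⊛ q ≋ p′ ⊛ q′
  ⊛-cong {p′ = p′} {q = q} e f = ≋-trans (⊛-congʳ q e) (⊛-congˡ p′ f)

  ⊛-distribʳ : ∀ r p q → (p ⊕ q) ⊛ r ≋ (p ⊛ r) ⊕ (q ⊛ r)
  ⊛-distribʳ r p q = ≋-trans (⊛-comm (p ⊕ q) r)
    (≋-trans (⊛-distribˡ r p q) (⊕-cong (⊛-comm r p) (⊛-comm r q)))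

  scale-⊛ : ∀ a q r → scale a q ⊛ r ≋ scale a (q ⊛ r)
  scale-⊛ a []      r = ≋-refl
  scale-⊛ a (b ∷ q) r = ≋-trans
    (⊕-cong (scale-scale a b r) (∷-cong (sym (zeroʳ a)) (scale-⊛ a q r)))
    (≋-sym (scale-⊕ a (scale b r) (0# ∷ (q ⊛ r))))

  ⊛-assoc : ∀ p q r → (p ⊛ q) ⊛ r ≋ p ⊛ (q ⊛ r)
  ⊛-assoc []      q r = ≋-refl
  ⊛-assoc (a ∷ p) q r = ≋-trans
    (⊛-distribʳ r (scale a q) (0# ∷ (p ⊛ q)))
    (⊕-cong (scale-⊛ a q r)
            (⊕-cong (scale-0 r) (∷-cong refl (⊛-assoc p q r))))

  ⊛-identityˡ : ∀ p → const 1# ⊛ p ≋ p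
  ⊛-identityˡ p = ≋-trans
    (⊕-cong (scale-1 p) (∷-≋[] refl ≋-refl)) (⊕-identityʳ p)

  polynomialRing : CommutativeRing c ℓ
  polynomialRing = record
    { Carrier = Poly
    ; _≈_ = _≋_
    ; _+_ = _⊕_
    ; _*_ = _⊛_
    ; -_  = ⊖_
    ; 0#  = []
    ; 1#  = const 1#
    ; isCommutativeRing = record
      { isRing = record
        { +-isAbelianGroup = record
          { isGroup = record
            { isMonoid = record
              { isSemigroup = record
                { isMagma = record
                  { isEquivalence = record
                    { refl = ≋-refl ; sym = ≋-sym ; trans = ≋-trans }
                  ; ∙-cong = ⊕-cong
                  }
                ; assoc = ⊕-assoc
                }
              ; identity = (λ _ → ≋-refl) , ⊕-identityʳ
              }
            ; inverse = ⊖-inverseˡ , ⊖-inverseʳ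
            ; ⁻¹-cong = ⊖-cong
            }
          ; comm = ⊕-comm
          }
        ; *-cong = ⊛-cong
        ; *-assoc = ⊛-assoc
        ; *-identity = ⊛-identityˡ
                     , λ p → ≋-trans (⊛-comm p (const 1#)) (⊛-identityˡ p)
        ; distrib = ⊛-distribˡ , ⊛-distribʳ
        }
      ; *-comm = ⊛-comm
      }
    }

  eval : Carrier → Poly → Carrier
  eval a []      = 0#
  eval a (b ∷ p) = b + a * eval a p

  eval-≋[] : ∀ a p → p ≋ [] → eval a p ≈ 0#
  eval-≋[] a []      e = refl
  eval-≋[] a (b ∷ p) e =
    trans (+-cong (at e zero) (*-congˡ (eval-≋[] a p (tail-≋[] e))))
          (trans (+-identityˡ _) (zeroʳ a))

  eval-cong : ∀ a {p q} → p ≋ q → eval a p ≈ eval a q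
  eval-cong a {[]}    {q}     e = sym (eval-≋[] a q (≋-sym e))
  eval-cong a {x ∷ p} {[]}    e = eval-≋[] a (x ∷ p) e
  eval-cong a {x ∷ p} {y ∷ q} e =
    +-cong (head-≈ e) (*-congˡ (eval-cong a (tail-≋ e)))

  eval-⊕ : ∀ a p q → eval a (p ⊕ q) ≈ eval a p + eval a q
  eval-⊕ a []      q       = sym (+-identityˡ _)
  eval-⊕ a (x ∷ p) []      = sym (+-identityʳ _)
  eval-⊕ a (x ∷ p) (y ∷ q) = trans (+-congˡ (*-congˡ (eval-⊕ a p q)))
    (solve 5 (λ a x y u v → (x :+ y) :+ a :* (u :+ v) := (x :+ a :* u) :+ (y :+ a :* v))
       refl a x y (eval a p) (eval a q))

  eval-scale : ∀ a b p → eval a (scale b p) ≈ b * eval a p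
  eval-scale a b []      = sym (zeroʳ b)
  eval-scale a b (x ∷ p) = trans (+-congˡ (*-congˡ (eval-scale a b p)))
    (solve 4 (λ a b x u → b :* x :+ a :* (b :* u) := b :* (x :+ a :* u))
       refl a b x (eval a p))

  eval-⊛ : ∀ a p q → eval a (p ⊛ q) ≈ eval a p * eval a q
  eval-⊛ a []      q = sym (zeroˡ _)
  eval-⊛ a (x ∷ p) q = trans (eval-⊕ a (scale x q) (0# ∷ (p ⊛ q)))
    (trans (+-cong (eval-scale a x q) (+-congˡ (*-congˡ (eval-⊛ a p q))))
    (solve 4 (λ a x u v → x :* v :+ (con 0 :+ a :* (u :* v)) := (x :+ a :* u) :* v)
       refl a x (eval a p) (eval a q)))

  eval-⊖ : ∀ a p → eval a (⊖ p) ≈ - eval a p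
  eval-⊖ a p = inverseʳ-unique _ _
    (trans (sym (eval-⊕ a p (⊖ p))) (eval-≋[] a (p ⊕ (⊖ p)) (⊖-inverseʳ p)))

  eval-const : ∀ a b → eval a (const b) ≈ b
  eval-const a b = trans (+-congˡ (zeroʳ a)) (+-identityʳ b)

  eval-isRingHomomorphism : ∀ a →
    RingMorphisms.IsRingHomomorphism (CommutativeRing.rawRing polynomialRing) rawRing (eval a)
  eval-isRingHomomorphism a = record
    { isSemiringHomomorphism = record
      { isNearSemiringHomomorphism = record
        { +-isMonoidHomomorphism = record
          { isMagmaHomomorphism = record
            { isRelHomomorphism = record { cong = eval-cong a }
            ; homo = eval-⊕ a
            }
          ; ε-homo = refl
          }
        ; *-homo = eval-⊛ a
        }
      ; 1#-homo = eval-const a 1#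
      }
    ; -‿homo = eval-⊖ a
    }

  NonConstant : Poly → Set (c ⊔ ℓ)
  NonConstant p = ¬ (∃[ a ] p ≋ const a)

  -- quot a p is the quotient of p by t - a, by synthetic division.

  t-_ : Carrier → Poly
  t- a = - a ∷ 1# ∷ []

  private
    horner : Carrier → Poly → Poly
    horner a []      = []
    horner a (b ∷ p) = eval a (b ∷ p) ∷ horner a p

  quot : Carrier → Poly → Poly
  quot a []      = []
  quot a (b ∷ p) = horner a p

  private
    length-horner : ∀ a p → length (horner a p) ≡ length p
    length-horner a []      = ≡.refl
    length-horner a (b ∷ p) = ≡.cong suc (length-horner a p)

    coeff-horner-0 : ∀ a p → coeff (horner a p) 0 ≈ eval a p
    coeff-horner-0 a []      = refl
    coeff-horner-0 a (b ∷ p) = refl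

    coeff-horner : ∀ a p n →
      coeff (horner a p) n ≈ coeff p n + a * coeff (horner a p) (suc n)
    coeff-horner a []      n       = sym (trans (+-identityˡ _) (zeroʳ a))
    coeff-horner a (b ∷ p) zero    = +-congˡ (*-congˡ (sym (coeff-horner-0 a p)))
    coeff-horner a (b ∷ p) (suc n) = coeff-horner a p n

    coeff-t-⊛-0 : ∀ a q → coeff ((t- a) ⊛ q) 0 ≈ - a * coeff q 0
    coeff-t-⊛-0 a q =
      trans (coeff-⊕ (scale (- a) q) _ 0)
            (trans (+-identityʳ _) (coeff-scale (- a) q 0))

    coeff-t-⊛ : ∀ a q n →
      coeff ((t- a) ⊛ q) (suc n) ≈ - a * coeff q (suc n) + coeff q n
    coeff-t-⊛ a q n =
      trans (coeff-⊕ (scale (- a) q) _ (suc n))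
            (+-cong (coeff-scale (- a) q (suc n)) (at (⊛-identityˡ q) n))

    cancel-* : ∀ a x y → x ≈ - a * y + (x + a * y)
    cancel-* a x y = sym (begin
      - a * y + (x + a * y)   ≈⟨ +-congʳ (-‿distribˡ-* a y) ⟨
      - (a * y) + (x + a * y) ≈⟨ +-congˡ (+-comm _ _) ⟩
      - (a * y) + (a * y + x) ≈⟨ +-assoc _ _ _ ⟨
      - (a * y) + a * y + x   ≈⟨ +-congʳ (-‿inverseˡ _) ⟩
      0# + x                  ≈⟨ +-identityˡ x ⟩
      x                       ∎)
      where open SetoidReasoning setoid

  length-quot : ∀ a p n → length p ℕ.≤ suc n → length (quot a p) ℕ.≤ n
  length-quot a []      n le       = z≤n
  length-quot a (b ∷ p) n (s≤s le) = ≡.subst (ℕ._≤ n) (≡.sym (length-horner a p)) le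

  factor : ∀ a p → eval a p ≈ 0# → p ≋ (t- a) ⊛ quot a p
  factor a []      e = ≋-sym (⊛-zeroʳ (t- a))
  factor a (b ∷ p) e .at zero    = begin
    b                                ≈⟨ cancel-* a b (eval a p) ⟩
    - a * eval a p + (b + a * eval a p) ≈⟨ +-congˡ e ⟩
    - a * eval a p + 0#              ≈⟨ +-identityʳ _ ⟩
    - a * eval a p                   ≈⟨ *-congˡ (coeff-horner-0 a p) ⟨
    - a * coeff (horner a p) 0       ≈⟨ coeff-t-⊛-0 a (horner a p) ⟨
    coeff ((t- a) ⊛ horner a p) 0    ∎
    where open SetoidReasoning setoid
  factor a (b ∷ p) e .at (suc n) = begin
    coeff p n
      ≈⟨ cancel-* a (coeff p n) _ ⟩
    - a * coeff (horner a p) (suc n) + (coeff p n + a * coeff (horner a p) (suc n))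
      ≈⟨ +-congˡ (coeff-horner a p n) ⟨
    - a * coeff (horner a p) (suc n) + coeff (horner a p) n
      ≈⟨ coeff-t-⊛ a (horner a p) n ⟨
    coeff ((t- a) ⊛ horner a p) (suc n) ∎
    where open SetoidReasoning setoid

  module _
    (≟0 : ∀ x → Dec (x ≈ 0#))
    (integral : ∀ x y → x * y ≈ 0# → x ≈ 0# ⊎ y ≈ 0#)
    where

    private
      drop-0 : ∀ {a} p q → a ≈ 0# → (a ∷ p) ⊛ q ≋ [] → p ⊛ q ≋ []
      drop-0 {a} p q a≈0 e = tail-≋[] (≋-trans (≋-sym
        (⊕-cong {scale a q} (≋-trans (scale-cong a≈0 ≋-refl) (scale-0 q)) ≋-refl)) e)

      cancel-≉0 : ∀ {a} p q → ¬ a ≈ 0# → (a ∷ p) ⊛ q ≋ [] → q ≋ []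
      cancel-≉0     p []      a≉0 e = ≋-refl
      cancel-≉0 {a} p (b ∷ q) a≉0 e
        with integral a b (trans (sym (+-identityʳ _)) (at e zero))
      ... | inj₁ a≈0 = ⊥-elim (a≉0 a≈0)
      ... | inj₂ b≈0 = ∷-≋[] b≈0 (cancel-≉0 p q a≉0
        (≋-trans (⊛-comm (a ∷ p) q)
          (drop-0 q (a ∷ p) b≈0 (≋-trans (⊛-comm (b ∷ q) (a ∷ p)) e))))

    ⊛-integral : ∀ p q → p ⊛ q ≋ [] → p ≋ [] ⊎ q ≋ []
    ⊛-integral []      q e = inj₁ ≋-refl
    ⊛-integral (a ∷ p) q e with ≟0 a
    ... | yes a≈0 = [ inj₁ ∘ ∷-≋[] a≈0 , inj₂ ]′ (⊛-integral p q (drop-0 p q a≈0 e))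
    ... | no  a≉0 = inj₂ (cancel-≉0 p q a≉0 e)

module Fraction
  (R : CommutativeRing c ℓ)
  (1≉0 : ¬ CommutativeRing._≈_ R (CommutativeRing.1# R) (CommutativeRing.0# R))
  (integral : ∀ x y →
    CommutativeRing._≈_ R (CommutativeRing._*_ R x y) (CommutativeRing.0# R) →
    CommutativeRing._≈_ R x (CommutativeRing.0# R) ⊎ CommutativeRing._≈_ R y (CommutativeRing.0# R))
  where

  open CommutativeRing R
  open GroupProperties +-group using (x∙y⁻¹≈ε⇒x≈y)
  open RingProperties ring using (-‿distribˡ-*)
  open SemiringSolver commutativeSemiring using (solve; _:=_; _:+_; _:*_; con)
  open SetoidReasoning setoid

  infixl 7 _//_[_]

  record Frac : Set (c ⊔ ℓ) where
    constructor _//_[_]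
    field
      num   : Carrier
      den   : Carrier
      den≉0 : ¬ den ≈ 0#

  open Frac public

  infix 4 _≃_

  record _≃_ (x y : Frac) : Set ℓ where
    constructor cross
    field
      uncross : num x * den y ≈ num y * den x

  open _≃_ public

  *-≉0 : ∀ {x y} → ¬ x ≈ 0# → ¬ y ≈ 0# → ¬ x * y ≈ 0#
  *-≉0 x≉0 y≉0 e = [ x≉0 , y≉0 ]′ (integral _ _ e)

  cancelʳ : ∀ {x y z} → ¬ z ≈ 0# → x * z ≈ y * z → x ≈ y
  cancelʳ {x} {y} {z} z≉0 e = [ x∙y⁻¹≈ε⇒x≈y x y , (λ z≈0 → ⊥-elim (z≉0 z≈0)) ]′
    (integral (x + - y) z (begin
      (x + - y) * z     ≈⟨ distribʳ z x (- y) ⟩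
      x * z + - y * z   ≈⟨ +-cong e (sym (-‿distribˡ-* y z)) ⟩
      y * z + - (y * z) ≈⟨ -‿inverseʳ _ ⟩
      0#                ∎))

  embed : Carrier → Frac
  embed x = x // 1# [ 1≉0 ]

  embed-injective : ∀ {x y} → embed x ≃ embed y → x ≈ y
  embed-injective e = cancelʳ 1≉0 (uncross e)

  infixl 6 _⊞_
  infixl 7 _⊠_

  _⊞_ : Frac → Frac → Frac
  x ⊞ y = (num x * den y + num y * den x) // (den x * den y) [ *-≉0 (den≉0 x) (den≉0 y) ]

  _⊠_ : Frac → Frac → Frac
  x ⊠ y = (num x * num y) // (den x * den y) [ *-≉0 (den≉0 x) (den≉0 y) ]

  ⊟_ : Frac → Frac
  ⊟ x = (- num x) // den x [ den≉0 x ]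

  ≃-refl : ∀ {x} → x ≃ x
  ≃-refl = cross refl

  ≃-sym : ∀ {x y} → x ≃ y → y ≃ x
  ≃-sym e = cross (sym (uncross e))

  ≃-trans : ∀ {x y z} → x ≃ y → y ≃ z → x ≃ z
  ≃-trans {a // b [ _ ]} {p // q [ q≉0 ]} {r // s [ _ ]} (cross e) (cross f) =
    cross (cancelʳ q≉0 (begin
      a * s * q ≈⟨ solve 3 (λ a s q → a :* s :* q := a :* q :* s) refl a s q ⟩
      a * q * s ≈⟨ *-congʳ e ⟩
      p * b * s ≈⟨ solve 3 (λ p b s → p :* b :* s := p :* s :* b) refl p b s ⟩
      p * s * b ≈⟨ *-congʳ f ⟩
      r * q * b ≈⟨ solve 3 (λ r q b → r :* q :* b := r :* b :* q) refl r q b ⟩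
      r * b * q ∎))

  ⊞-cong : ∀ {x x′ y y′} → x ≃ x′ → y ≃ y′ → x ⊞ y ≃ x′ ⊞ y′
  ⊞-cong {a // b [ _ ]} {a′ // b′ [ _ ]} {p // q [ _ ]} {p′ // q′ [ _ ]} (cross e) (cross f) =
    cross (begin
      (a * q + p * b) * (b′ * q′)
        ≈⟨ solve 6 (λ a b p q b′ q′ → (a :* q :+ p :* b) :* (b′ :* q′)
                      := (a :* b′) :* (q :* q′) :+ (p :* q′) :* (b :* b′)) refl a b p q b′ q′ ⟩
      (a * b′) * (q * q′) + (p * q′) * (b * b′)
        ≈⟨ +-cong (*-congʳ e) (*-congʳ f) ⟩
      (a′ * b) * (q * q′) + (p′ * q) * (b * b′)
        ≈⟨ solve 6 (λ a b p q b′ q′ → (a :* b′) :* (q′ :* q) :+ (p :* q′) :* (b′ :* b)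
                      := (a :* q :+ p :* b) :* (b′ :* q′)) refl a′ b′ p′ q′ b q ⟩
      (a′ * q′ + p′ * b′) * (b * q) ∎)

  ⊠-cong : ∀ {x x′ y y′} → x ≃ x′ → y ≃ y′ → x ⊠ y ≃ x′ ⊠ y′
  ⊠-cong {a // b [ _ ]} {a′ // b′ [ _ ]} {p // q [ _ ]} {p′ // q′ [ _ ]} (cross e) (cross f) =
    cross (begin
      (a * p) * (b′ * q′) ≈⟨ interchange a p b′ q′ ⟩
      (a * b′) * (p * q′) ≈⟨ *-cong e f ⟩
      (a′ * b) * (p′ * q) ≈⟨ interchange a′ b p′ q ⟩
      (a′ * p′) * (b * q) ∎)
    where
    interchange : ∀ w x y z → (w * x) * (y * z) ≈ (w * y) * (x * z)
    interchange = solve 4 (λ w x y z → (w :* x) :* (y :* z) := (w :* y) :* (x :* z)) refl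

  ⊟-cong : ∀ {x y} → x ≃ y → ⊟ x ≃ ⊟ y
  ⊟-cong (cross e) =
    cross (trans (sym (-‿distribˡ-* _ _)) (trans (-‿cong e) (-‿distribˡ-* _ _)))

  ⊞-assoc : ∀ x y z → (x ⊞ y) ⊞ z ≃ x ⊞ (y ⊞ z)
  ⊞-assoc (a // b [ _ ]) (p // q [ _ ]) (r // s [ _ ]) = cross
    (solve 6 (λ a b p q r s →
        ((a :* q :+ p :* b) :* s :+ r :* (b :* q)) :* (b :* (q :* s))
        := (a :* (q :* s) :+ (p :* s :+ r :* q) :* b) :* ((b :* q) :* s))
      refl a b p q r s)

  ⊞-comm : ∀ x y → x ⊞ y ≃ y ⊞ x
  ⊞-comm (a // b [ _ ]) (p // q [ _ ]) = cross
    (solve 4 (λ a b p q → (a :* q :+ p :* b) :* (q :* b) := (p :* b :+ a :* q) :* (b :* q))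
      refl a b p q)

  ⊞-identityˡ : ∀ x → embed 0# ⊞ x ≃ x
  ⊞-identityˡ (a // b [ _ ]) = cross
    (solve 2 (λ a b → (con 0 :* b :+ a :* con 1) :* b := a :* (con 1 :* b)) refl a b)

  ⊟-inverseˡ : ∀ x → (⊟ x) ⊞ x ≃ embed 0#
  ⊟-inverseˡ (a // b [ _ ]) = cross (begin
    (- a * b + a * b) * 1# ≈⟨ *-congʳ (distribʳ b (- a) a) ⟨
    ((- a + a) * b) * 1#   ≈⟨ *-congʳ (*-congʳ (-‿inverseˡ a)) ⟩
    (0# * b) * 1#          ≈⟨ solve 1 (λ b → (con 0 :* b) :* con 1 := con 0 :* (b :* b)) refl b ⟩
    0# * (b * b)           ∎)

  ⊠-assoc : ∀ x y z → (x ⊠ y) ⊠ z ≃ x ⊠ (y ⊠ z)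
  ⊠-assoc (a // b [ _ ]) (p // q [ _ ]) (r // s [ _ ]) = cross
    (solve 6 (λ a b p q r s → ((a :* p) :* r) :* (b :* (q :* s))
        := (a :* (p :* r)) :* ((b :* q) :* s)) refl a b p q r s)

  ⊠-comm : ∀ x y → x ⊠ y ≃ y ⊠ x
  ⊠-comm (a // b [ _ ]) (p // q [ _ ]) = cross
    (solve 4 (λ a b p q → (a :* p) :* (q :* b) := (p :* a) :* (b :* q)) refl a b p q)

  ⊠-identityˡ : ∀ x → embed 1# ⊠ x ≃ x
  ⊠-identityˡ (a // b [ _ ]) = cross
    (solve 2 (λ a b → (con 1 :* a) :* b := a :* (con 1 :* b)) refl a b)

  ⊠-distribˡ : ∀ x y z → x ⊠ (y ⊞ z) ≃ (x ⊠ y) ⊞ (x ⊠ z)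
  ⊠-distribˡ (a // b [ _ ]) (p // q [ _ ]) (r // s [ _ ]) = cross
    (solve 6 (λ a b p q r s →
        (a :* (p :* s :+ r :* q)) :* ((b :* q) :* (b :* s))
        := ((a :* p) :* (b :* s) :+ (a :* r) :* (b :* q)) :* (b :* (q :* s)))
      refl a b p q r s)

  fractionRing : CommutativeRing (c ⊔ ℓ) ℓ
  fractionRing = record
    { Carrier = Frac
    ; _≈_ = _≃_
    ; _+_ = _⊞_
    ; _*_ = _⊠_
    ; -_  = ⊟_
    ; 0#  = embed 0#
    ; 1#  = embed 1#
    ; isCommutativeRing = record
      { isRing = record
        { +-isAbelianGroup = record
          { isGroup = record
            { isMonoid = record
              { isSemigroup = record
                { isMagma = record
                  { isEquivalence = record
                    { refl = ≃-refl ; sym = ≃-sym ; trans = ≃-trans }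
                  ; ∙-cong = ⊞-cong
                  }
                ; assoc = ⊞-assoc
                }
              ; identity = ⊞-identityˡ
                         , λ x → ≃-trans (⊞-comm x (embed 0#)) (⊞-identityˡ x)
              }
            ; inverse = ⊟-inverseˡ , λ x → ≃-trans (⊞-comm x (⊟ x)) (⊟-inverseˡ x)
            ; ⁻¹-cong = ⊟-cong
            }
          ; comm = ⊞-comm
          }
        ; *-cong = ⊠-cong
        ; *-assoc = ⊠-assoc
        ; *-identity = ⊠-identityˡ
                     , λ x → ≃-trans (⊠-comm x (embed 1#)) (⊠-identityˡ x)
        ; distrib = ⊠-distribˡ
                  , λ x y z → ≃-trans (⊠-comm (y ⊞ z) x)
                      (≃-trans (⊠-distribˡ x y z) (⊞-cong (⊠-comm x y) (⊠-comm x z)))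
        }
      ; *-comm = ⊠-comm
      }
    }

  embed-cong : ∀ {x y} → x ≈ y → embed x ≃ embed y
  embed-cong e = cross (*-congʳ e)

  embed-clear : ∀ x d → embed (num x * d) ≃ x ⊠ embed (den x * d)
  embed-clear (a // b [ _ ]) d = cross
    (solve 3 (λ a b d → (a :* d) :* (b :* con 1) := (a :* (b :* d)) :* con 1) refl a b d)

  embed-cancel : ∀ {l X Z} x → ¬ l ≈ 0# →
                 embed (l * X) ≃ x ⊠ embed (l * Z) → embed X ≃ x ⊠ embed Z
  embed-cancel {l} {X} {Z} (a // b [ _ ]) l≉0 (cross e) = cross (cancelʳ l≉0 (begin
    X * (b * 1#) * l   ≈⟨ solve 3 (λ l X b → X :* (b :* con 1) :* l := l :* X :* (b :* con 1)) refl l X b ⟩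
    l * X * (b * 1#)   ≈⟨ e ⟩
    a * (l * Z) * 1#   ≈⟨ solve 3 (λ l Z a → a :* (l :* Z) :* con 1 := a :* Z :* con 1 :* l) refl l Z a ⟩
    a * Z * 1# * l     ∎))

  embed-proportional : ∀ {x x′ X Z X′ Z′} → x ≃ x′ →
    embed X ≃ x ⊠ embed Z → embed X′ ≃ x′ ⊠ embed Z′ → X * Z′ ≈ X′ * Z
  embed-proportional {a // b [ b≉0 ]} {p // q [ q≉0 ]} {X} {Z} {X′} {Z′} (cross e) (cross f) (cross g) =
    cancelʳ (*-≉0 b≉0 q≉0) (begin
      X * Z′ * (b * q)
        ≈⟨ solve 4 (λ X Z′ b q → X :* Z′ :* (b :* q) := X :* (b :* con 1) :* (Z′ :* q)) refl X Z′ b q ⟩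
      X * (b * 1#) * (Z′ * q)
        ≈⟨ *-congʳ f ⟩
      a * Z * 1# * (Z′ * q)
        ≈⟨ solve 4 (λ a Z Z′ q → a :* Z :* con 1 :* (Z′ :* q) := a :* q :* (Z :* Z′)) refl a Z Z′ q ⟩
      a * q * (Z * Z′)
        ≈⟨ *-congʳ e ⟩
      p * b * (Z * Z′)
        ≈⟨ solve 4 (λ p Z Z′ b → p :* b :* (Z :* Z′) := p :* Z′ :* con 1 :* (Z :* b)) refl p Z Z′ b ⟩
      p * Z′ * 1# * (Z * b)
        ≈⟨ *-congʳ g ⟨
      X′ * (q * 1#) * (Z * b)
        ≈⟨ solve 4 (λ X′ Z b q → X′ :* (q :* con 1) :* (Z :* b) := X′ :* Z :* (b :* q)) refl X′ Z b q ⟩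
      X′ * Z * (b * q) ∎)

  -- fractionRing is a field.

  ⊠-inverse : ∀ x → ¬ x ≃ embed 0# → ∃[ y ] x ⊠ y ≃ embed 1#
  ⊠-inverse (a // b [ b≉0 ]) x≄0 = b // a [ a≉0 ] , cross
    (solve 2 (λ a b → (a :* b) :* con 1 := con 1 :* (b :* a)) refl a b)
    where
    a≉0 : ¬ a ≈ 0#
    a≉0 a≈0 = x≄0 (cross (trans (*-identityʳ a) (trans a≈0 (sym (zeroˡ b)))))

  open RingMorphisms rawRing (CommutativeRing.rawRing fractionRing)

  embed-isRingHomomorphism : IsRingHomomorphism embed
  embed-isRingHomomorphism = record
    { isSemiringHomomorphism = record
      { isNearSemiringHomomorphism = record
        { +-isMonoidHomomorphism = record
          { isMagmaHomomorphism = record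
            { isRelHomomorphism = record { cong = λ e → cross (*-congʳ e) }
            ; homo = λ x y → cross (solve 2 (λ x y →
                (x :+ y) :* (con 1 :* con 1) := (x :* con 1 :+ y :* con 1) :* con 1)
                refl x y)
            }
          ; ε-homo = ≃-refl
          }
        ; *-homo = λ x y → cross (solve 2 (λ x y →
            (x :* y) :* (con 1 :* con 1) := (x :* y) :* con 1) refl x y)
        }
      ; 1#-homo = ≃-refl
      }
    ; -‿homo = λ x → ≃-refl
    }

record WeierstrassCurve (K : CommutativeRing c ℓ) : Set c where
  constructor weierstrass
  open CommutativeRing K
  field
    a₁ a₂ a₃ a₄ a₆ : Carrier

-- IsElliptic and Isomorphic are meaningful only when K is a field.

module Weierstrass {K : CommutativeRing c ℓ} (W : WeierstrassCurve K) where

  open CommutativeRing K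
  open WeierstrassCurve W
  open RawSemiringDefinitions (RawRing.rawSemiring rawRing) using () renaming (_×_ to _·_)

  Equation : Carrier → Carrier → Set ℓ
  Equation x y =
    y * y + a₁ * x * y + a₃ * y ≈ x * x * x + a₂ * (x * x) + a₄ * x + a₆

  Homogeneous : Carrier → Carrier → Carrier → Set ℓ
  Homogeneous X Y Z =
    Y * Y * Z + a₁ * X * Y * Z + a₃ * Y * Z * Z
      ≈ X * X * X + a₂ * X * X * Z + a₄ * X * Z * Z + a₆ * Z * Z * Z

  b₂ b₄ b₆ b₈ Δ : Carrier
  b₂ = a₁ * a₁ + 4 · a₂
  b₄ = 2 · a₄ + a₁ * a₃
  b₆ = a₃ * a₃ + 4 · a₆
  b₈ = a₁ * a₁ * a₆ + 4 · (a₂ * a₆) - a₁ * a₃ * a₄ + a₂ * a₃ * a₃ - a₄ * a₄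
  Δ  = - (b₂ * b₂ * b₈) - 8 · (b₄ * b₄ * b₄) - 27 · (b₆ * b₆) + 9 · (b₂ * b₄ * b₆)

  IsElliptic : Set ℓ
  IsElliptic = ¬ Δ ≈ 0#

  data Point : Set (c ⊔ ℓ) where
    O      : Point
    affine : (x y : Carrier) → Equation x y → Point

  infix 4 _≈ₚ_

  data _≈ₚ_ : Point → Point → Set (c ⊔ ℓ) where
    O≈O    : O ≈ₚ O
    affine : ∀ {x y x′ y′ eq eq′} → x ≈ x′ → y ≈ y′ →
             affine x y eq ≈ₚ affine x′ y′ eq′

open Weierstrass public using (Point; O; affine; IsElliptic; Equation)

-- Isomorphisms of Weierstrass curves over a field are exactly the
-- admissible substitutions x = u²x′ + r, y = u³y′ + su²x′ + t with
-- u ≠ 0 (Silverman, AEC, Prop. III.3.1(b) and Table III.3.1).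

record Isomorphic {K : CommutativeRing c ℓ} (W W′ : WeierstrassCurve K) : Set (c ⊔ ℓ) where
  open CommutativeRing K
  open RawSemiringDefinitions (RawRing.rawSemiring rawRing) using (_^_) renaming (_×_ to _·_)
  open WeierstrassCurve W
  open WeierstrassCurve W′ using () renaming
    (a₁ to a₁′; a₂ to a₂′; a₃ to a₃′; a₄ to a₄′; a₆ to a₆′)
  field
    u r s t : Carrier
    u≉0     : ¬ u ≈ 0#
    a₁-eq   : u * a₁′ ≈ a₁ + 2 · s
    a₂-eq   : u ^ 2 * a₂′ ≈ a₂ - s * a₁ + 3 · r - s * s
    a₃-eq   : u ^ 3 * a₃′ ≈ a₃ + r * a₁ + 2 · t
    a₄-eq   : u ^ 4 * a₄′ ≈ a₄ - s * a₃ + 2 · (r * a₂) - (t + r * s) * a₁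
                              + 3 · (r * r) - 2 · (s * t)
    a₆-eq   : u ^ 6 * a₆′ ≈ a₆ + r * a₄ + r * r * a₂ + r * r * r
                              - t * a₃ - t * t - r * t * a₁

mapCurve : {K : CommutativeRing c ℓ} {L : CommutativeRing c′ ℓ′} →
           (CommutativeRing.Carrier K → CommutativeRing.Carrier L) →
           WeierstrassCurve K → WeierstrassCurve L
mapCurve f (weierstrass a₁ a₂ a₃ a₄ a₆) =
  weierstrass (f a₁) (f a₂) (f a₃) (f a₄) (f a₆)

module _ (K : CommutativeRing c ℓ) where

  open CommutativeRing K
  open RingProperties ring using (-‿distribˡ-*; -‿distribʳ-*)
  open AbelianGroupProperties +-abelianGroup using (⁻¹-∙-comm; ⁻¹-involutive)
  open SemiringSolver commutativeSemiring using (solve; _:=_; _:+_; _:*_; con)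
  open SetoidReasoning setoid

  -- The cubic (x - e₁)(x - e₂)(x - e₃), expanded.

  fromRoots : (e₁ e₂ e₃ : Carrier) → WeierstrassCurve K
  fromRoots e₁ e₂ e₃ = record
    { a₁ = 0#
    ; a₂ = - (e₁ + e₂ + e₃)
    ; a₃ = 0#
    ; a₄ = e₁ * e₂ + e₁ * e₃ + e₂ * e₃
    ; a₆ = - (e₁ * e₂ * e₃)
    }

  private
    neg-neg : ∀ x y → - x * - y ≈ x * y
    neg-neg x y = trans (sym (-‿distribˡ-* x (- y)))
      (trans (-‿cong (sym (-‿distribʳ-* x y))) (⁻¹-involutive _))

    lhs : ∀ x y → y * y + 0# * x * y + 0# * y ≈ y * y
    lhs = solve 2 (λ x y → y :* y :+ con 0 :* x :* y :+ con 0 :* y := y :* y) refl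

    rhs : ∀ e₁ e₂ e₃ x →
      x * x * x + - (e₁ + e₂ + e₃) * (x * x) + (e₁ * e₂ + e₁ * e₃ + e₂ * e₃) * x + - (e₁ * e₂ * e₃)
        ≈ (x - e₁) * (x - e₂) * (x - e₃)
    rhs e₁ e₂ e₃ x = begin
      x * x * x + - (e₁ + e₂ + e₃) * (x * x) + (e₁ * e₂ + e₁ * e₃ + e₂ * e₃) * x + - (e₁ * e₂ * e₃)
        ≈⟨ +-cong (+-cong (+-congˡ (*-congʳ neg-sum)) (*-congʳ pairs)) (trans (-‿distribʳ-* _ _) (*-congʳ (sym (neg-neg e₁ e₂)))) ⟩
      x * x * x + (- e₁ + - e₂ + - e₃) * (x * x)
        + (- e₁ * - e₂ + - e₁ * - e₃ + - e₂ * - e₃) * x + - e₁ * - e₂ * - e₃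
        ≈⟨ solve 4 (λ f g h x →
              x :* x :* x :+ (f :+ g :+ h) :* (x :* x) :+ (f :* g :+ f :* h :+ g :* h) :* x :+ f :* g :* h
              := (x :+ f) :* (x :+ g) :* (x :+ h)) refl (- e₁) (- e₂) (- e₃) x ⟩
      (x - e₁) * (x - e₂) * (x - e₃) ∎
      where
      neg-sum : - (e₁ + e₂ + e₃) ≈ - e₁ + - e₂ + - e₃
      neg-sum = trans (sym (⁻¹-∙-comm _ _)) (+-congʳ (sym (⁻¹-∙-comm _ _)))
      pairs : e₁ * e₂ + e₁ * e₃ + e₂ * e₃ ≈ - e₁ * - e₂ + - e₁ * - e₃ + - e₂ * - e₃
      pairs = sym (+-cong (+-cong (neg-neg _ _) (neg-neg _ _)) (neg-neg _ _))

  fromRoots-equation : ∀ e₁ e₂ e₃ x y → Equation (fromRoots e₁ e₂ e₃) x y →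
                       y * y ≈ (x - e₁) * (x - e₂) * (x - e₃)
  fromRoots-equation e₁ e₂ e₃ x y eq =
    trans (sym (lhs x y)) (trans eq (rhs e₁ e₂ e₃ x))

  fromRoots-equation⁻¹ : ∀ e₁ e₂ e₃ x y → y * y ≈ (x - e₁) * (x - e₂) * (x - e₃) →
                         Equation (fromRoots e₁ e₂ e₃) x y
  fromRoots-equation⁻¹ e₁ e₂ e₃ x y eq =
    trans (lhs x y) (trans eq (sym (rhs e₁ e₂ e₃ x)))

module Homogenization {K : CommutativeRing c ℓ} (W : WeierstrassCurve K) where

  open CommutativeRing K
  open WeierstrassCurve W
  open Weierstrass W using (Homogeneous)
  open SemiringSolver commutativeSemiring using (solve; _:=_; _:+_; _:*_; con)
  open SetoidReasoning setoid

  private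
    L : Carrier → Carrier → Carrier → Carrier
    L X Y Z = Y * Y * Z + a₁ * X * Y * Z + a₃ * Y * Z * Z

    R : Carrier → Carrier → Carrier
    R X Z = X * X * X + a₂ * X * X * Z + a₄ * X * Z * Z + a₆ * Z * Z * Z

    L-scale : ∀ w X Y Z → L (X * w) (Y * w) (Z * w) ≈ w * w * w * L X Y Z
    L-scale w X Y Z = solve 6 (λ a₁ a₃ w X Y Z →
        (Y :* w) :* (Y :* w) :* (Z :* w) :+ a₁ :* (X :* w) :* (Y :* w) :* (Z :* w) :+ a₃ :* (Y :* w) :* (Z :* w) :* (Z :* w)
        := w :* w :* w :* (Y :* Y :* Z :+ a₁ :* X :* Y :* Z :+ a₃ :* Y :* Z :* Z))
      refl a₁ a₃ w X Y Z

    R-scale : ∀ w X Z → R (X * w) (Z * w) ≈ w * w * w * R X Z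
    R-scale w X Z = solve 6 (λ a₂ a₄ a₆ w X Z →
        (X :* w) :* (X :* w) :* (X :* w) :+ a₂ :* (X :* w) :* (X :* w) :* (Z :* w)
          :+ a₄ :* (X :* w) :* (Z :* w) :* (Z :* w) :+ a₆ :* (Z :* w) :* (Z :* w) :* (Z :* w)
        := w :* w :* w :* (X :* X :* X :+ a₂ :* X :* X :* Z :+ a₄ :* X :* Z :* Z :+ a₆ :* Z :* Z :* Z))
      refl a₂ a₄ a₆ w X Z

    L-1 : ∀ x y → L x y 1# ≈ y * y + a₁ * x * y + a₃ * y
    L-1 x y = solve 4 (λ a₁ a₃ x y →
        y :* y :* con 1 :+ a₁ :* x :* y :* con 1 :+ a₃ :* y :* con 1 :* con 1
        := y :* y :+ a₁ :* x :* y :+ a₃ :* y) refl a₁ a₃ x y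

    R-1 : ∀ x → R x 1# ≈ x * x * x + a₂ * (x * x) + a₄ * x + a₆
    R-1 x = solve 4 (λ a₂ a₄ a₆ x →
        x :* x :* x :+ a₂ :* x :* x :* con 1 :+ a₄ :* x :* con 1 :* con 1 :+ a₆ :* con 1 :* con 1 :* con 1
        := x :* x :* x :+ a₂ :* (x :* x) :+ a₄ :* x :+ a₆) refl a₂ a₄ a₆ x

    L-cong : ∀ {X X′ Y Y′ Z Z′} → X ≈ X′ → Y ≈ Y′ → Z ≈ Z′ → L X Y Z ≈ L X′ Y′ Z′
    L-cong p q r = +-cong (+-cong (*-cong (*-cong q q) r) (*-cong (*-cong (*-congˡ p) q) r))
                          (*-cong (*-cong (*-congˡ q) r) r)

    R-cong : ∀ {X X′ Z Z′} → X ≈ X′ → Z ≈ Z′ → R X Z ≈ R X′ Z′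
    R-cong p r = +-cong (+-cong (+-cong (*-cong (*-cong p p) p)
                     (*-cong (*-cong (*-congˡ p) p) r))
                     (*-cong (*-cong (*-congˡ p) r) r))
                     (*-cong (*-cong (*-congˡ r) r) r)

  homogenize : ∀ x y X Y Z → Equation W x y → X ≈ x * Z → Y ≈ y * Z → Homogeneous X Y Z
  homogenize x y X Y Z eq X≈xZ Y≈yZ = begin
    L X Y Z                                       ≈⟨ L-cong X≈xZ Y≈yZ (sym (*-identityˡ Z)) ⟩
    L (x * Z) (y * Z) (1# * Z)                    ≈⟨ L-scale Z x y 1# ⟩
    Z * Z * Z * L x y 1#                          ≈⟨ *-congˡ (trans (L-1 x y) (trans eq (sym (R-1 x)))) ⟩
    Z * Z * Z * R x 1#                            ≈⟨ R-scale Z x 1# ⟨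
    R (x * Z) (1# * Z)                            ≈⟨ R-cong X≈xZ (sym (*-identityˡ Z)) ⟨
    R X Z                                         ∎

  dehomogenize : ∀ X Y Z w → Homogeneous X Y Z → Z * w ≈ 1# → Equation W (X * w) (Y * w)
  dehomogenize X Y Z w h Zw≈1 = trans (sym (L-1 (X * w) (Y * w))) (trans (begin
    L (X * w) (Y * w) 1#        ≈⟨ L-cong refl refl Zw≈1 ⟨
    L (X * w) (Y * w) (Z * w)   ≈⟨ L-scale w X Y Z ⟩
    w * w * w * L X Y Z         ≈⟨ *-congˡ h ⟩
    w * w * w * R X Z           ≈⟨ R-scale w X Z ⟨
    R (X * w) (Z * w)           ≈⟨ R-cong refl Zw≈1 ⟩
    R (X * w) 1#                ∎) (R-1 (X * w)))

module _
  {K : CommutativeRing c ℓ} {L : CommutativeRing c′ ℓ′}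
  {f : CommutativeRing.Carrier K → CommutativeRing.Carrier L}
  (f-hom : RingMorphisms.IsRingHomomorphism (CommutativeRing.rawRing K) (CommutativeRing.rawRing L) f)
  (W : WeierstrassCurve K)
  where

  private
    module K = CommutativeRing K
    module L = CommutativeRing L

  open RingMorphisms.IsRingHomomorphism f-hom
  open WeierstrassCurve W
  open L using (_≈_; sym; trans)

  private
    *³ : ∀ x y z → f (x K.* y K.* z) ≈ f x L.* f y L.* f z
    *³ x y z = trans (*-homo _ _) (L.*-congʳ (*-homo _ _))

    *⁴ : ∀ x y z w → f (x K.* y K.* z K.* w) ≈ f x L.* f y L.* f z L.* f w
    *⁴ x y z w = trans (*-homo _ _) (L.*-congʳ (*³ x y z))

    +-hom : ∀ {x y x′ y′} → f x ≈ x′ → f y ≈ y′ → f (x K.+ y) ≈ x′ L.+ y′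
    +-hom p q = trans (+-homo _ _) (L.+-cong p q)

    lhs : ∀ X Y Z → f (Y K.* Y K.* Z K.+ a₁ K.* X K.* Y K.* Z K.+ a₃ K.* Y K.* Z K.* Z)
          ≈ f Y L.* f Y L.* f Z L.+ f a₁ L.* f X L.* f Y L.* f Z L.+ f a₃ L.* f Y L.* f Z L.* f Z
    lhs X Y Z = +-hom (+-hom (*³ _ _ _) (*⁴ _ _ _ _)) (*⁴ _ _ _ _)

    rhs : ∀ X Z → f (X K.* X K.* X K.+ a₂ K.* X K.* X K.* Z K.+ a₄ K.* X K.* Z K.* Z K.+ a₆ K.* Z K.* Z K.* Z)
          ≈ f X L.* f X L.* f X L.+ f a₂ L.* f X L.* f X L.* f Z L.+ f a₄ L.* f X L.* f Z L.* f Z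
              L.+ f a₆ L.* f Z L.* f Z L.* f Z
    rhs X Z = +-hom (+-hom (+-hom (*³ _ _ _) (*⁴ _ _ _ _)) (*⁴ _ _ _ _)) (*⁴ _ _ _ _)

  homogeneous-map : ∀ X Y Z → Weierstrass.Homogeneous W X Y Z →
    Weierstrass.Homogeneous (mapCurve {K = K} {L = L} f W) (f X) (f Y) (f Z)
  homogeneous-map X Y Z h =
    trans (sym (lhs X Y Z)) (trans (⟦⟧-cong h) (rhs X Z))

  homogeneous-unmap : (∀ {x y} → f x ≈ f y → x K.≈ y) → ∀ X Y Z →
    Weierstrass.Homogeneous (mapCurve {K = K} {L = L} f W) (f X) (f Y) (f Z) →
    Weierstrass.Homogeneous W X Y Z
  homogeneous-unmap f-inj X Y Z h =
    f-inj (trans (lhs X Y Z) (trans h (sym (rhs X Z))))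

module ℤ[t] = Polynomial ℤₚ.+-*-commutativeRing
module ℚ[t] = Polynomial ℚₚ.+-*-commutativeRing

ℤ[t]-ring ℚ[t]-ring : CommutativeRing 0ℓ 0ℓ
ℤ[t]-ring = ℤ[t].polynomialRing
ℚ[t]-ring = ℚ[t].polynomialRing

ℤ[t] ℚ[t] : Set
ℤ[t] = ℤ[t].Poly
ℚ[t] = ℚ[t].Poly

private
  ℚ-ring : CommutativeRing 0ℓ 0ℓ
  ℚ-ring = ℚₚ.+-*-commutativeRing

ℚ-inverse : ∀ {p} → p ≢ 0ℚ → ∃[ q ] p ℚ.* q ≡ 1ℚ
ℚ-inverse {p} p≢0 = (ℚ.1/ p) {{ℚ.≢-nonZero p≢0}} , ℚₚ.*-inverseʳ p {{ℚ.≢-nonZero p≢0}}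

ℚ-integral : ∀ p q → p ℚ.* q ≡ 0ℚ → p ≡ 0ℚ ⊎ q ≡ 0ℚ
ℚ-integral p q pq≡0 with p ℚₚ.≟ 0ℚ
... | yes p≡0 = inj₁ p≡0
... | no  p≢0 with ℚ-inverse p≢0
...   | r , pr≡1 = inj₂ (begin
    q                 ≡⟨ ℚₚ.*-identityʳ q ⟨
    q ℚ.* 1ℚ          ≡⟨ ≡.cong (q ℚ.*_) pr≡1 ⟨
    q ℚ.* (p ℚ.* r)   ≡⟨ ℚₚ.*-assoc q p r ⟨
    q ℚ.* p ℚ.* r     ≡⟨ ≡.cong (ℚ._* r) (ℚₚ.*-comm q p) ⟩
    p ℚ.* q ℚ.* r     ≡⟨ ≡.cong (ℚ._* r) pq≡0 ⟩
    0ℚ ℚ.* r          ≡⟨ ℚₚ.*-zeroˡ r ⟩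
    0ℚ                ∎)
  where open ≡.≡-Reasoning

ℚ[t]-1≉0 : ¬ ℚ[t].const 1ℚ ℚ[t].≋ []
ℚ[t]-1≉0 e with () ← ℚ[t].at e 0

module ℚ⟨t⟩ = Fraction ℚ[t]-ring ℚ[t]-1≉0 (ℚ[t].⊛-integral (ℚₚ._≟ 0ℚ) ℚ-integral)

ℚ⟨t⟩-ring : CommutativeRing 0ℓ 0ℓ
ℚ⟨t⟩-ring = ℚ⟨t⟩.fractionRing

ℚ⟨t⟩ : Set
ℚ⟨t⟩ = ℚ⟨t⟩.Frac

ℤ[t]→ℚ[t] : ℤ[t] → ℚ[t]
ℤ[t]→ℚ[t] = map (ℚ._/ 1)

ℚ[t]→ℚ⟨t⟩ : ℚ[t] → ℚ⟨t⟩
ℚ[t]→ℚ⟨t⟩ = ℚ⟨t⟩.embed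

ℚ→ℚ⟨t⟩ : ℚ → ℚ⟨t⟩
ℚ→ℚ⟨t⟩ = ℚ[t]→ℚ⟨t⟩ ∘ ℚ[t].const

infix 9 _⟨_⟩

_⟨_⟩ : ℤ[t] → ℚ → ℚ
h ⟨ t₀ ⟩ = ℚ[t].eval t₀ (ℤ[t]→ℚ[t] h)

IsSquare : ℚ → Set
IsSquare q = ∃[ r ] r ℚ.* r ≡ q

infix 4 _∣_

_∣_ : ℤ[t] → ℤ[t] → Set
_∣_ = RawSemiringDefinitions._∣_ (RawRing.rawSemiring (CommutativeRing.rawRing ℤ[t]-ring))

-- Square-freeness in the UFD ℤ[t]: constants count, so 4t is not
-- square-free but 2t is.

SquareFree : ℤ[t] → Set
SquareFree h = ∀ d → (d ℤ[t].⊛ d) ∣ h → d ∣ CommutativeRing.1# ℤ[t]-ring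

curve : (e₁ e₂ e₃ : ℤ[t]) → WeierstrassCurve ℚ[t]-ring
curve e₁ e₂ e₃ = mapCurve ℤ[t]→ℚ[t] (fromRoots ℤ[t]-ring e₁ e₂ e₃)

overℚ⟨t⟩ : WeierstrassCurve ℚ[t]-ring → WeierstrassCurve ℚ⟨t⟩-ring
overℚ⟨t⟩ = mapCurve ℚ[t]→ℚ⟨t⟩

specialize : ℚ → WeierstrassCurve ℚ[t]-ring → WeierstrassCurve ℚ-ring
specialize t₀ = mapCurve (ℚ[t].eval t₀)

ConstantCurve : WeierstrassCurve ℚ⟨t⟩-ring → Set
ConstantCurve W = ∃[ W₀ ] IsElliptic W₀ × Isomorphic W (mapCurve {K = ℚ-ring} ℚ→ℚ⟨t⟩ W₀)

-- Projective coordinates [X : Y : Z] = [x : y : 1] of an affine point,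
-- chosen in ℚ[t] and not all vanishing at t₀.

record Coordinates (t₀ : ℚ) (x y : ℚ⟨t⟩) : Set where
  field
    X Y Z   : ℚ[t]
    X-eq    : ℚ[t]→ℚ⟨t⟩ X ℚ⟨t⟩.≃ x ℚ⟨t⟩.⊠ ℚ[t]→ℚ⟨t⟩ Z
    Y-eq    : ℚ[t]→ℚ⟨t⟩ Y ℚ⟨t⟩.≃ y ℚ⟨t⟩.⊠ ℚ[t]→ℚ⟨t⟩ Z
    Z≉0     : ¬ Z ℚ[t].≋ []
    regular : ¬ (ℚ[t].eval t₀ X ≡ 0ℚ × ℚ[t].eval t₀ Y ≡ 0ℚ × ℚ[t].eval t₀ Z ≡ 0ℚ)

-- Clear denominators, then divide by t - t₀ as long as all three
-- coordinates vanish at t₀.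

coordinates : ∀ t₀ x y → Coordinates t₀ x y
coordinates t₀ x y = reduce (length Z₀) (num x ⊛ den y) (num y ⊛ den x) Z₀ ℕₚ.≤-refl
  (embed-clear x (den y))
  (≃-trans (embed-clear y (den x))
           (⊠-cong (≃-refl {y}) (embed-cong (⊛-comm (den y) (den x)))))
  (*-≉0 (den≉0 x) (den≉0 y))
  where
  open ℚ[t]
  open ℚ⟨t⟩

  Z₀ : ℚ[t]
  Z₀ = den x ⊛ den y

  t-t₀≉0 : ¬ (t- t₀) ≋ []
  t-t₀≉0 e with () ← at e 1

  divide : ∀ {V Z} v → eval t₀ V ≡ 0ℚ → eval t₀ Z ≡ 0ℚ →
           embed V ≃ v ⊠ embed Z → embed (quot t₀ V) ≃ v ⊠ embed (quot t₀ Z)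
  divide {V} {Z} v V≡0 Z≡0 e = embed-cancel {l = t- t₀} v t-t₀≉0
    (≃-trans (embed-cong (≋-sym (factor t₀ V V≡0)))
    (≃-trans e (⊠-cong (≃-refl {v}) (embed-cong (factor t₀ Z Z≡0)))))

  reduce : ∀ n X Y Z → length Z ℕ.≤ n →
           embed X ≃ x ⊠ embed Z → embed Y ≃ y ⊠ embed Z → ¬ Z ≋ [] →
           Coordinates t₀ x y
  reduce zero    X Y []       le X-eq Y-eq Z≉0 = ⊥-elim (Z≉0 ≋-refl)
  reduce (suc n) X Y Z        le X-eq Y-eq Z≉0
    with eval t₀ X ℚₚ.≟ 0ℚ | eval t₀ Y ℚₚ.≟ 0ℚ | eval t₀ Z ℚₚ.≟ 0ℚ
  ... | yes X≡0 | yes Y≡0 | yes Z≡0 =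
    reduce n (quot t₀ X) (quot t₀ Y) (quot t₀ Z) (length-quot t₀ Z n le)
      (divide x X≡0 Z≡0 X-eq) (divide y Y≡0 Z≡0 Y-eq)
      (λ e → Z≉0 (≋-trans (factor t₀ Z Z≡0)
        (≋-trans (⊛-congˡ (t- t₀) e) (⊛-zeroʳ (t- t₀)))))
  ... | no X≢0 | _ | _ = record
    { X-eq = X-eq ; Y-eq = Y-eq ; Z≉0 = Z≉0 ; regular = λ (X≡0 , _ , _) → X≢0 X≡0 }
  ... | yes _ | no Y≢0 | _ = record
    { X-eq = X-eq ; Y-eq = Y-eq ; Z≉0 = Z≉0 ; regular = λ (_ , Y≡0 , _) → Y≢0 Y≡0 }
  ... | yes _ | yes _ | no Z≢0 = record
    { X-eq = X-eq ; Y-eq = Y-eq ; Z≉0 = Z≉0 ; regular = λ (_ , _ , Z≡0) → Z≢0 Z≡0 }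

-- If Z = 0 the equation forces X = 0, so the point [X : Y : Z] is
-- O = [0 : 1 : 0].

fromProjective : (V : WeierstrassCurve ℚ-ring) → ∀ X Y Z →
                 Weierstrass.Homogeneous V X Y Z → Point V
fromProjective V X Y Z h with Z ℚₚ.≟ 0ℚ
... | yes _   = O
... | no  Z≢0 = affine (X ℚ.* w) (Y ℚ.* w)
    (Homogenization.dehomogenize V X Y Z w h (proj₂ (ℚ-inverse Z≢0)))
  where
  w : ℚ
  w = proj₁ (ℚ-inverse Z≢0)

module _ (W : WeierstrassCurve ℚ[t]-ring) {t₀ : ℚ} {x y : ℚ⟨t⟩}
  (eq : Equation (overℚ⟨t⟩ W) x y) (C : Coordinates t₀ x y) where

  open ℚ[t]
  open ℚ⟨t⟩
  open Coordinates C

  specialized-equation :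
    Weierstrass.Homogeneous (specialize t₀ W) (eval t₀ X) (eval t₀ Y) (eval t₀ Z)
  specialized-equation =
    homogeneous-map {K = ℚ[t]-ring} {L = ℚ-ring} (eval-isRingHomomorphism t₀) W X Y Z
      (homogeneous-unmap {K = ℚ[t]-ring} {L = ℚ⟨t⟩-ring}
        embed-isRingHomomorphism W embed-injective X Y Z
        (Homogenization.homogenize (overℚ⟨t⟩ W) x y (embed X) (embed Y) (embed Z) eq X-eq Y-eq))

  evaluate : Point (specialize t₀ W)
  evaluate = fromProjective (specialize t₀ W) (eval t₀ X) (eval t₀ Y) (eval t₀ Z) specialized-equation

σ : (W : WeierstrassCurve ℚ[t]-ring) (t₀ : ℚ) → Point (overℚ⟨t⟩ W) → Point (specialize t₀ W)
σ W t₀ O               = O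
σ W t₀ (affine x y eq) = evaluate W {t₀} {x} {y} eq (coordinates t₀ x y)

-- σ respects equality of points, so it is a map of sets.

private
  vanish : ∀ x z x′ z′ → x ℚ.* z′ ≡ x′ ℚ.* z → z ≡ 0ℚ → z′ ≢ 0ℚ → x ≡ 0ℚ
  vanish x z x′ z′ e z≡0 z′≢0
    with ℚ-integral x z′ (≡.trans e (≡.trans (≡.cong (x′ ℚ.*_) z≡0) (ℚₚ.*-zeroʳ x′)))
  ... | inj₁ x≡0  = x≡0
  ... | inj₂ z′≡0 = ⊥-elim (z′≢0 z′≡0)

  ratio : ∀ x z x′ z′ w w′ → x ℚ.* z′ ≡ x′ ℚ.* z → z ℚ.* w ≡ 1ℚ → z′ ℚ.* w′ ≡ 1ℚ →
          x ℚ.* w ≡ x′ ℚ.* w′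
  ratio x z x′ z′ w w′ e zw≡1 z′w′≡1 = begin
    x ℚ.* w                      ≡⟨ ℚₚ.*-identityʳ _ ⟨
    x ℚ.* w ℚ.* 1ℚ               ≡⟨ ≡.cong (x ℚ.* w ℚ.*_) z′w′≡1 ⟨
    x ℚ.* w ℚ.* (z′ ℚ.* w′)      ≡⟨ swap x w z′ w′ ⟩
    x ℚ.* z′ ℚ.* (w ℚ.* w′)      ≡⟨ ≡.cong (ℚ._* (w ℚ.* w′)) e ⟩
    x′ ℚ.* z ℚ.* (w ℚ.* w′)      ≡⟨ ≡.cong (x′ ℚ.* z ℚ.*_) (ℚₚ.*-comm w w′) ⟩
    x′ ℚ.* z ℚ.* (w′ ℚ.* w)      ≡⟨ swap x′ z w′ w ⟩
    x′ ℚ.* w′ ℚ.* (z ℚ.* w)      ≡⟨ ≡.cong (x′ ℚ.* w′ ℚ.*_) zw≡1 ⟩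
    x′ ℚ.* w′ ℚ.* 1ℚ             ≡⟨ ℚₚ.*-identityʳ _ ⟩
    x′ ℚ.* w′                    ∎
    where
    open ≡.≡-Reasoning
    swap : ∀ p q r s → p ℚ.* q ℚ.* (r ℚ.* s) ≡ p ℚ.* r ℚ.* (q ℚ.* s)
    swap = CommutativeSemigroupProperties.interchange
      (CommutativeRing.*-commutativeSemigroup ℚ-ring)

fromProjective-cong : ∀ V X Y Z X′ Y′ Z′ h h′ →
  ¬ (X ≡ 0ℚ × Y ≡ 0ℚ × Z ≡ 0ℚ) → ¬ (X′ ≡ 0ℚ × Y′ ≡ 0ℚ × Z′ ≡ 0ℚ) →
  X ℚ.* Z′ ≡ X′ ℚ.* Z → Y ℚ.* Z′ ≡ Y′ ℚ.* Z →
  Weierstrass._≈ₚ_ V (fromProjective V X Y Z h) (fromProjective V X′ Y′ Z′ h′)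
fromProjective-cong V X Y Z X′ Y′ Z′ h h′ reg reg′ eX eY with Z ℚₚ.≟ 0ℚ | Z′ ℚₚ.≟ 0ℚ
... | yes _   | yes _    = Weierstrass.O≈O
... | yes Z≡0 | no Z′≢0  = ⊥-elim (reg (vanish X Z X′ Z′ eX Z≡0 Z′≢0 , vanish Y Z Y′ Z′ eY Z≡0 Z′≢0 , Z≡0))
... | no Z≢0  | yes Z′≡0 =
  ⊥-elim (reg′ (vanish X′ Z′ X Z (≡.sym eX) Z′≡0 Z≢0 , vanish Y′ Z′ Y Z (≡.sym eY) Z′≡0 Z≢0 , Z′≡0))
... | no Z≢0  | no Z′≢0  =
  Weierstrass.affine (ratio X Z X′ Z′ w w′ eX Zw≡1 Z′w′≡1) (ratio Y Z Y′ Z′ w w′ eY Zw≡1 Z′w′≡1)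
  where
  w      = proj₁ (ℚ-inverse Z≢0)
  w′     = proj₁ (ℚ-inverse Z′≢0)
  Zw≡1   = proj₂ (ℚ-inverse Z≢0)
  Z′w′≡1 = proj₂ (ℚ-inverse Z′≢0)


private
  at-t₀ : ∀ t₀ x x′ X Z X′ Z′ → x ℚ⟨t⟩.≃ x′ →
    ℚ[t]→ℚ⟨t⟩ X ℚ⟨t⟩.≃ x ℚ⟨t⟩.⊠ ℚ[t]→ℚ⟨t⟩ Z → ℚ[t]→ℚ⟨t⟩ X′ ℚ⟨t⟩.≃ x′ ℚ⟨t⟩.⊠ ℚ[t]→ℚ⟨t⟩ Z′ →
    ℚ[t].eval t₀ X ℚ.* ℚ[t].eval t₀ Z′ ≡ ℚ[t].eval t₀ X′ ℚ.* ℚ[t].eval t₀ Z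
  at-t₀ t₀ x x′ X Z X′ Z′ x≃x′ e e′ =
    ≡.trans (≡.sym (ℚ[t].eval-⊛ t₀ X Z′)) (≡.trans (ℚ[t].eval-cong t₀
      (ℚ⟨t⟩.embed-proportional {x} {x′} {X} {Z} {X′} {Z′} x≃x′ e e′)) (ℚ[t].eval-⊛ t₀ X′ Z))

module _ (W : WeierstrassCurve ℚ[t]-ring) {t₀ : ℚ} {x y x′ y′ : ℚ⟨t⟩}
  (eq : Equation (overℚ⟨t⟩ W) x y) (C : Coordinates t₀ x y)
  (eq′ : Equation (overℚ⟨t⟩ W) x′ y′) (C′ : Coordinates t₀ x′ y′) where

  private
    module C  = Coordinates C
    module C′ = Coordinates C′

  evaluate-cong : x ℚ⟨t⟩.≃ x′ → y ℚ⟨t⟩.≃ y′ →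
    Weierstrass._≈ₚ_ (specialize t₀ W) (evaluate W eq C) (evaluate W eq′ C′)
  evaluate-cong x≃x′ y≃y′ = fromProjective-cong (specialize t₀ W)
    (ℚ[t].eval t₀ C.X) (ℚ[t].eval t₀ C.Y) (ℚ[t].eval t₀ C.Z)
    (ℚ[t].eval t₀ C′.X) (ℚ[t].eval t₀ C′.Y) (ℚ[t].eval t₀ C′.Z)
    (specialized-equation W eq C) (specialized-equation W eq′ C′)
    C.regular C′.regular
    (at-t₀ t₀ x x′ C.X C.Z C′.X C′.Z x≃x′ C.X-eq C′.X-eq)
    (at-t₀ t₀ y y′ C.Y C.Z C′.Y C′.Z y≃y′ C.Y-eq C′.Y-eq)

σ-cong : ∀ W t₀ {P Q} → Weierstrass._≈ₚ_ (overℚ⟨t⟩ W) P Q →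
         Weierstrass._≈ₚ_ (specialize t₀ W) (σ W t₀ P) (σ W t₀ Q)
σ-cong W t₀ Weierstrass.O≈O = Weierstrass.O≈O
σ-cong W t₀ (Weierstrass.affine {x} {y} {x′} {y′} {eq} {eq′} x≃x′ y≃y′) =
  evaluate-cong W {t₀} {x} {y} {x′} {y′} eq (coordinates t₀ x y) eq′ (coordinates t₀ x′ y′) x≃x′ y≃y′

{-# OPTIONS --safe #-}

-- Suppose P ≠ Q have the same specialization. Then P - Q ≠ O (or one of
-- P, Q) specializes to O, so there is x = A / D² in lowest terms in ℤ[t]
-- with D(t₀) = 0 and (A - e₁D²)(A - e₂D²)(A - e₃D²) a square.
-- Each A - eᵢD² is hᵢ sᵢ² with hᵢ square-free; by coprimality hᵢ divides
-- (eᵢ - eⱼ)(eᵢ - eₖ), and hᵢ(t₀) is a square because A(t₀) is one. Hence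
-- hᵢ is constant, so a square, and x is the abscissa of a double 2R, where
-- R again specializes to O and its denominator divides D. Halving cannot
-- go on for ever: once the denominator is stationary, A(t₀) is multiplied
-- by 4 at each step, while A - e₁D² divides the fixed polynomial
-- (e₁ - e₂)(e₁ - e₃). The value of the cofactor at t₀ is then divided by 4
-- at each step, but it is nonzero and its denominator is bounded.

module Submission where

open import Defs using
  ( module Polynomial; WeierstrassCurve; fromRoots; module Weierstrass )
open import Algebra.Bundles using (CommutativeRing; RawRing)
open import Algebra.Definitions.RawMagma using (_,_)
import Algebra.Definitions.RawSemiring as RawSemiringDefinitions
import Algebra.Morphism.Construct.Composition as Composition
open import Algebra.Morphism.Structures using (module RingMorphisms)
import Algebra.Properties.AbelianGroup as AbelianGroupProperties
import Algebra.Properties.CommutativeSemigroup.Divisibility as SemigroupDivisibility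
import Algebra.Properties.Group as GroupProperties
import Algebra.Properties.Ring as RingProperties
import Algebra.Properties.Semiring.Divisibility as SemiringDivisibility
import Algebra.Properties.Semiring.Mult as Multiples
import Algebra.Properties.Semiring.Mult.TCOptimised as Mult
import Algebra.Solver.Ring as RingSolver
open import Algebra.Solver.Ring.AlmostCommutativeRing
  using (fromCommutativeRing; _-Raw-AlmostCommutative⟶_)
import Algebra.Solver.Ring.NaturalCoefficients.Default as SemiringSolver
open import Data.Empty using (⊥; ⊥-elim)
open import Data.Integer.Base as ℤ using (ℤ; +_; 0ℤ; 1ℤ)
import Data.Integer.Divisibility.Signed as ℤ∣
import Data.Integer.Properties as ℤₚ
open import Data.List.Base using ([]; _∷_; length; map)
open import Data.List.Relation.Unary.All using (_∷_)
open import Data.Maybe.Base using (Maybe; just; nothing)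
open import Data.Nat.Base as ℕ using (ℕ; zero; suc; z≤n; s≤s)
import Data.Nat.Divisibility as ℕ∣
open import Data.Nat.Induction using (<-rec)
import Data.Nat.Primality as ℕ
open import Data.Nat.Primality.Factorisation using (factorise)
import Data.Nat.Properties as ℕₚ
open import Data.Product.Base using (_×_; _,_; ∃-syntax; proj₁; proj₂)
open import Data.Rational.Base as ℚ using (ℚ; 0ℚ; 1ℚ; ↥_; ↧_; ↧ₙ_)
import Data.Rational.Properties as ℚₚ
open import Data.Rational.Unnormalised.Base using (mkℚᵘ; *≡*; _≃_)
import Data.Rational.Unnormalised.Properties as ℚᵘₚ
open import Data.Sum.Base using (_⊎_; inj₁; inj₂; [_,_]′; map₁; map₂) renaming (map to ⊎-map)
open import Function.Base using (id; _∘_)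
open import Function.Definitions using (Injective)
open import Level using (Level; _⊔_; 0ℓ)
open import Relation.Binary.PropositionalEquality as ≡ using (_≡_; _≢_)
import Relation.Binary.Reasoning.Setoid as SetoidReasoning
open import Relation.Nullary.Decidable
  using (Dec; yes; no; map′; decidable-stable)
open import Relation.Nullary.Negation.Core using (¬_; ¬¬-map; contradiction)

-- With Cᵢ² = A - eᵢD², the halves of the point are x = (A + C₁C₂ + C₁C₃ + C₂C₃) / D², one for each
-- choice of signs up to a common one. At t₀ the three Cᵢ agree up to sign. Choosing the signs so
-- that they agree exactly turns the numerator into 4A(t₀), whence the factor 4; any other choice
-- gives 0. The same formula gives a - e₁D² = (C₁ + C₂)(C₁ + C₃) for the new numerator a, and
-- multiplication by the conjugate (C₁ - C₂)(C₁ - C₃) gives D⁴(e₁ - e₂)(e₁ - e₃), which is why the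
-- numerators become divisors of a fixed polynomial. The step from P ≠ Q to a pole uses the line
-- through P and -Q: its slope has two expressions, and at least one of them visibly has a pole at
-- t₀, according to whether y(t₀) vanishes. Greatest common divisors and square-free parts in ℤ[t]
-- are obtained by contradiction, so most of the descent lives under a double negation. It is left
-- only where the goal is stable: a contradiction, being a unit, or equality of integer polynomials.

private
  variable
    c ℓ c′ ℓ′ : Level

-- The coefficient (m , n) stands for m - n. Sums and products are kept
-- reduced, so that equal normal forms are syntactically equal.

module IntegerCoefficients (R : CommutativeRing c ℓ) where

  open CommutativeRing R
  open Mult semiring using (×-homo-+; ×1-homo-*) renaming (_×_ to _·_)
  open RingProperties ring using (-‿distribˡ-*; -‿distribʳ-*; -0#≈0#)
  open AbelianGroupProperties +-abelianGroup using (⁻¹-∙-comm; ⁻¹-involutive; ⁻¹-anti-homo‿-)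
  private module S = SemiringSolver commutativeSemiring
  open SetoidReasoning setoid

  private
    reduce : ℕ → ℕ → ℕ × ℕ
    reduce (ℕ.suc m) (ℕ.suc n) = reduce m n
    reduce m         n         = m , n

    differences : RawRing _ _
    differences = record
      { Carrier = ℕ × ℕ
      ; _≈_     = _≡_
      ; _+_     = λ (m , n) (m′ , n′) → reduce (m ℕ.+ m′) (n ℕ.+ n′)
      ; _*_     = λ (m , n) (m′ , n′) → reduce (m ℕ.* m′ ℕ.+ n ℕ.* n′) (m ℕ.* n′ ℕ.+ n ℕ.* m′)
      ; -_      = λ (m , n) → n , m
      ; 0#      = 0 , 0
      ; 1#      = 1 , 0
      }

    -- The cases with a zero component omit the subtraction, so that `con (0 , 0)` and `con (1 , 0)`
    -- denote `0#` and `1#` definitionally and fit goals that mention these constants.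
    ⟦_⟧ : ℕ × ℕ → Carrier
    ⟦ m , 0 ⟧       = m · 1#
    ⟦ 0 , n ⟧       = - (n · 1#)
    ⟦ m , n ⟧       = m · 1# - n · 1#

    ⟦⟧-def : ∀ m n → ⟦ m , n ⟧ ≈ m · 1# - n · 1#
    ⟦⟧-def m         0         = sym (trans (+-congˡ -0#≈0#) (+-identityʳ _))
    ⟦⟧-def 0         (ℕ.suc n) = sym (+-identityˡ _)
    ⟦⟧-def (ℕ.suc m) (ℕ.suc n) = refl

    x-y+x′-y′ : ∀ x y x′ y′ → (x + x′) - (y + y′) ≈ (x - y) + (x′ - y′)
    x-y+x′-y′ x y x′ y′ = begin
      (x + x′) - (y + y′)     ≈⟨ +-congˡ (⁻¹-∙-comm y y′) ⟨
      (x + x′) + (- y + - y′) ≈⟨ S.solve 4 (λ x y x′ y′ → (x S.:+ x′) S.:+ (y S.:+ y′) S.:=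
          (x S.:+ y) S.:+ (x′ S.:+ y′)) refl x (- y) x′ (- y′) ⟩
      (x - y) + (x′ - y′)     ∎

    *-homo : ∀ x y x′ y′ → (x * x′ + y * y′) - (x * y′ + y * x′) ≈ (x - y) * (x′ - y′)
    *-homo x y x′ y′ = begin
      (x * x′ + y * y′) - (x * y′ + y * x′)
        ≈⟨ +-cong (+-congˡ (sym neg-neg)) (trans (sym (⁻¹-∙-comm _ _))
            (+-cong (-‿distribʳ-* x y′) (-‿distribˡ-* y x′))) ⟩
      (x * x′ + - y * - y′) + (x * - y′ + - y * x′)
        ≈⟨ S.solve 4 (λ x y x′ y′ → (x S.:* x′ S.:+ y S.:* y′) S.:+ (x S.:* y′ S.:+ y S.:* x′) S.:=
            (x S.:+ y) S.:* (x′ S.:+ y′)) refl x (- y) x′ (- y′) ⟩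
      (x - y) * (x′ - y′) ∎
      where
      neg-neg : - y * - y′ ≈ y * y′
      neg-neg = trans (sym (-‿distribˡ-* y (- y′)))
        (trans (-‿cong (sym (-‿distribʳ-* y y′))) (⁻¹-involutive _))

    +-cancel : ∀ {x y x′ y′} → x + y′ ≈ x′ + y → x - y ≈ x′ - y′
    +-cancel {x} {y} {x′} {y′} e = begin
      x - y                  ≈⟨ +-congʳ (trans (sym (+-identityʳ x))
          (+-congˡ (sym (-‿inverseʳ y′)))) ⟩
      x + (y′ - y′) - y      ≈⟨ +-congʳ (+-assoc x y′ (- y′)) ⟨
      x + y′ - y′ - y        ≈⟨ +-congʳ (+-congʳ e) ⟩
      x′ + y - y′ - y        ≈⟨ S.solve 4 (λ x′ y ny ny′ → x′ S.:+ y S.:+ ny′ S.:+ ny S.:=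
          (x′ S.:+ ny′) S.:+ (y S.:+ ny)) refl x′ y (- y) (- y′) ⟩
      (x′ - y′) + (y - y)    ≈⟨ trans (+-congˡ (-‿inverseʳ y)) (+-identityʳ _) ⟩
      x′ - y′                ∎

    reduce-def : ∀ m n → ⟦ reduce m n ⟧ ≈ m · 1# - n · 1#
    reduce-def (ℕ.suc m) (ℕ.suc n) = trans (reduce-def m n) (+-cancel (begin
      m · 1# + ℕ.suc n · 1#     ≈⟨ ×-homo-+ 1# m (ℕ.suc n) ⟨
      (m ℕ.+ ℕ.suc n) · 1#      ≡⟨ ≡.cong (_· 1#) (ℕₚ.+-suc m n) ⟩
      (ℕ.suc m ℕ.+ n) · 1#      ≈⟨ ×-homo-+ 1# (ℕ.suc m) n ⟩
      ℕ.suc m · 1# + n · 1#     ∎))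
    reduce-def 0         n         = ⟦⟧-def 0 n
    reduce-def (ℕ.suc m) 0         = ⟦⟧-def (ℕ.suc m) 0

    homomorphism : differences -Raw-AlmostCommutative⟶ fromCommutativeRing R
    homomorphism = record
      { ⟦_⟧    = ⟦_⟧
      ; +-homo = λ (m , n) (m′ , n′) → begin
          ⟦ reduce (m ℕ.+ m′) (n ℕ.+ n′) ⟧
            ≈⟨ reduce-def (m ℕ.+ m′) (n ℕ.+ n′) ⟩
          (m ℕ.+ m′) · 1# - (n ℕ.+ n′) · 1#
            ≈⟨ +-cong (×-homo-+ 1# m m′) (-‿cong (×-homo-+ 1# n n′)) ⟩
          (m · 1# + m′ · 1#) - (n · 1# + n′ · 1#)
            ≈⟨ x-y+x′-y′ _ _ _ _ ⟩
          (m · 1# - n · 1#) + (m′ · 1# - n′ · 1#)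
            ≈⟨ +-cong (⟦⟧-def m n) (⟦⟧-def m′ n′) ⟨
          ⟦ m , n ⟧ + ⟦ m′ , n′ ⟧ ∎
      ; *-homo = λ (m , n) (m′ , n′) → begin
          ⟦ reduce (m ℕ.* m′ ℕ.+ n ℕ.* n′) (m ℕ.* n′ ℕ.+ n ℕ.* m′) ⟧
            ≈⟨ reduce-def (m ℕ.* m′ ℕ.+ n ℕ.* n′) (m ℕ.* n′ ℕ.+ n ℕ.* m′) ⟩
          (m ℕ.* m′ ℕ.+ n ℕ.* n′) · 1# - (m ℕ.* n′ ℕ.+ n ℕ.* m′) · 1#
            ≈⟨ +-cong (sum m m′ n n′) (-‿cong (sum m n′ n m′)) ⟩
          (m · 1# * (m′ · 1#) + n · 1# * (n′ · 1#)) - (m · 1# * (n′ · 1#) + n · 1# * (m′ · 1#))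
            ≈⟨ *-homo _ _ _ _ ⟩
          (m · 1# - n · 1#) * (m′ · 1# - n′ · 1#)
            ≈⟨ *-cong (⟦⟧-def m n) (⟦⟧-def m′ n′) ⟨
          ⟦ m , n ⟧ * ⟦ m′ , n′ ⟧ ∎
      ; -‿homo = λ (m , n) → begin
          ⟦ n , m ⟧             ≈⟨ ⟦⟧-def n m ⟩
          n · 1# - m · 1#       ≈⟨ ⁻¹-anti-homo‿- (m · 1#) (n · 1#) ⟨
          - (m · 1# - n · 1#)   ≈⟨ -‿cong (⟦⟧-def m n) ⟨
          - ⟦ m , n ⟧           ∎
      ; 0-homo = refl
      ; 1-homo = refl
      }
      where
      sum : ∀ m m′ n n′ → (m ℕ.* m′ ℕ.+ n ℕ.* n′) · 1# ≈ m · 1# * (m′ · 1#) + n · 1# * (n′ · 1#)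
      sum m m′ n n′ = trans (×-homo-+ 1# (m ℕ.* m′) (n ℕ.* n′))
          (+-cong (×1-homo-* m m′) (×1-homo-* n n′))

    decide : ∀ a b → Maybe (⟦ a ⟧ ≈ ⟦ b ⟧)
    decide (m , n) (m′ , n′) with m ℕ.+ n′ ℕₚ.≟ m′ ℕ.+ n
    ... | no  _ = nothing
    ... | yes e = just (begin
      ⟦ m , n ⟧           ≈⟨ ⟦⟧-def m n ⟩
      m · 1# - n · 1#     ≈⟨ +-cancel (trans (sym (×-homo-+ 1# m n′))
          (trans (reflexive (≡.cong (_· 1#) e)) (×-homo-+ 1# m′ n))) ⟩
      m′ · 1# - n′ · 1#   ≈⟨ ⟦⟧-def m′ n′ ⟨
      ⟦ m′ , n′ ⟧         ∎)

  open RingSolver differences (fromCommutativeRing R) homomorphism decide public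
    using (solve; _:=_; _:+_; _:*_; _:-_; :-_; con)
    renaming (Polynomial to Expression)

-- Divisibility in factorial domains

infixl 1 _>>=_

-- The double-negation monad: `do` blocks may pick divisors whose existence is only known
-- classically.
_>>=_ : {A : Set ℓ} {B : Set ℓ′} → ¬ ¬ A → (A → ¬ ¬ B) → ¬ ¬ B
(m >>= f) k = m (λ x → f x k)

return : {A : Set ℓ} → A → ¬ ¬ A
return x k = k x

Integral : CommutativeRing c ℓ → Set (c ⊔ ℓ)
Integral R = ∀ x y → x * y ≈ 0# → x ≈ 0# ⊎ y ≈ 0#
  where open CommutativeRing R

module Domain (R : CommutativeRing c ℓ) (integral : Integral R) where

  open CommutativeRing R
  open IntegerCoefficients R
  open GroupProperties +-group using (x∙y⁻¹≈ε⇒x≈y)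
  open SetoidReasoning setoid

  *-≉0 : ∀ {x y} → ¬ x ≈ 0# → ¬ y ≈ 0# → ¬ x * y ≈ 0#
  *-≉0 x≉0 y≉0 e = [ x≉0 , y≉0 ]′ (integral _ _ e)

  ≉0ˡ : ∀ {x y} → ¬ x * y ≈ 0# → ¬ x ≈ 0#
  ≉0ˡ xy≉0 x≈0 = xy≉0 (trans (*-congʳ x≈0) (zeroˡ _))

  ≉0ʳ : ∀ {x y} → ¬ x * y ≈ 0# → ¬ y ≈ 0#
  ≉0ʳ xy≉0 y≈0 = xy≉0 (trans (*-congˡ y≈0) (zeroʳ _))

  ≉0-cong : ∀ {x y} → x ≈ y → ¬ x ≈ 0# → ¬ y ≈ 0#
  ≉0-cong x≈y x≉0 y≈0 = x≉0 (trans x≈y y≈0)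

  cancelˡ : ∀ {x y} z → ¬ z ≈ 0# → z * x ≈ z * y → x ≈ y
  cancelˡ {x} {y} z z≉0 e = [ ⊥-elim ∘ z≉0 , x∙y⁻¹≈ε⇒x≈y x y ]′ (integral z (x - y) (begin
    z * (x - y)     ≈⟨ solve 3 (λ x y z → z :* (x :- y) := z :* x :- z :* y) refl x y z ⟩
    z * x - z * y   ≈⟨ +-congʳ e ⟩
    z * y - z * y   ≈⟨ -‿inverseʳ _ ⟩
    0#              ∎))

-- Unique factorization in the form in which it is used: Euclid's lemma, and a measure that drops
-- under division by a nonunit. `Norm` is a relation because for polynomials it is read off from a
-- degree, which zero does not have. `unit-stable` allows coprimality and square-freeness to be
-- proved by contradiction.
record FactorialDomain (R : CommutativeRing c ℓ) : Set (c ⊔ Level.suc ℓ) where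
  open CommutativeRing R
  open RawSemiringDefinitions (RawRing.rawSemiring rawRing) using (Coprime; _∣_)
  field
    integral    : Integral R
    unit-stable : ∀ {x} → ¬ ¬ (x ∣ 1#) → x ∣ 1#
    euclid      : ∀ {x y z} → Coprime x y → x ∣ y * z → x ∣ z
    Norm        : Carrier → ℕ → Set ℓ
    norm        : ∀ {x} → ¬ x ≈ 0# → ∃[ n ] Norm x n
    norm-<      : ∀ {x y k n} → x ≈ k * y → ¬ k ∣ 1# → Norm x n → ∃[ m ] m ℕ.< n × Norm y m

module Factorization (R : CommutativeRing c ℓ) (R-factorial : FactorialDomain R) where

  open CommutativeRing R
  open RawSemiringDefinitions (RawRing.rawSemiring rawRing) using (Coprime; _∣_)
  open FactorialDomain R-factorial
  open Domain R integral
  open IntegerCoefficients R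
  open SemiringDivisibility semiring hiding (_∣_; _,_) public
  open SemigroupDivisibility *-commutativeSemigroup using (x∣xy; x∣y⇒zx∣zy; ∙-cong-∣) public
  open SetoidReasoning setoid

  record Split (a b : Carrier) : Set (c ⊔ ℓ) where
    field
      g a′ b′ : Carrier
      a-eq    : a ≈ g * a′
      b-eq    : b ≈ g * b′
      coprime : Coprime a′ b′

  -- If no split exists, `x` and `y` themselves cannot be coprime; dividing both by a common nonunit
  -- lowers the norm of `y`, and the induction hypothesis supplies a split after all.
  split : ∀ x {y} → ¬ y ≈ 0# → ¬ ¬ Split x y
  split x y≉0 = <-rec (λ n → ∀ x {y} → Norm y n → ¬ ¬ Split x y) go _ x (proj₂ (norm y≉0))
    where
    go : ∀ n → (∀ {m} → m ℕ.< n → ∀ x {y} → Norm y m → ¬ ¬ Split x y) → ∀ x {y} → Norm y n → ¬ ¬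
        Split x y
    go n rec x {y} ∥y∥ ¬split = ¬split record
      { g = 1# ; a′ = x ; b′ = y ; a-eq = sym (*-identityˡ x) ; b-eq = sym (*-identityˡ y)
      ; coprime = λ {d} d∣x d∣y → unit-stable λ d∤1 → common d∣x d∣y d∤1 ¬split }
      where
      common : ∀ {d} → d ∣ x → d ∣ y → ¬ d ∣ 1# → ¬ ¬ Split x y
      common {d} (x′ , x′d≈x) (y′ , y′d≈y) d∤1 = let (m , m<n , ∥y′∥) = norm-<
                                                       (trans (sym y′d≈y) (*-comm y′ d)) d∤1 ∥y∥ in
        ¬¬-map (λ s → let open Split s in record
        { g = d * g ; a′ = a′ ; b′ = b′
        ; a-eq = trans (sym x′d≈x) (trans (*-comm x′ d)
            (trans (*-congˡ a-eq) (sym (*-assoc d g a′))))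
        ; b-eq = trans (sym y′d≈y) (trans (*-comm y′ d)
            (trans (*-congˡ b-eq) (sym (*-assoc d g b′))))
        ; coprime = coprime }) (rec m<n x′ ∥y′∥)

  SquareFree : Carrier → Set (c ⊔ ℓ)
  SquareFree h = ∀ d → d * d ∣ h → d ∣ 1#

  SquareFreePart : Carrier → Set (c ⊔ ℓ)
  SquareFreePart g = ∃[ h ] ∃[ k ] g ≈ h * (k * k) × SquareFree h

  -- The scheme of `split`, now with the square of a nonunit divided out of `g` at each step.
  squareFreePart : ∀ {g} → ¬ g ≈ 0# → ¬ ¬ SquareFreePart g
  squareFreePart g≉0 = <-rec (λ n → ∀ {g} → Norm g n → ¬ ¬ SquareFreePart g) go _ (proj₂ (norm g≉0))
    where
    go : ∀ n → (∀ {m} → m ℕ.< n → ∀ {g} → Norm g m → ¬ ¬ SquareFreePart g) → ∀ {g} → Norm g n → ¬ ¬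
        SquareFreePart g
    go n rec {g} ∥g∥ ¬part = ¬part (g , 1# , trans (sym (*-identityʳ g))
        (*-congˡ (sym (*-identityʳ 1#))) ,
      λ d dd∣g → unit-stable λ d∤1 → square d dd∣g d∤1 ¬part)
      where
      square : ∀ d → d * d ∣ g → ¬ d ∣ 1# → ¬ ¬ SquareFreePart g
      square d (q , qdd≈g) d∤1 = let (m , m<n , ∥q∥) = norm-< (trans (sym qdd≈g) (*-comm q (d * d)))
                                       (d∤1 ∘ ∣ʳ-trans (x∣xy d d)) ∥g∥ in
        ¬¬-map (λ (h , k , q≈ , h-sf) → h , k * d ,
        trans (sym qdd≈g) (trans (*-congʳ q≈)
            (solve 3 (λ h k d → h :* (k :* k) :* (d :* d) := h :* ((k :* d) :* (k :* d))) refl h k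
                d)) , h-sf)
        (rec m<n ∥q∥)

  coprime-sym : ∀ {x y} → Coprime x y → Coprime y x
  coprime-sym c d∣y d∣x = c d∣x d∣y

  coprime-∣ : ∀ {x x′ y} → x′ ∣ x → Coprime x y → Coprime x′ y
  coprime-∣ x′∣x c d∣x′ d∣y = c (∣ʳ-trans d∣x′ x′∣x) d∣y

  coprime-* : ∀ {x y z} → Coprime x y → Coprime x z → Coprime x (y * z)
  coprime-* c c′ d∣x d∣yz =
    c′ d∣x (euclid (coprime-∣ d∣x c) d∣yz)

  ∣-+ : ∀ {x y z} → x ∣ y → x ∣ z → x ∣ y + z
  ∣-+ (p , e) (q , f) = p + q , trans (distribʳ _ p q) (+-cong e f)

  ∣-*ˡ : ∀ {x y} z → x ∣ y → x ∣ y * z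
  ∣-*ˡ z x∣y = ∣ʳ-trans x∣y (x∣xy _ z)

  coprime-+ : ∀ {x y} z → Coprime x y → Coprime x (y + x * z)
  coprime-+ {x} {y} z c {d} d∣x d∣y+xz = c d∣x (∣ʳ-respʳ-≈
    (solve 3 (λ x y z → (y :+ x :* z) :+ x :* (:- z) := y) refl x y z)
    (∣-+ d∣y+xz (∣-*ˡ (- z) d∣x)))

  cancel-∣ : ∀ {x y z} → ¬ z ≈ 0# → z * x ∣ z * y → x ∣ y
  cancel-∣ {x} {y} {z} z≉0 (q , e) = q , cancelˡ z z≉0
    (trans (solve 3 (λ q x z → z :* (q :* x) := q :* (z :* x)) refl q x z) e)

  -- After removal of the greatest common divisor, x′² divides y′² with x′ and y′ coprime, so x′
  -- divides y′ by Euclid's lemma and is a unit.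
  ²∣²⇒∣ : ∀ {x y} → ¬ x ≈ 0# → x * x ∣ y * y → ¬ ¬ (x ∣ y)
  ²∣²⇒∣ {x} {y} x≉0 xx∣yy = do
    record { g = g ; a′ = y′ ; b′ = x′ ; a-eq = y≈ ; b-eq = x≈ ; coprime = c } ← split y x≉0
    let g≉0 = ≉0ˡ (≉0-cong x≈ x≉0)
        x′x′∣y′y′ : x′ * x′ ∣ y′ * y′
        x′x′∣y′y′ = cancel-∣ (*-≉0 g≉0 g≉0)
          (∣ʳ-respˡ-≈ (square x≈) (∣ʳ-respʳ-≈ (square y≈) xx∣yy))
    let x′∣y′ = euclid (coprime-sym c) (∣ʳ-trans (x∣xy x′ x′) x′x′∣y′y′)
        x′∣1 = c x′∣y′ ∣ʳ-refl
    return (∣ʳ-respˡ-≈ (sym x≈) (∣ʳ-respʳ-≈ (sym y≈)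
      (x∣y⇒zx∣zy g (∣ʳ-trans x′∣1 (1∣ y′)))))
    where
    square : ∀ {x g x′} → x ≈ g * x′ → x * x ≈ (g * g) * (x′ * x′)
    square {x} {g} {x′} e = trans (*-cong e e)
      (solve 2 (λ g x → (g :* x) :* (g :* x) := (g :* g) :* (x :* x)) refl g x′)

  -- Let d = gcd (u , w), u = d u′ and w = d w′, so that u′ v = d w′². Since u′ is prime to w′ it
  -- divides d; since d divides u it is prime to v and divides u′. Hence u′ is d up to a unit, and u
  -- is d² up to a unit.
  coprime-square : ∀ {u v w} → ¬ u ≈ 0# → Coprime u v → u * v ≈ w * w →
                   ¬ ¬ (∃[ ε ] ∃[ d ] ε ∣ 1# × u ≈ ε * (d * d))
  coprime-square {u} {v} {w} u≉0 c uv≈ww = do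
    record { g = d ; a′ = w′ ; b′ = u′ ; a-eq = w≈ ; b-eq = u≈ ; coprime = c′ } ← split w u≉0
    let d≉0 = ≉0ˡ (≉0-cong u≈ u≉0)
        u′v≈dww : u′ * v ≈ w′ * (w′ * d)
        u′v≈dww = cancelˡ d d≉0 (begin
          d * (u′ * v)            ≈⟨ *-assoc d u′ v ⟨
          d * u′ * v              ≈⟨ *-congʳ u≈ ⟨
          u * v                   ≈⟨ uv≈ww ⟩
          w * w                   ≈⟨ *-cong w≈ w≈ ⟩
          (d * w′) * (d * w′)     ≈⟨ solve 2 (λ d w → (d :* w) :* (d :* w) := d :* (w :* (w :* d)))
              refl d w′ ⟩
          d * (w′ * (w′ * d))     ∎)
        u′∣w′d = euclid (coprime-sym c′) (∣ʳ-respʳ-≈ u′v≈dww (x∣xy u′ v))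
        (f , fu′≈d) = euclid (coprime-sym c′) u′∣w′d
        (e , ed≈u′) = euclid (coprime-∣ (∣ʳ-respʳ-≈ (sym u≈) (x∣xy d u′)) c)
                             (∣ʳ-respʳ-≈ (trans (sym u′v≈dww) (*-comm u′ v))
                                 (∣ʳ-trans (x∣ʳyx d w′) (x∣ʳyx (w′ * d) w′)))
    return (e , d , (f , cancelˡ d d≉0 (begin
        d * (f * e)   ≈⟨ solve 3 (λ d e f → d :* (f :* e) := f :* (e :* d)) refl d e f ⟩
        f * (e * d)   ≈⟨ *-congˡ ed≈u′ ⟩
        f * u′        ≈⟨ fu′≈d ⟩
        d             ≈⟨ *-identityʳ d ⟨
        d * 1#        ∎))
      , (begin
        u             ≈⟨ u≈ ⟩
        d * u′        ≈⟨ *-congˡ ed≈u′ ⟨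
        d * (e * d)   ≈⟨ solve 2 (λ d e → d :* (e :* d) := e :* (d :* d)) refl d e ⟩
        e * (d * d)   ∎))

  -- The simplest case of integral closedness: a square root c / e of h in the fraction field
  -- already lies in R.
  integral-square : ∀ {h c e} → ¬ e ≈ 0# → h * (e * e) ≈ c * c → ¬ ¬ (∃[ w ] w * w ≈ h)
  integral-square {h} {c} {e} e≉0 hee≈cc = do
    (k , ke≈c) ← ²∣²⇒∣ e≉0 (h , hee≈cc)
    return (k , cancelˡ (e * e) (*-≉0 e≉0 e≉0) (begin
      (e * e) * (k * k)   ≈⟨ solve 2 (λ e k → (e :* e) :* (k :* k) := (k :* e) :* (k :* e)) refl e k
          ⟩
      (k * e) * (k * e)   ≈⟨ *-cong ke≈c ke≈c ⟩
      c * c               ≈⟨ hee≈cc ⟨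
      h * (e * e)         ≈⟨ *-comm h (e * e) ⟩
      (e * e) * h         ∎))

-- The descent by halving

record Field (K : CommutativeRing c ℓ) : Set (c ⊔ ℓ) where
  open CommutativeRing K
  field
    integral : Integral K
    inverse  : ∀ {x} → ¬ x ≈ 0# → ∃[ y ] x * y ≈ 1#
    2≉0      : ¬ 1# + 1# ≈ 0#

module Quadruple (K : CommutativeRing c ℓ) where
  open CommutativeRing K
  open IntegerCoefficients K

  -- Multiplication by 4 written with sums, so that additivity alone carries it through a ring
  -- homomorphism.
  quadruple : Carrier → Carrier
  quadruple x = (x + x) + (x + x)

  quadruple-cong : ∀ {x y} → x ≈ y → quadruple x ≈ quadruple y
  quadruple-cong e = +-cong (+-cong e e) (+-cong e e)

  quadrupleⁿ : ℕ → Carrier → Carrier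
  quadrupleⁿ zero    x = x
  quadrupleⁿ (suc n) x = quadruple (quadrupleⁿ n x)

  quadrupleⁿ-cong : ∀ n {x y} → x ≈ y → quadrupleⁿ n x ≈ quadrupleⁿ n y
  quadrupleⁿ-cong zero    e = e
  quadrupleⁿ-cong (suc n) e = quadruple-cong (quadrupleⁿ-cong n e)

  *-quadrupleⁿ : ∀ n x y → x * quadrupleⁿ n y ≈ quadrupleⁿ n (x * y)
  *-quadrupleⁿ zero    x y = refl
  *-quadrupleⁿ (suc n) x y = trans
    (solve 2 (λ x q → x :* ((q :+ q) :+ (q :+ q)) := (x :* q :+ x :* q) :+ (x :* q :+ x :* q)) refl
        x (quadrupleⁿ n y))
    (quadruple-cong (*-quadrupleⁿ n x y))

module FieldProperties (K : CommutativeRing c ℓ) (K-field : Field K) where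

  open CommutativeRing K
  open Field K-field
  open Quadruple K
  open IntegerCoefficients K
  open SetoidReasoning setoid

  Square : Carrier → Set (c ⊔ ℓ)
  Square x = ∃[ r ] r * r ≈ x

  square-quotient : ∀ {x r s} → ¬ s ≈ 0# → x * (s * s) ≈ r * r → Square x
  square-quotient {x} {r} {s} s≉0 e with inverse s≉0
  ... | t , st≈1 = r * t , (begin
    (r * t) * (r * t)         ≈⟨ solve 2 (λ r t → (r :* t) :* (r :* t) := (r :* r) :* (t :* t)) refl
        r t ⟩
    (r * r) * (t * t)         ≈⟨ *-congʳ e ⟨
    x * (s * s) * (t * t)     ≈⟨ solve 3 (λ x s t → x :* (s :* s) :* (t :* t) := x :*
        ((s :* t) :* (s :* t))) refl x s t ⟩
    x * ((s * t) * (s * t))   ≈⟨ *-congˡ (*-cong st≈1 st≈1) ⟩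
    x * (1# * 1#)             ≈⟨ trans (*-congˡ (*-identityˡ 1#)) (*-identityʳ x) ⟩
    x                         ∎)

  ²≈²⇒± : ∀ {x y} → x * x ≈ y * y → x ≈ y ⊎ - x ≈ y
  ²≈²⇒± {x} {y} e = [ inj₁ ∘ positive , inj₂ ∘ negative ]′ (integral (x - y) (x + y) (begin
    (x - y) * (x + y)   ≈⟨ solve 2 (λ x y → (x :- y) :* (x :+ y) := x :* x :- y :* y) refl x y ⟩
    x * x - y * y       ≈⟨ +-congʳ e ⟩
    y * y - y * y       ≈⟨ -‿inverseʳ (y * y) ⟩
    0#                  ∎))
    where
    positive : x - y ≈ 0# → x ≈ y
    positive e⁻ = begin
      x             ≈⟨ solve 2 (λ x y → x := (x :- y) :+ y) refl x y ⟩
      (x - y) + y   ≈⟨ +-congʳ e⁻ ⟩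
      0# + y        ≈⟨ +-identityˡ y ⟩
      y             ∎
    negative : x + y ≈ 0# → - x ≈ y
    negative e⁺ = begin
      - x           ≈⟨ solve 2 (λ x y → :- x := y :- (x :+ y)) refl x y ⟩
      y - (x + y)   ≈⟨ +-congˡ (-‿cong e⁺) ⟩
      y - 0#        ≈⟨ solve 1 (λ y → y :- con (0 , 0) := y) refl y ⟩
      y             ∎

  double-≉0 : ∀ {x} → ¬ x ≈ 0# → ¬ x + x ≈ 0#
  double-≉0 {x} x≉0 e = [ 2≉0 , x≉0 ]′ (integral (1# + 1#) x
    (trans (solve 1 (λ x → (con (1 , 0) :+ con (1 , 0)) :* x := x :+ x) refl x) e))

  quadruple-≉0 : ∀ {x} → ¬ x ≈ 0# → ¬ quadruple x ≈ 0#
  quadruple-≉0 = double-≉0 ∘ double-≉0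

module Cubic (R : CommutativeRing c ℓ) where
  open CommutativeRing R
  -- With f the cubic of the curve this is d³ f (a / d). Hence a / d is the abscissa of a point over
  -- the fraction field when `d * cubic e₁ e₂ e₃ a d` is a square.
  cubic : (e₁ e₂ e₃ a d : Carrier) → Carrier
  cubic e₁ e₂ e₃ a d = (a - e₁ * d) * (a - e₂ * d) * (a - e₃ * d)

  open IntegerCoefficients R

  private
    factor-cong : ∀ e {a a′ d d′} → a ≈ a′ → d ≈ d′ → a - e * d ≈ a′ - e * d′
    factor-cong e p q = +-cong p (-‿cong (*-congˡ q))

    factor-scale : ∀ g e a d → g * a - e * (g * d) ≈ g * (a - e * d)
    factor-scale = solve 4 (λ g e a d → g :* a :- e :* (g :* d) := g :* (a :- e :* d)) refl

  cubic-cong : ∀ {e₁ e₂ e₃ a a′ d d′} → a ≈ a′ → d ≈ d′ → cubic e₁ e₂ e₃ a d ≈ cubic e₁ e₂ e₃ a′ d′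
  cubic-cong {e₁} {e₂} {e₃} p q =
    *-cong (*-cong (factor-cong e₁ p q) (factor-cong e₂ p q)) (factor-cong e₃ p q)

  cubic-scale : ∀ g {e₁ e₂ e₃ a d} →
    cubic e₁ e₂ e₃ (g * a) (g * d) ≈ (g * g * g) * cubic e₁ e₂ e₃ a d
  cubic-scale g {e₁} {e₂} {e₃} {a} {d} = trans
    (*-cong (*-cong (factor-scale g e₁ a d) (factor-scale g e₂ a d)) (factor-scale g e₃ a d))
    (solve 4 (λ g x y z → (g :* x) :* (g :* y) :* (g :* z) := (g :* g :* g) :* (x :* y :* z)) refl g
        _ _ _)

module Descent (R : CommutativeRing 0ℓ 0ℓ) (R-factorial : FactorialDomain R)
  (K : CommutativeRing 0ℓ 0ℓ) (K-field : Field K)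
  (φ : CommutativeRing.Carrier R → CommutativeRing.Carrier K)
  (φ-hom : RingMorphisms.IsRingHomomorphism (CommutativeRing.rawRing R) (CommutativeRing.rawRing K)
      φ)
  where

  private module K = CommutativeRing K
  open CommutativeRing R
  open RawSemiringDefinitions (RawRing.rawSemiring rawRing) using (Coprime; _∣_)
  open FactorialDomain R-factorial
  open Factorization R R-factorial
  open Domain R integral
  open Cubic R
  open IntegerCoefficients R
  open Field K-field using () renaming (integral to K-integral)
  open FieldProperties K K-field
  open Quadruple K
  open RingMorphisms.IsRingHomomorphism φ-hom using (⟦⟧-cong; +-homo; *-homo; -‿homo; 0#-homo)
  private
    module KD = Domain K K-integral
    module KS = IntegerCoefficients K

  φ-≉0 : ∀ {x} → ¬ φ x K.≈ K.0# → ¬ x ≈ 0#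
  φ-≉0 φx≉0 x≈0 = φx≉0 (K.trans (⟦⟧-cong x≈0) 0#-homo)

  φ-∣-≉0 : ∀ {x y} → x ∣ y → ¬ φ y K.≈ K.0# → ¬ φ x K.≈ K.0#
  φ-∣-≉0 {x} {y} (q , qx≈y) φy≉0 = KD.≉0ʳ (KD.≉0-cong (K.trans (⟦⟧-cong (sym qx≈y)) (*-homo q x))
      φy≉0)

  φ-shift : ∀ a e d → φ d K.≈ K.0# → φ (a - e * (d * d)) K.≈ φ a
  φ-shift a e d φd≈0 = begin
    φ (a - e * (d * d))                  ≈⟨ K.trans (+-homo _ _) (K.+-congˡ (-‿homo _)) ⟩
    φ a K.- φ (e * (d * d))              ≈⟨ K.+-congˡ
        (K.-‿cong (K.trans (*-homo _ _) (K.*-congˡ (*-homo d d)))) ⟩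
    φ a K.- φ e K.* (φ d K.* φ d)        ≈⟨ K.+-congˡ (K.-‿cong (K.*-congˡ (K.*-congʳ φd≈0))) ⟩
    φ a K.- φ e K.* (K.0# K.* φ d)       ≈⟨ KS.solve 3
        (λ a e d → a KS.:- e KS.:* (KS.con (0 , 0) KS.:* d) KS.:= a) K.refl (φ a) (φ e) (φ d) ⟩
    φ a                                  ∎
    where open SetoidReasoning K.setoid

  open SetoidReasoning setoid

  unit-*ˡ : ∀ {k l} x → k * l ≈ 1# → (k * l) * x ≈ x
  unit-*ˡ x kl≈1 = trans (*-congʳ kl≈1) (*-identityˡ x)

  coprime-shift : ∀ {A D} e → Coprime A D → Coprime (A - e * (D * D)) D
  coprime-shift {A} {D} e A⊥D = coprime-sym λ k∣D k∣ → coprime-+ (- (e * D)) (coprime-sym A⊥D) k∣D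
    (∣ʳ-respʳ-≈ (solve 3 (λ A e D → A :- e :* (D :* D) := A :+ D :* (:- (e :* D))) refl A e D) k∣)

  -- The abscissa a / d rewritten as A / D² in lowest terms. `A∣a` is kept because it transports the
  -- nonvanishing of φ a to φ A.
  record Reduced (e₁ e₂ e₃ a d : Carrier) : Set where
    field
      A D B    : Carrier
      D≉0      : ¬ D ≈ 0#
      coprime  : Coprime A D
      ratio    : a * (D * D) ≈ A * d
      A∣a      : A ∣ a
      equation : B * B ≈ cubic e₁ e₂ e₃ A (D * D)

  -- Cancel g = gcd (a , d); the equation loses a factor g⁴. The new denominator d′ is prime to each
  -- a′ - eᵢ d′, so it is prime to the cubic. As their product is a square, d′ is a unit ε times a
  -- square D².
  reduce : ∀ {e₁ e₂ e₃ a d y} → ¬ d ≈ 0# → y * y ≈ d * cubic e₁ e₂ e₃ a d → ¬ ¬ Reduced e₁ e₂ e₃ a d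
  reduce {e₁} {e₂} {e₃} {a} {d} {y} d≉0 y²≈ = do
    record { g = g ; a′ = a′ ; b′ = d′ ; a-eq = a≈ ; b-eq = d≈ ; coprime = a′⊥d′ } ← split a d≉0
    let g≉0 = ≉0ˡ (≉0-cong d≈ d≉0)
        d′≉0 = ≉0ʳ (≉0-cong d≈ d≉0)
        gg≉0 = *-≉0 g≉0 g≉0
        y²≈g⁴ : y * y ≈ ((g * g) * (g * g)) * (d′ * cubic e₁ e₂ e₃ a′ d′)
        y²≈g⁴ = begin
          y * y                          ≈⟨ y²≈ ⟩
          d * cubic e₁ e₂ e₃ a d                              ≈⟨ *-cong d≈
              (trans (cubic-cong a≈ d≈) (cubic-scale g)) ⟩
          (g * d′) * ((g * g * g) * cubic e₁ e₂ e₃ a′ d′)     ≈⟨ solve 3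
              (λ g d x → (g :* d) :* ((g :* g :* g) :* x) := ((g :* g) :* (g :* g)) :* (d :* x))
                  refl g d′ _ ⟩
          ((g * g) * (g * g)) * (d′ * cubic e₁ e₂ e₃ a′ d′) ∎
    (z , zgg≈y) ← ²∣²⇒∣ gg≉0 (_ , trans (*-comm _ _) (sym y²≈g⁴))
    let z²≈ : d′ * cubic e₁ e₂ e₃ a′ d′ ≈ z * z
        z²≈ = cancelˡ _ (*-≉0 gg≉0 gg≉0) (begin
          ((g * g) * (g * g)) * (d′ * cubic e₁ e₂ e₃ a′ d′)  ≈⟨ y²≈g⁴ ⟨
          y * y                                              ≈⟨ *-cong zgg≈y zgg≈y ⟨
          (z * (g * g)) * (z * (g * g))                      ≈⟨ solve 2
              (λ z g → (z :* (g :* g)) :* (z :* (g :* g)) := ((g :* g) :* (g :* g)) :* (z :* z))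
                  refl z g ⟩
          ((g * g) * (g * g)) * (z * z)                      ∎)
        d′⊥ : ∀ e → Coprime d′ (a′ - e * d′)
        d′⊥ e {k} k∣d′ k∣ = coprime-+ (- e) (coprime-sym a′⊥d′) k∣d′
          (∣ʳ-respʳ-≈ (solve 3 (λ a e d → a :- e :* d := a :+ d :* (:- e)) refl a′ e d′) k∣)
    (ε , D , (ε′ , ε′ε≈1) , d′≈) ← coprime-square d′≉0
        (coprime-* (coprime-* (d′⊥ e₁) (d′⊥ e₂)) (d′⊥ e₃)) z²≈
    let DD≉0 = ≉0ʳ (≉0-cong d′≈ d′≉0)
        -- The unit moves to the numerator: a′ / (ε D²) = (ε⁻¹ a′) / D². On the right of the
        -- equation d′ gives one factor ε and the cubic three, so z is divided by ε².
        A = ε′ * a′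
        b = ε′ * (ε′ * z)
        a′≈ : a′ ≈ ε * A
        a′≈ = sym (begin
          ε * (ε′ * a′)   ≈⟨ solve 3 (λ ε ε′ a → ε :* (ε′ :* a) := (ε′ :* ε) :* a) refl ε ε′ a′ ⟩
          (ε′ * ε) * a′   ≈⟨ unit-*ˡ a′ ε′ε≈1 ⟩
          a′              ∎)
        b²≈ : b * b ≈ (D * D) * cubic e₁ e₂ e₃ A (D * D)
        b²≈ = begin
          (ε′ * (ε′ * z)) * (ε′ * (ε′ * z))
            ≈⟨ solve 2 (λ ε z → (ε :* (ε :* z)) :* (ε :* (ε :* z)) := ((ε :* ε) :* (ε :* ε)) :*
                (z :* z)) refl ε′ z ⟩
          ((ε′ * ε′) * (ε′ * ε′)) * (z * z)
            ≈⟨ *-congˡ z²≈ ⟨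
          ((ε′ * ε′) * (ε′ * ε′)) * (d′ * cubic e₁ e₂ e₃ a′ d′)
            ≈⟨ *-congˡ (*-cong d′≈ (trans (cubic-cong a′≈ d′≈) (cubic-scale ε))) ⟩
          ((ε′ * ε′) * (ε′ * ε′)) * ((ε * (D * D)) * ((ε * ε * ε) * cubic e₁ e₂ e₃ A (D * D)))
            ≈⟨ solve 4 (λ ε′ ε D x →
                ((ε′ :* ε′) :* (ε′ :* ε′)) :* ((ε :* D) :* ((ε :* ε :* ε) :* x))
                := (ε′ :* ε) :* ((ε′ :* ε) :* ((ε′ :* ε) :* ((ε′ :* ε) :* (D :* x)))))
               refl ε′ ε (D * D) _ ⟩
          (ε′ * ε) * ((ε′ * ε) * ((ε′ * ε) * ((ε′ * ε) * ((D * D) * cubic e₁ e₂ e₃ A (D * D)))))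
            ≈⟨ trans (unit-*ˡ _ ε′ε≈1) (trans (unit-*ˡ _ ε′ε≈1)
                (trans (unit-*ˡ _ ε′ε≈1) (unit-*ˡ _ ε′ε≈1))) ⟩
          (D * D) * cubic e₁ e₂ e₃ A (D * D) ∎
    (B , BD≈b) ← ²∣²⇒∣ (≉0ˡ DD≉0) (_ , trans (*-comm _ _) (sym b²≈))
    return record
      { A = A ; D = D ; B = B
      ; D≉0 = ≉0ˡ DD≉0
      ; coprime = coprime-∣ (ε , sym a′≈) (coprime-sym
          (coprime-∣ (∣ʳ-respʳ-≈ (sym d′≈) (∣ʳ-trans (x∣xy D D) (x∣ʳyx (D * D) ε)))
              (coprime-sym a′⊥d′)))
      ; ratio = begin
          a * (D * D)                     ≈⟨ *-congʳ (trans a≈ (*-congˡ a′≈)) ⟩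
          g * (ε * A) * (D * D)           ≈⟨ solve 4
              (λ g ε A D → g :* (ε :* A) :* D := A :* (g :* (ε :* D))) refl g ε A (D * D) ⟩
          A * (g * (ε * (D * D)))         ≈⟨ *-congˡ (trans d≈ (*-congˡ d′≈)) ⟨
          A * d                           ∎
      ; A∣a = g * ε , trans (*-assoc g ε A) (sym (trans a≈ (*-congˡ a′≈)))
      ; equation = cancelˡ (D * D) DD≉0 (begin
          (D * D) * (B * B)     ≈⟨ solve 2 (λ D B → (D :* D) :* (B :* B) := (B :* D) :* (B :* D))
              refl D B ⟩
          (B * D) * (B * D)     ≈⟨ *-cong BD≈b BD≈b ⟩
          b * b                 ≈⟨ b²≈ ⟩
          (D * D) * cubic e₁ e₂ e₃ A (D * D) ∎)
      }

  -- The hypothesis on t₀ as the descent consumes it: a square-free divisor of N is a square as soon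
  -- as its value is one.
  SquaresReflected : Carrier → Set
  SquaresReflected N = ∀ h → SquareFree h → h ∣ N → Square (φ h) → ¬ ¬ (∃[ w ] w * w ≈ h)

  -- gcd (M₁ , M₂ M₃) divides (f₁ - f₂)(f₁ - f₃), and M₁ times it is a
  -- square up to a unit.

  square-root : ∀ {f₁ f₂ f₃ A D B} → SquaresReflected ((f₁ - f₂) * (f₁ - f₃)) →
    Coprime A D → φ D K.≈ K.0# → ¬ φ A K.≈ K.0# → Square (φ A) →
    B * B ≈ cubic f₁ f₂ f₃ A (D * D) →
    ¬ ¬ (∃[ C ] C * C ≈ A - f₁ * (D * D))
  square-root {f₁} {f₂} {f₃} {A} {D} {B} squares A⊥D φD≈0 φA≉0 (r , r²≈φA) B²≈ = do
    record { g = g ; a′ = v ; b′ = u ; a-eq = M₂M₃≈ ; b-eq = M₁≈ ; coprime = v⊥u } ← split (M₂ * M₃)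
        M₁≉0
    let g≉0 = ≉0ˡ (≉0-cong M₁≈ M₁≉0)
        u≉0 = ≉0ʳ (≉0-cong M₁≈ M₁≉0)
        gguv≈ : (g * g) * (u * v) ≈ B * B
        gguv≈ = sym (begin
          B * B               ≈⟨ B²≈ ⟩
          M₁ * M₂ * M₃        ≈⟨ trans (*-assoc _ _ _) (*-cong M₁≈ M₂M₃≈) ⟩
          (g * u) * (g * v)   ≈⟨ solve 3 (λ g u v → (g :* u) :* (g :* v) := (g :* g) :* (u :* v))
              refl g u v ⟩
          (g * g) * (u * v)   ∎)
    (q , qg≈B) ← ²∣²⇒∣ g≉0 (u * v , trans (*-comm _ _) gguv≈)
    (ε , d , (ε′ , ε′ε≈1) , u≈) ← coprime-square u≉0 (coprime-sym v⊥u)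
        (cancelˡ (g * g) (*-≉0 g≉0 g≉0) (begin
      (g * g) * (u * v)   ≈⟨ gguv≈ ⟩
      B * B               ≈⟨ *-cong qg≈B qg≈B ⟨
      (q * g) * (q * g)   ≈⟨ solve 2 (λ q g → (q :* g) :* (q :* g) := (g :* g) :* (q :* q)) refl q g
          ⟩
      (g * g) * (q * q)   ∎))
    let g∣M₁ : g ∣ M₁
        g∣M₁ = ∣ʳ-respʳ-≈ (sym M₁≈) (x∣xy g u)
        g∣M₂M₃ : g ∣ M₂ * M₃
        g∣M₂M₃ = ∣ʳ-respʳ-≈ (sym M₂M₃≈) (x∣xy g v)
        g⊥D = coprime-∣ g∣M₁ M₁⊥D
        g⊥D² = coprime-* g⊥D g⊥D
        -- M₂ = M₁ + (f₁ - f₂) D² and M₃ = M₁ + (f₁ - f₃) D², so M₂ M₃ is D⁴ N modulo M₁. Now g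
        -- divides M₁ and M₂ M₃ and is prime to D.
        g∣N = euclid (coprime-* g⊥D² g⊥D²) (∣ʳ-respʳ-≈ (sym N≈) (∣-+ g∣M₂M₃ (∣-*ˡ _ g∣M₁)))
    (h , k , g≈ , h-sf) ← squareFreePart g≉0
    -- The unit belongs to the square-free part: M₁ must be h′ times an exact square for φ h′ to
    -- inherit being a square from φ M₁ = φ A.
    let h′ = ε * h
        s = k * d
        h′∣h : h′ ∣ h
        h′∣h = ε′ , trans (sym (*-assoc ε′ ε h)) (unit-*ˡ h ε′ε≈1)
        h∣N = ∣ʳ-trans (∣ʳ-respʳ-≈ (sym g≈) (x∣xy h (k * k))) g∣N
        M₁≈h′s² : M₁ ≈ h′ * (s * s)
        M₁≈h′s² = begin
          M₁                              ≈⟨ trans M₁≈ (*-cong g≈ u≈) ⟩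
          (h * (k * k)) * (ε * (d * d))   ≈⟨ solve 4
              (λ h k ε d → (h :* (k :* k)) :* (ε :* (d :* d)) := (ε :* h) :* ((k :* d) :* (k :* d)))
                  refl h k ε d ⟩
          (ε * h) * ((k * d) * (k * d))   ∎
        -- Division by φ s² is legitimate because s divides M₁, whose value is φ A and hence
        -- nonzero.
        φs≉0 = φ-∣-≉0 (∣ʳ-respʳ-≈ (sym M₁≈h′s²) (∣ʳ-trans (x∣xy s s) (x∣ʳyx _ h′))) φM₁≉0
        φh′-square = square-quotient φs≉0 (K.trans
          (K.trans (K.*-congˡ (K.sym (*-homo s s))) (K.sym (*-homo h′ _)))
          (K.trans (⟦⟧-cong (sym M₁≈h′s²)) (K.trans φM₁≈φA (K.sym r²≈φA))))
    (w , w²≈h′) ← squares h′ (λ _ dd∣ → h-sf _ (∣ʳ-trans dd∣ h′∣h)) (∣ʳ-trans h′∣h h∣N) φh′-square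
    return (w * s , (begin
      (w * s) * (w * s)   ≈⟨ solve 2 (λ w s → (w :* s) :* (w :* s) := (w :* w) :* (s :* s)) refl w s
          ⟩
      (w * w) * (s * s)   ≈⟨ *-congʳ w²≈h′ ⟩
      h′ * (s * s)        ≈⟨ M₁≈h′s² ⟨
      M₁                  ∎))
    where
    M₁ = A - f₁ * (D * D)
    M₂ = A - f₂ * (D * D)
    M₃ = A - f₃ * (D * D)
    φM₁≈φA = φ-shift A f₁ D φD≈0
    φM₁≉0 : ¬ φ M₁ K.≈ K.0#
    φM₁≉0 = KD.≉0-cong (K.sym φM₁≈φA) φA≉0
    M₁≉0 = φ-≉0 φM₁≉0
    M₁⊥D : Coprime M₁ D
    M₁⊥D = coprime-shift f₁ A⊥D
    N≈ : (D * D) * (D * D) * ((f₁ - f₂) * (f₁ - f₃)) ≈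
         M₂ * M₃ + M₁ * - (M₁ + (f₁ - f₂) * (D * D) + (f₁ - f₃) * (D * D))
    N≈ = solve 5 (λ f₁ f₂ f₃ A E →
      E :* E :* ((f₁ :- f₂) :* (f₁ :- f₃)) :=
      (A :- f₂ :* E) :* (A :- f₃ :* E) :+ (A :- f₁ :* E) :*
          (:- ((A :- f₁ :* E) :+ (f₁ :- f₂) :* E :+ (f₁ :- f₃) :* E)))
      refl f₁ f₂ f₃ A (D * D)

  -- A point other than O in the kernel of specialization: its abscissa A / D² has a pole at t₀. For
  -- a general φ coprimality does not force `φA≉0`, so it is a separate field.
  record Datum (e₁ e₂ e₃ A D : Carrier) : Set where
    field
      coprime  : Coprime A D
      D≉0      : ¬ D ≈ 0#
      φD≈0     : φ D K.≈ K.0#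
      φA≉0     : ¬ φ A K.≈ K.0#
      B        : Carrier
      equation : B * B ≈ cubic e₁ e₂ e₃ A (D * D)

  -- Applying φ to `ratio` gives φ a (φ D)² = φ A φ d = 0, so the pole survives the reduction.
  reduced-datum : ∀ {e₁ e₂ e₃ a d} → ¬ φ a K.≈ K.0# → φ d K.≈ K.0# →
    (r : Reduced e₁ e₂ e₃ a d) → Datum e₁ e₂ e₃ (Reduced.A r) (Reduced.D r)
  reduced-datum {a = a} {d} φa≉0 φd≈0 r = record
    { coprime = coprime ; D≉0 = D≉0 ; φD≈0 = φD≈0 ; φA≉0 = φ-∣-≉0 A∣a φa≉0 ; B = B ; equation =
        equation }
    where
    open Reduced r
    φaDD≈0 : φ a K.* (φ D K.* φ D) K.≈ K.0#
    φaDD≈0 = K.trans (K.*-congˡ (K.sym (*-homo D D))) (K.trans (K.sym (*-homo a (D * D)))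
      (K.trans (⟦⟧-cong ratio) (K.trans (*-homo A d) (K.trans (K.*-congˡ φd≈0) (K.zeroʳ (φ A))))))
    φD≈0 : φ D K.≈ K.0#
    φD≈0 = [ ⊥-elim ∘ φa≉0 , [ id , id ]′ ∘ K-integral _ _ ]′ (K-integral _ _ φaDD≈0)

  -- This chooses signs of the square roots, that is, one of the four halves of the point: the one
  -- that specializes to O again.
  same-sign : ∀ {C C₁} → φ C K.* φ C K.≈ φ C₁ K.* φ C₁ → ∃[ C′ ] C′ * C′ ≈ C * C × φ C′ K.≈ φ C₁
  same-sign {C} e = [ (λ e⁺ → C , refl , e⁺)
                    , (λ e⁻ → - C , solve 1 (λ C → (:- C) :* (:- C) := C :* C) refl C , K.trans
                        (-‿homo C) e⁻)
                    ]′ (²≈²⇒± e)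

  module _ {e₁ e₂ e₃ : Carrier}
    (squares₁ : SquaresReflected ((e₁ - e₂) * (e₁ - e₃)))
    (squares₂ : SquaresReflected ((e₂ - e₁) * (e₂ - e₃)))
    (squares₃ : SquaresReflected ((e₃ - e₁) * (e₃ - e₂)))
    where

    record Halving (A D : Carrier) : Set where
      field
        C₁ C₂ C₃ : Carrier
        C₁²≈     : C₁ * C₁ ≈ A - e₁ * (D * D)
        C₂²≈     : C₂ * C₂ ≈ A - e₂ * (D * D)
        C₃²≈     : C₃ * C₃ ≈ A - e₃ * (D * D)
        φC₁²≈    : φ C₁ K.* φ C₁ K.≈ φ A
        φC₂≈     : φ C₂ K.≈ φ C₁
        φC₃≈     : φ C₃ K.≈ φ C₁

    halving : ∀ {A D} → Datum e₁ e₂ e₃ A D → ¬ ¬ Halving A D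
    halving {A} {D} Δ = do
      (C₁ , C₁²≈) ← square-root squares₁ coprime φD≈0 φA≉0 φA-square equation
      (C₂ , C₂²≈) ← square-root squares₂ coprime φD≈0 φA≉0 φA-square
        (trans equation (*-congʳ (*-comm _ _)))
      (C₃ , C₃²≈) ← square-root squares₃ coprime φD≈0 φA≉0 φA-square
        (trans equation (trans (*-comm _ _) (sym (*-assoc _ _ _))))
      let (C₂′ , C₂′² , φC₂≈) = same-sign (K.trans (φC² e₂ C₂²≈) (K.sym (φC² e₁ C₁²≈)))
          (C₃′ , C₃′² , φC₃≈) = same-sign (K.trans (φC² e₃ C₃²≈) (K.sym (φC² e₁ C₁²≈)))
      return record
        { C₁ = C₁ ; C₂ = C₂′ ; C₃ = C₃′
        ; C₁²≈ = C₁²≈ ; C₂²≈ = trans C₂′² C₂²≈ ; C₃²≈ = trans C₃′² C₃²≈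
        ; φC₁²≈ = φC² e₁ C₁²≈ ; φC₂≈ = φC₂≈ ; φC₃≈ = φC₃≈ }
      where
      open Datum Δ
      φC² : ∀ {C} e → C * C ≈ A - e * (D * D) → φ C K.* φ C K.≈ φ A
      φC² {C} e C²≈ = K.trans (K.sym (*-homo C C)) (K.trans (⟦⟧-cong C²≈) (φ-shift A e D φD≈0))
      -- Since D vanishes at t₀, the equation becomes B² = A³ there, and A = (B / A)².
      φA-square : Square (φ A)
      φA-square = square-quotient φA≉0 (K.trans (K.sym (K.*-assoc _ _ _)) (K.trans
        (K.*-cong (K.*-cong (K.sym (φ-shift A e₁ D φD≈0)) (K.sym (φ-shift A e₂ D φD≈0)))
            (K.sym (φ-shift A e₃ D φD≈0)))
        (K.trans (K.*-congʳ (K.sym (*-homo _ _))) (K.trans (K.sym (*-homo _ _))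
        (K.trans (⟦⟧-cong (sym equation)) (*-homo B B))))))

    module Half {A D : Carrier} (Δ : Datum e₁ e₂ e₃ A D) (H : Halving A D) where

      open Datum Δ
      open Halving H

      -- x(Q) = a / D² for the half Q of P with x(P) = A / D².

      a y : Carrier
      a = A + (C₁ * C₂ + C₁ * C₃ + C₂ * C₃)
      y = (C₁ + C₂) * (C₁ + C₃) * (C₂ + C₃)

      factor₁ : a - e₁ * (D * D) ≈ (C₁ + C₂) * (C₁ + C₃)
      factor₁ = begin
        a - e₁ * (D * D)                                            ≈⟨ solve 5
            (λ A E x y z → A :+ (x :* y :+ x :* z :+ y :* z) :- E := (A :- E) :+
                (x :* y :+ x :* z :+ y :* z)) refl A (e₁ * (D * D)) C₁ C₂ C₃ ⟩
        (A - e₁ * (D * D)) + (C₁ * C₂ + C₁ * C₃ + C₂ * C₃)          ≈⟨ +-congʳ C₁²≈ ⟨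
        C₁ * C₁ + (C₁ * C₂ + C₁ * C₃ + C₂ * C₃)                     ≈⟨ solve 3
            (λ x y z → x :* x :+ (x :* y :+ x :* z :+ y :* z) := (x :+ y) :* (x :+ z)) refl C₁ C₂ C₃
                ⟩
        (C₁ + C₂) * (C₁ + C₃)                                       ∎

      factor₂ : a - e₂ * (D * D) ≈ (C₁ + C₂) * (C₂ + C₃)
      factor₂ = begin
        a - e₂ * (D * D)                                            ≈⟨ solve 5
            (λ A E x y z → A :+ (x :* y :+ x :* z :+ y :* z) :- E := (A :- E) :+
                (x :* y :+ x :* z :+ y :* z)) refl A (e₂ * (D * D)) C₁ C₂ C₃ ⟩
        (A - e₂ * (D * D)) + (C₁ * C₂ + C₁ * C₃ + C₂ * C₃)          ≈⟨ +-congʳ C₂²≈ ⟨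
        C₂ * C₂ + (C₁ * C₂ + C₁ * C₃ + C₂ * C₃)                     ≈⟨ solve 3
            (λ x y z → y :* y :+ (x :* y :+ x :* z :+ y :* z) := (x :+ y) :* (y :+ z)) refl C₁ C₂ C₃
                ⟩
        (C₁ + C₂) * (C₂ + C₃)                                       ∎

      factor₃ : a - e₃ * (D * D) ≈ (C₁ + C₃) * (C₂ + C₃)
      factor₃ = begin
        a - e₃ * (D * D)                                            ≈⟨ solve 5
            (λ A E x y z → A :+ (x :* y :+ x :* z :+ y :* z) :- E := (A :- E) :+
                (x :* y :+ x :* z :+ y :* z)) refl A (e₃ * (D * D)) C₁ C₂ C₃ ⟩
        (A - e₃ * (D * D)) + (C₁ * C₂ + C₁ * C₃ + C₂ * C₃)          ≈⟨ +-congʳ C₃²≈ ⟨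
        C₃ * C₃ + (C₁ * C₂ + C₁ * C₃ + C₂ * C₃)                     ≈⟨ solve 3
            (λ x y z → z :* z :+ (x :* y :+ x :* z :+ y :* z) := (x :+ z) :* (y :+ z)) refl C₁ C₂ C₃
                ⟩
        (C₁ + C₃) * (C₂ + C₃)                                       ∎

      -- Each of the three sums Cᵢ + Cⱼ occurs in exactly two of the factors a - eᵢD².
      y²≈ : y * y ≈ cubic e₁ e₂ e₃ a (D * D)
      y²≈ = sym (trans (*-cong (*-cong factor₁ factor₂) factor₃)
        (solve 3 (λ p q r → (p :* q) :* (p :* r) :* (q :* r) := (p :* q :* r) :* (p :* q :* r)) refl
            _ _ _))

      -- All Cᵢ have the same value, whose square is φ A, so the three products add 3 φ A to φ A.
      φa≈ : φ a K.≈ quadruple (φ A)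
      φa≈ = K.trans (K.trans (+-homo _ _) (K.+-congˡ (K.trans (+-homo _ _) (K.+-cong
              (K.trans (+-homo _ _) (K.+-cong (*-homo _ _) (*-homo _ _))) (*-homo _ _)))))
        (K.trans (K.+-congˡ (K.+-cong
            (K.+-cong (K.trans (K.*-congˡ φC₂≈) φC₁²≈) (K.trans (K.*-congˡ φC₃≈) φC₁²≈))
            (K.trans (K.*-cong φC₂≈ φC₃≈) φC₁²≈)))
          (KS.solve 1 (λ x → x KS.:+ (x KS.:+ x KS.:+ x) KS.:= (x KS.:+ x) KS.:+ (x KS.:+ x)) K.refl
              (φ A)))

      -- The conjugate of `factor₁` turns sums into differences of squares, and C₁² - Cⱼ² = (eⱼ -
      -- e₁) D² no longer involves A.
      complement : ((C₁ - C₂) * (C₁ - C₃)) * (a - e₁ * (D * D)) ≈ (D * D) * (D * D) *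
          ((e₁ - e₂) * (e₁ - e₃))
      complement = begin
        ((C₁ - C₂) * (C₁ - C₃)) * (a - e₁ * (D * D))           ≈⟨ *-congˡ factor₁ ⟩
        ((C₁ - C₂) * (C₁ - C₃)) * ((C₁ + C₂) * (C₁ + C₃))      ≈⟨ solve 3
            (λ x y z → ((x :- y) :* (x :- z)) :* ((x :+ y) :* (x :+ z)) := (x :* x :- y :* y) :*
                (x :* x :- z :* z)) refl C₁ C₂ C₃ ⟩
        (C₁ * C₁ - C₂ * C₂) * (C₁ * C₁ - C₃ * C₃)              ≈⟨ *-cong (+-cong C₁²≈ (-‿cong C₂²≈))
            (+-cong C₁²≈ (-‿cong C₃²≈)) ⟩
        ((A - e₁ * (D * D)) - (A - e₂ * (D * D))) * ((A - e₁ * (D * D)) - (A - e₃ * (D * D)))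
          ≈⟨ solve 5 (λ A E x y z → ((A :- x :* E) :- (A :- y :* E)) :*
              ((A :- x :* E) :- (A :- z :* E)) := E :* E :* ((x :- y) :* (x :- z))) refl A (D * D)
                  e₁ e₂ e₃ ⟩
        (D * D) * (D * D) * ((e₁ - e₂) * (e₁ - e₃)) ∎

      φD²≈0 : φ (D * D) K.≈ K.0#
      φD²≈0 = K.trans (*-homo D D) (K.trans (K.*-congʳ φD≈0) (K.zeroˡ (φ D)))

      -- By `complement`, a - e₁D² divides D⁴(e₁ - e₂)(e₁ - e₃); being prime to D, it divides the
      -- part independent of the point.
      same-denominator : ¬ φ a K.≈ K.0# → Coprime a D →
        Datum e₁ e₂ e₃ a D × a - e₁ * (D * D) ∣ (e₁ - e₂) * (e₁ - e₃)
      same-denominator φa≉0 a⊥D =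
        record { coprime = a⊥D ; D≉0 = D≉0 ; φD≈0 = φD≈0 ; φA≉0 = φa≉0 ; B = y ; equation = y²≈ } ,
        euclid (coprime-* (coprime-* a-⊥D a-⊥D) (coprime-* a-⊥D a-⊥D)) (_ , complement)
        where
        a-⊥D = coprime-shift e₁ a⊥D

      -- Reduction of a / D² gives A′ / D′² with D′² dividing D², say D = k D′. Were k a unit, D
      -- would divide D′ and a would divide A′, so a and D would be coprime like A′ and D′.
      smaller-denominator : ¬ φ a K.≈ K.0# → ¬ Coprime a D →
        ¬ ¬ (∃[ A′ ] ∃[ D′ ] ∃[ k ] D ≈ k * D′ × ¬ k ∣ 1# × Datum e₁ e₂ e₃ A′ D′)
      smaller-denominator φa≉0 ¬a⊥D = do
        r ← reduce {y = D * y} (*-≉0 D≉0 D≉0) (trans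
          (solve 2 (λ D y → (D :* y) :* (D :* y) := (D :* D) :* (y :* y)) refl D y) (*-congˡ y²≈))
        let module r = Reduced r
            D′⊥A′ = coprime-sym r.coprime
            D′²⊥A′ = coprime-sym (coprime-* r.coprime r.coprime)
            D′²∣D² = euclid D′²⊥A′ (a , r.ratio)
        (k , kD′≈D) ← ²∣²⇒∣ r.D≉0 D′²∣D²
        let unit⇒coprime : k ∣ 1# → Coprime a D
            unit⇒coprime (k′ , k′k≈1) =
              let D∣D′ : D ∣ r.D
                  D∣D′ = k′ , trans (*-congˡ (sym kD′≈D))
                      (trans (sym (*-assoc k′ k r.D)) (unit-*ˡ r.D k′k≈1))
                  a∣A′ : a ∣ r.A
                  a∣A′ = cancel-∣ (*-≉0 D≉0 D≉0) (∣ʳ-trans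
                    (∣ʳ-respˡ-≈ (*-comm a (D * D)) (x∣y⇒zx∣zy a (∙-cong-∣ D∣D′ D∣D′)))
                    (∣ʳ-reflexive (trans r.ratio (*-comm r.A (D * D)))))
              in coprime-∣ a∣A′ (coprime-sym (coprime-∣ D∣D′ D′⊥A′))
        return (r.A , r.D , k , sym kD′≈D , ¬a⊥D ∘ unit⇒coprime , reduced-datum φa≉0 φD²≈0 r)

    module _
      (unbounded : ∀ {x y} → ¬ φ x K.≈ K.0# → ¬ y K.≈ K.0# →
        ¬ (∀ n → ¬ ¬ (∃[ z ] z ∣ x × φ z K.≈ quadrupleⁿ n y)))
      (e₁₂ : ¬ φ (e₁ - e₂) K.≈ K.0#)
      (e₁₃ : ¬ φ (e₁ - e₃) K.≈ K.0#)
      where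

      φN≉0 : ¬ φ ((e₁ - e₂) * (e₁ - e₃)) K.≈ K.0#
      φN≉0 = KD.≉0-cong (K.sym (*-homo _ _)) (KD.*-≉0 e₁₂ e₁₃)

      -- No datum has a denominator of smaller norm, so halving a datum over D always returns one
      -- over the same D.
      module Chain {n : ℕ} {D : Carrier} (∥D∥≡n : Norm D n)
        (rec : ∀ {m} → m ℕ.< n → ∀ {A′ D′} → Norm D′ m → ¬ Datum e₁ e₂ e₃ A′ D′) where

        Next : Carrier → Set
        Next a = Datum e₁ e₂ e₃ a D × a - e₁ * (D * D) ∣ (e₁ - e₂) * (e₁ - e₃)

        next : ∀ {A} → Datum e₁ e₂ e₃ A D → ¬ ¬ (∃[ a ] φ a K.≈ quadruple (φ A) × Next a)
        next {A} Δ = do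
          H ← halving Δ
          let open Half Δ H
              φa≉0 = KD.≉0-cong (K.sym φa≈) (quadruple-≉0 (Datum.φA≉0 Δ))
              descend : ¬ ¬ Coprime a D
              descend ¬a⊥D = smaller-denominator φa≉0 ¬a⊥D
                λ (A′ , D′ , k , D≈ , k∤1 , Δ′) →
                  let (m , m<n , ∥D′∥≡m) = norm-< D≈ k∤1 ∥D∥≡n in rec m<n ∥D′∥≡m Δ′
          a⊥D ← descend
          return (a , φa≈ , same-denominator φa≉0 a⊥D)

        -- After k + 1 halvings. The first is not counted in k, because the divisibility in `Next`
        -- is only available once a halving has been made.
        chain : ∀ {A} → Datum e₁ e₂ e₃ A D → ∀ k →
                ¬ ¬ (∃[ a ] φ a K.≈ quadrupleⁿ k (quadruple (φ A)) × Next a)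
        chain Δ zero    = next Δ
        chain Δ (suc k) = do
          (a , φa≈ , Δ′ , _)      ← chain Δ k
          (b , φb≈ , Δ″∣N) ← next Δ′
          return (b , K.trans φb≈ (quadruple-cong φa≈) , Δ″∣N)

      -- Strong induction on the norm of D: a minimal datum starts a chain, whose numerators shifted
      -- by e₁D² all divide (e₁ - e₂)(e₁ - e₃) while their values grow as 4ᵏ. This contradicts
      -- `unbounded`.
      no-datum : ∀ n {A D} → Norm D n → ¬ Datum e₁ e₂ e₃ A D
      no-datum = <-rec _ λ n rec {A} {D} ∥D∥≡n Δ →
        unbounded φN≉0 (quadruple-≉0 (Datum.φA≉0 Δ)) λ k → ¬¬-map
          (λ (a , φa≈ , _ , ∣N) → a - e₁ * (D * D) , ∣N , K.trans (φ-shift a e₁ D (Datum.φD≈0 Δ))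
              φa≈)
          (Chain.chain ∥D∥≡n rec Δ k)

      -- The outcome of the descent, in terms of an arbitrary fraction for the abscissa:
      -- specialization sends no point but O to O.
      no-pole : ∀ {a d y} → ¬ d ≈ 0# → y * y ≈ d * cubic e₁ e₂ e₃ a d →
                       ¬ φ a K.≈ K.0# → ¬ φ d K.≈ K.0#
      no-pole d≉0 y²≈ φa≉0 φd≈0 = reduce d≉0 y²≈ λ r →
        no-datum _ (proj₂ (norm (Reduced.D≉0 r))) (reduced-datum φa≉0 φd≈0 r)

-- Differences of points

module CubicExpansion (R : CommutativeRing c ℓ) where
  open CommutativeRing R
  open IntegerCoefficients R
  open Cubic R

  module _ (e₁ e₂ e₃ : Carrier) where

    s₁ s₂ s₃ : Carrier
    s₁ = e₁ + e₂ + e₃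
    s₂ = e₁ * e₂ + e₁ * e₃ + e₂ * e₃
    s₃ = e₁ * e₂ * e₃

    cubic-expand : ∀ a d → cubic e₁ e₂ e₃ a d ≈ a * a * a - s₁ * a * a * d + s₂ * a * d * d - s₃ * d
        * d * d
    cubic-expand a d = solve 5 (λ e₁ e₂ e₃ a d →
      (a :- e₁ :* d) :* (a :- e₂ :* d) :* (a :- e₃ :* d) :=
      a :* a :* a :- (e₁ :+ e₂ :+ e₃) :* a :* a :* d :+ (e₁ :* e₂ :+ e₁ :* e₃ :+ e₂ :* e₃) :* a :* d
          :* d :- e₁ :* e₂ :* e₃ :* d :* d :* d)
      refl e₁ e₂ e₃ a d

    -- The homogenized divided difference (f (x) - f (y)) / (x - y); on the diagonal x = y it is the
    -- derivative of f.
    chord : (x y z : Carrier) → Carrier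
    chord x y z = x * x + x * y + y * y - s₁ * z * (x + y) + s₂ * z * z

    cubic-chord : ∀ x y z → cubic e₁ e₂ e₃ x z - cubic e₁ e₂ e₃ y z ≈ (x - y) * chord x y z
    cubic-chord x y z = trans (+-cong (cubic-expand x z) (-‿cong (cubic-expand y z)))
      (solve 6 (λ x y z s t p →
        (x :* x :* x :- s :* x :* x :* z :+ t :* x :* z :* z :- p :* z :* z :* z)
        :- (y :* y :* y :- s :* y :* y :* z :+ t :* y :* z :* z :- p :* z :* z :* z)
        := (x :- y) :* (x :* x :+ x :* y :+ y :* y :- s :* z :* (x :+ y) :+ t :* z :* z))
        refl x y z s₁ s₂ s₃)

    tangent-factors : ∀ x z → chord x x z ≈
      (x - e₂ * z) * (x - e₃ * z) + (x - e₁ * z) * (x - e₃ * z) + (x - e₁ * z) * (x - e₂ * z)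
    tangent-factors x z = solve 5 (λ e₁ e₂ e₃ x z →
      x :* x :+ x :* x :+ x :* x :- (e₁ :+ e₂ :+ e₃) :* z :* (x :+ x) :+
          (e₁ :* e₂ :+ e₁ :* e₃ :+ e₂ :* e₃) :* z :* z
      := (x :- e₂ :* z) :* (x :- e₃ :* z) :+ (x :- e₁ :* z) :* (x :- e₃ :* z) :+ (x :- e₁ :* z) :*
          (x :- e₂ :* z))
      refl e₁ e₂ e₃ x z

  module _ (integral : Integral R) where
    open Domain R integral

    -- The roots are simple: when one linear factor vanishes, the derivative is the product of the
    -- two others, and these are nonzero because the roots differ.
    tangent-≉0 : ∀ {e₁ e₂ e₃ x z} → ¬ e₁ - e₂ ≈ 0# → ¬ e₁ - e₃ ≈ 0# → ¬ e₂ - e₃ ≈ 0# → ¬ z ≈ 0# →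
                 cubic e₁ e₂ e₃ x z ≈ 0# → ¬ chord e₁ e₂ e₃ x x z ≈ 0#
    tangent-≉0 {e₁} {e₂} {e₃} {x} {z} e₁₂ e₁₃ e₂₃ z≉0 cubic≈0 chord≈0 =
      [ [ case₁ , case₂ ]′ ∘ integral _ _ , case₃ ]′ (integral _ _ cubic≈0)
      where
      factors≈0 = trans (sym (tangent-factors e₁ e₂ e₃ x z)) chord≈0

      other-factor : ∀ e f → x - e * z ≈ 0# → ¬ e - f ≈ 0# → ¬ x - f * z ≈ 0#
      other-factor e f x≈ez e≉f x≈fz = *-≉0 e≉f z≉0
        (trans (solve 4 (λ e f x z → (e :- f) :* z := (x :- f :* z) :- (x :- e :* z)) refl e f x z)
        (trans (+-cong x≈fz (-‿cong x≈ez)) (-‿inverseʳ 0#)))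

      flip-≉0 : ∀ {e f} → ¬ e - f ≈ 0# → ¬ f - e ≈ 0#
      flip-≉0 {e} {f} e≉f f≈e = e≉f (trans (solve 2 (λ e f → e :- f := con (0 , 0) :- (f :- e)) refl
          e f)
        (trans (+-congˡ (-‿cong f≈e)) (-‿inverseʳ 0#)))

      only : ∀ {p q r} → p ≈ 0# → ¬ q ≈ 0# → ¬ r ≈ 0# → ¬ q * r + p * r + p * q ≈ 0#
      only {p} {q} {r} p≈0 q≉0 r≉0 e = *-≉0 q≉0 r≉0 (trans
        (solve 3 (λ p q r → q :* r := (q :* r :+ p :* r :+ p :* q) :- p :* (r :+ q)) refl p q r)
        (trans (+-cong e (-‿cong (trans (*-congʳ p≈0) (zeroˡ _)))) (-‿inverseʳ 0#)))

      case₁ : ¬ x - e₁ * z ≈ 0#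
      case₁ e = only e (other-factor e₁ e₂ e e₁₂) (other-factor e₁ e₃ e e₁₃) factors≈0

      case₂ : ¬ x - e₂ * z ≈ 0#
      case₂ e = only e (other-factor e₂ e₁ e (flip-≉0 e₁₂)) (other-factor e₂ e₃ e e₂₃)
        (trans (solve 3 (λ p q r → p :* r :+ q :* r :+ q :* p := q :* r :+ p :* r :+ p :* q) refl
            (x - e₁ * z) (x - e₂ * z) (x - e₃ * z)) factors≈0)

      case₃ : ¬ x - e₃ * z ≈ 0#
      case₃ e = only e (other-factor e₃ e₁ e (flip-≉0 e₁₃)) (other-factor e₃ e₂ e (flip-≉0 e₂₃))
        (trans (solve 3 (λ p q r → p :* q :+ r :* q :+ r :* p := q :* r :+ p :* r :+ p :* q) refl
            (x - e₁ * z) (x - e₂ * z) (x - e₃ * z)) factors≈0)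

  -- The line y = λ (x - x₁) + y₁ with λ = u / v through (x₁ , y₁) and
  -- (x₂ , - y₂) meets the curve a third time at x = a / d.

  module ThirdPoint {e₁ e₂ e₃ x₁ y₁ x₂ y₂ z u v : Carrier}
    (on-curve : y₁ * y₁ * z ≈ cubic e₁ e₂ e₃ x₁ z)
    (slope    : u * (x₁ - x₂) ≈ v * (y₁ + y₂))
    (slope′   : u * ((y₁ - y₂) * z) ≈ v * chord e₁ e₂ e₃ x₁ x₂ z)
    where

    open SetoidReasoning setoid
    private
      s = s₁ e₁ e₂ e₃
      t = s₂ e₁ e₂ e₃
      p = s₃ e₁ e₂ e₃

    -- The points are (xᵢ / z , ± yᵢ / z). By Vieta the third abscissa is λ² + s - (x₁ + x₂) / z
    -- with s the sum of the roots; n / d is its difference from x₁ / z, and w / (v³ z) is the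
    -- ordinate on the line.
    n a d w : Carrier
    n = u * u * z + v * v * (s * z - x₁ - x₁ - x₂)
    a = v * v * x₁ + n
    d = v * v * z
    w = u * n + y₁ * (v * v * v)

    private
      derivative : Carrier
      derivative = x₁ * x₁ + x₁ * x₁ + x₁ * x₁ - s * x₁ * z - s * x₁ * z + t * z * z

      -- Put h = x - x₁. Along the line f minus the square of the ordinate is h (h - (x₂ - x₁)) (h -
      -- n / d), up to the scaling by z. This compares the coefficients of h, and `third-root` those
      -- of h². Both forms of the slope enter, since `slope` alone says nothing when x₁ = x₂ and y₁
      -- = - y₂.
      tangency : n * (x₁ - x₂) + v * v * derivative ≈ v * (u * z * (y₁ + y₁))
      tangency = begin
        n * (x₁ - x₂) + v * v * derivative
          ≈⟨ solve 7 (λ s t z u v x y →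
               (u :* u :* z :+ v :* v :* (s :* z :- x :- x :- y)) :* (x :- y)
                 :+ v :* v :* (x :* x :+ x :* x :+ x :* x :- s :* x :* z :- s :* x :* z :+ t :* z :*
                     z)
               := u :* z :* (u :* (x :- y)) :+ v :*
                   (v :* (x :* x :+ x :* y :+ y :* y :- s :* z :* (x :+ y) :+ t :* z :* z)))
               refl s t z u v x₁ x₂ ⟩
        u * z * (u * (x₁ - x₂)) + v * (v * chord e₁ e₂ e₃ x₁ x₂ z)
          ≈⟨ +-cong (*-congˡ slope) (*-congˡ (sym slope′)) ⟩
        u * z * (v * (y₁ + y₂)) + v * (u * ((y₁ - y₂) * z))
          ≈⟨ solve 5 (λ z u v x y → u :* z :* (v :* (x :+ y)) :+ v :* (u :* ((x :- y) :* z)) := v :*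
              (u :* z :* (x :+ x))) refl z u v y₁ y₂ ⟩
        v * (u * z * (y₁ + y₁)) ∎

      -- Expansion of the cubic at v² x₁ with increment n, the denominator d being fixed.
      taylor : cubic e₁ e₂ e₃ a d ≈ cubic e₁ e₂ e₃ (v * v * x₁) d
        + n * (n * (n + (v * v * x₁ + v * v * x₁ + v * v * x₁ - s * d)) + v * v *
            (v * v * derivative))
      taylor = begin
        cubic e₁ e₂ e₃ a d
          ≈⟨ cubic-expand e₁ e₂ e₃ a d ⟩
        a * a * a - s * a * a * d + t * a * d * d - p * d * d * d
          ≈⟨ solve 6 (λ s t p n q d →
               let a = q :+ n in
               a :* a :* a :- s :* a :* a :* d :+ t :* a :* d :* d :- p :* d :* d :* d
               := (q :* q :* q :- s :* q :* q :* d :+ t :* q :* d :* d :- p :* d :* d :* d)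
                  :+ n :* (n :* (n :+ (q :+ q :+ q :- s :* d)) :+
                      (q :* q :+ q :* q :+ q :* q :- s :* q :* d :- s :* q :* d :+ t :* d :* d)))
               refl s t p n (v * v * x₁) d ⟩
        (let q = v * v * x₁ in (q * q * q - s * q * q * d + t * q * d * d - p * d * d * d)
          + n * (n * (n + (q + q + q - s * d)) +
              (q * q + q * q + q * q - s * q * d - s * q * d + t * d * d)))
          ≈⟨ +-cong (sym (cubic-expand e₁ e₂ e₃ _ d)) (*-congˡ (+-congˡ
               (solve 5 (λ s t V x z →
                 V :* x :* (V :* x) :+ V :* x :* (V :* x) :+ V :* x :* (V :* x) :- s :* (V :* x) :*
                     (V :* z) :- s :* (V :* x) :* (V :* z) :+ t :* (V :* z) :* (V :* z)
                 := V :* (V :* (x :* x :+ x :* x :+ x :* x :- s :* x :* z :- s :* x :* z :+ t :* z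
                     :* z)))
                 refl s t (v * v) x₁ z))) ⟩
        _ ∎

      third-root : n + (v * v * x₁ + v * v * x₁ + v * v * x₁ - s * d) ≈ z * u * u + v * v *
          (x₁ - x₂)
      third-root = solve 6 (λ s z u V x y →
        (u :* u :* z :+ V :* (s :* z :- x :- x :- y)) :+
            (V :* x :+ V :* x :+ V :* x :- s :* (V :* z))
        := z :* u :* u :+ V :* (x :- y)) refl s z u (v * v) x₁ x₂

    third-point : (v * z * w) * (v * z * w) ≈ d * cubic e₁ e₂ e₃ a d
    third-point = sym (begin
      d * cubic e₁ e₂ e₃ a d
        ≈⟨ *-congˡ taylor ⟩
      d * (cubic e₁ e₂ e₃ (v * v * x₁) d
        + n * (n * (n + (v * v * x₁ + v * v * x₁ + v * v * x₁ - s * d)) + v * v *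
            (v * v * derivative)))
        ≈⟨ *-congˡ (+-cong (trans (cubic-scale (v * v)) (*-congˡ (sym on-curve)))
            (*-congˡ (+-congʳ (*-congˡ third-root)))) ⟩
      d * ((v * v) * (v * v) * (v * v) * (y₁ * y₁ * z)
        + n * (n * (z * u * u + v * v * (x₁ - x₂)) + v * v * (v * v * derivative)))
        ≈⟨ *-congˡ (+-congˡ (*-congˡ (solve 6
            (λ n z u V X D → n :* (z :* u :* u :+ V :* X) :+ V :* (V :* D) := n :* (z :* u :* u) :+
                V :* (n :* X :+ V :* D)) refl n z u (v * v) (x₁ - x₂) derivative))) ⟩
      d * ((v * v) * (v * v) * (v * v) * (y₁ * y₁ * z)
        + n * (n * (z * u * u) + v * v * (n * (x₁ - x₂) + v * v * derivative)))
        ≈⟨ *-congˡ (+-congˡ (*-congˡ (+-congˡ (*-congˡ tangency)))) ⟩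
      d * ((v * v) * (v * v) * (v * v) * (y₁ * y₁ * z)
        + n * (n * (z * u * u) + v * v * (v * (u * z * (y₁ + y₁)))))
        ≈⟨ solve 5 (λ n z u v y →
             v :* v :* z :* ((v :* v) :* (v :* v) :* (v :* v) :* (y :* y :* z) :+ n :*
                 (n :* (z :* u :* u) :+ v :* v :* (v :* (u :* z :* (y :+ y)))))
             := v :* z :* (u :* n :+ y :* (v :* v :* v)) :*
                 (v :* z :* (u :* n :+ y :* (v :* v :* v))))
             refl n z u v y₁ ⟩
      v * z * w * (v * z * w) ∎)

module Separation (R : CommutativeRing c ℓ) (R-integral : Integral R)
  (K : CommutativeRing c′ ℓ′) (K-field : Field K)
  (φ : CommutativeRing.Carrier R → CommutativeRing.Carrier K)
  (φ-hom : RingMorphisms.IsRingHomomorphism (CommutativeRing.rawRing R) (CommutativeRing.rawRing K)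
      φ)
  where

  open CommutativeRing R
  open Cubic R
  open CubicExpansion R
  open IntegerCoefficients R
  open Domain R R-integral
  open Field K-field using () renaming (integral to K-integral)
  open FieldProperties K K-field using (double-≉0)
  open RingMorphisms.IsRingHomomorphism φ-hom using (⟦⟧-cong; +-homo; *-homo; -‿homo; 0#-homo)
  open SetoidReasoning setoid
  private
    module K = CommutativeRing K
    module KD = Domain K K-integral
    module KC = Cubic K
    module KE = CubicExpansion K

  module _ {e₁ e₂ e₃ : Carrier}
    (e₁₂ : ¬ φ (e₁ - e₂) K.≈ K.0#)
    (e₁₃ : ¬ φ (e₁ - e₃) K.≈ K.0#)
    (e₂₃ : ¬ φ (e₂ - e₃) K.≈ K.0#)
    (no-pole : ∀ {a d y} → ¬ d ≈ 0# → y * y ≈ d * cubic e₁ e₂ e₃ a d →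
               ¬ φ a K.≈ K.0# → ¬ φ d K.≈ K.0#)
    where

    private
      φ≉0⇒≉0 : ∀ {x} → ¬ φ x K.≈ K.0# → ¬ x ≈ 0#
      φ≉0⇒≉0 φx≉0 x≈0 = φx≉0 (K.trans (⟦⟧-cong x≈0) 0#-homo)

      φ-*≉0 : ∀ {x y} → ¬ φ x K.≈ K.0# → ¬ φ y K.≈ K.0# → ¬ φ (x * y) K.≈ K.0#
      φ-*≉0 φx≉0 φy≉0 = KD.≉0-cong (K.sym (*-homo _ _)) (KD.*-≉0 φx≉0 φy≉0)

      φ-*≈0ˡ : ∀ {x} y → φ x K.≈ K.0# → φ (x * y) K.≈ K.0#
      φ-*≈0ˡ y φx≈0 = K.trans (*-homo _ y) (K.trans (K.*-congʳ φx≈0) (K.zeroˡ _))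

      φ-+≈0 : ∀ {x y} → φ x K.≈ K.0# → φ y K.≈ K.0# → φ (x + y) K.≈ K.0#
      φ-+≈0 φx≈0 φy≈0 = K.trans (+-homo _ _) (K.trans (K.+-cong φx≈0 φy≈0) (K.+-identityʳ _))

      φ-+≉0 : ∀ {x y} → ¬ φ x K.≈ K.0# → φ y K.≈ K.0# → ¬ φ (x + y) K.≈ K.0#
      φ-+≉0 φx≉0 φy≈0 = KD.≉0-cong (K.sym (K.trans (+-homo _ _)
          (K.trans (K.+-congˡ φy≈0) (K.+-identityʳ _)))) φx≉0

      φ-sub : ∀ x y → φ (x - y) K.≈ φ x K.- φ y
      φ-sub x y = K.trans (+-homo x _) (K.+-congˡ (-‿homo y))

      φ-sub≈0 : ∀ {x y} → φ x K.≈ φ y → φ (x - y) K.≈ K.0#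
      φ-sub≈0 {x} {y} e = K.trans (φ-sub x y) (K.trans (K.+-congʳ e) (K.-‿inverseʳ _))

      φ-cubic : ∀ x z → φ (cubic e₁ e₂ e₃ x z) K.≈ KC.cubic (φ e₁) (φ e₂) (φ e₃) (φ x) (φ z)
      φ-cubic x z = K.trans (*-homo _ _) (K.*-cong
          (K.trans (*-homo _ _) (K.*-cong (linear e₁) (linear e₂))) (linear e₃))
        where
        linear : ∀ e → φ (x - e * z) K.≈ φ x K.- φ e K.* φ z
        linear e = K.trans (φ-sub x _) (K.+-congˡ (K.-‿cong (*-homo e z)))

      difference≉0 : ∀ {x y} → ¬ φ (x - y) K.≈ K.0# → ¬ φ x K.- φ y K.≈ K.0#
      difference≉0 = KD.≉0-cong (φ-sub _ _)

    -- x(P) = X / Z = V / X², and this has no common zero at t₀.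

    no-kernel : ∀ {X Y Z} → ¬ Z ≈ 0# → Y * Y * Z ≈ cubic e₁ e₂ e₃ X Z → φ Z K.≈ K.0# →
                ¬ ¬ (φ X K.≈ K.0# × φ Y K.≈ K.0# × φ Z K.≈ K.0#)
    no-kernel {X} {Y} {Z} Z≉0 equation φZ≈0 reg =
      no-pole X²≉0 square (φV≉0) (φ-*≈0ˡ X φX≈0)
      where
      s = s₁ e₁ e₂ e₃
      t = s₂ e₁ e₂ e₃
      p = s₃ e₁ e₂ e₃
      -- The cofactor of Z once X³ is isolated in the equation of the curve. Modulo X and Z it is
      -- Y², and Y cannot vanish at t₀ together with them.
      V = Y * Y + (X * (s * X) + Z * (p * Z - t * X))
      X³≈ZV : X * X * X ≈ Z * V
      X³≈ZV = begin
        X * X * X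
          ≈⟨ solve 5 (λ X Z s t p → X :* X :* X :=
              (X :* X :* X :- s :* X :* X :* Z :+ t :* X :* Z :* Z :- p :* Z :* Z :* Z)
               :+ Z :* (X :* (s :* X) :+ Z :* (p :* Z :- t :* X))) refl X Z s t p ⟩
        (X * X * X - s * X * X * Z + t * X * Z * Z - p * Z * Z * Z) + Z *
            (X * (s * X) + Z * (p * Z - t * X))
          ≈⟨ +-congʳ (trans equation (cubic-expand e₁ e₂ e₃ X Z)) ⟨
        Y * Y * Z + Z * (X * (s * X) + Z * (p * Z - t * X))
          ≈⟨ solve 3 (λ Y Z r → Y :* Y :* Z :+ Z :* r := Z :* (Y :* Y :+ r)) refl Y Z _ ⟩
        Z * V ∎
      φX≈0 : φ X K.≈ K.0#
      φX≈0 = [ [ id , id ]′ ∘ K-integral _ _ , id ]′ (K-integral _ _ (K.trans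
        (K.sym (K.trans (*-homo _ _) (K.*-congʳ (*-homo _ _))))
        (K.trans (⟦⟧-cong X³≈ZV) (φ-*≈0ˡ V φZ≈0))))
      φY≉0 : ¬ φ Y K.≈ K.0#
      φY≉0 φY≈0 = reg (φX≈0 , φY≈0 , φZ≈0)
      φV≉0 : ¬ φ V K.≈ K.0#
      φV≉0 = φ-+≉0 (φ-*≉0 φY≉0 φY≉0) (φ-+≈0 (φ-*≈0ˡ _ φX≈0) (φ-*≈0ˡ _ φZ≈0))
      X≉0 : ¬ X ≈ 0#
      X≉0 X≈0 = *-≉0 Z≉0 (φ≉0⇒≉0 φV≉0) (trans (sym X³≈ZV) (trans (*-congˡ X≈0) (zeroʳ _)))
      X²≉0 = *-≉0 X≉0 X≉0
      square : (X * V * Y) * (X * V * Y) ≈ (X * X) * cubic e₁ e₂ e₃ V (X * X)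
      square = cancelˡ (Z * Z * Z) (*-≉0 (*-≉0 Z≉0 Z≉0) Z≉0) (sym (begin
        (Z * Z * Z) * ((X * X) * cubic e₁ e₂ e₃ V (X * X))
          ≈⟨ solve 3 (λ z x c → z :* (x :* c) := x :* (z :* c)) refl (Z * Z * Z) (X * X) _ ⟩
        (X * X) * ((Z * Z * Z) * cubic e₁ e₂ e₃ V (X * X))
          ≈⟨ *-congˡ (cubic-scale Z) ⟨
        (X * X) * cubic e₁ e₂ e₃ (Z * V) (Z * (X * X))
          ≈⟨ *-congˡ (cubic-cong (sym X³≈ZV) (*-comm Z (X * X))) ⟩
        (X * X) * cubic e₁ e₂ e₃ ((X * X) * X) ((X * X) * Z)
          ≈⟨ *-congˡ (trans (cubic-scale (X * X)) (*-congˡ (sym equation))) ⟩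
        (X * X) * ((X * X) * (X * X) * (X * X) * (Y * Y * Z))
          ≈⟨ solve 3 (λ X Y Z → (X :* X) :* ((X :* X) :* (X :* X) :* (X :* X) :* (Y :* Y :* Z)) :=
              (X :* X :* X) :* (X :* X :* X) :* (X :* X :* Y :* Y :* Z)) refl X Y Z ⟩
        (X * X * X) * (X * X * X) * (X * X * Y * Y * Z)
          ≈⟨ *-congʳ (*-cong X³≈ZV X³≈ZV) ⟩
        (Z * V) * (Z * V) * (X * X * Y * Y * Z)
          ≈⟨ solve 4 (λ X Y Z V → (Z :* V) :* (Z :* V) :* (X :* X :* Y :* Y :* Z) := (Z :* Z :* Z)
              :* ((X :* V :* Y) :* (X :* V :* Y))) refl X Y Z V ⟩
        (Z * Z * Z) * ((X * V * Y) * (X * V * Y)) ∎))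

    private
      module _ {x₁ y₁ x₂ y₂ z : Carrier}
        (on-curve₁ : y₁ * y₁ * z ≈ cubic e₁ e₂ e₃ x₁ z)
        (on-curve₂ : y₂ * y₂ * z ≈ cubic e₁ e₂ e₃ x₂ z)
        (φz≉0 : ¬ φ z K.≈ K.0#)
        (φx₁≈φx₂ : φ x₁ K.≈ φ x₂)
        (φy₁≈φy₂ : φ y₁ K.≈ φ y₂)
        where

        c₁₂ : Carrier
        c₁₂ = chord e₁ e₂ e₃ x₁ x₂ z

        chord-equation : (y₁ + y₂) * ((y₁ - y₂) * z) ≈ (x₁ - x₂) * c₁₂
        chord-equation = begin
          (y₁ + y₂) * ((y₁ - y₂) * z)                            ≈⟨ solve 3
              (λ x y z → (x :+ y) :* ((x :- y) :* z) := x :* x :* z :- y :* y :* z) refl y₁ y₂ z ⟩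
          y₁ * y₁ * z - y₂ * y₂ * z                              ≈⟨ +-cong on-curve₁
              (-‿cong on-curve₂) ⟩
          cubic e₁ e₂ e₃ x₁ z - cubic e₁ e₂ e₃ x₂ z              ≈⟨ cubic-chord e₁ e₂ e₃ x₁ x₂ z ⟩
          (x₁ - x₂) * c₁₂                                        ∎

        z≉0 = φ≉0⇒≉0 φz≉0

        -- A line through P and - Q whose slope u / v has a pole at t₀.

        no-steep-line : ∀ u v → ¬ φ u K.≈ K.0# → φ v K.≈ K.0# → ¬ v ≈ 0# →
          u * (x₁ - x₂) ≈ v * (y₁ + y₂) → u * ((y₁ - y₂) * z) ≈ v * c₁₂ → ⊥
        no-steep-line u v φu≉0 φv≈0 v≉0 slope slope′ =
          -- Modulo v² the numerator a is u² z, which is nonzero at t₀, while d = v² z vanishes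
          -- there: the third point, Q - P, would specialize to O.
          no-pole (*-≉0 (*-≉0 v≉0 v≉0) z≉0) third-point φa≉0 (φ-*≈0ˡ z φvv≈0)
          where
          open ThirdPoint {e₁} {e₂} {e₃} {x₁} {y₁} {x₂} {y₂} {z} {u} {v} on-curve₁ slope slope′
          φvv≈0 = φ-*≈0ˡ v φv≈0
          φa≉0 : ¬ φ a K.≈ K.0#
          φa≉0 = KD.≉0-cong (⟦⟧-cong (+-comm n _))
            (φ-+≉0 (φ-+≉0 (φ-*≉0 (φ-*≉0 φu≉0 φu≉0) φz≉0) (φ-*≈0ˡ _ φvv≈0)) (φ-*≈0ˡ x₁ φvv≈0))

        -≈0⇒≈ : ∀ {x y} → x - y ≈ 0# → x ≈ y
        -≈0⇒≈ {x} {y} e = trans (solve 2 (λ x y → x := (x :- y) :+ y) refl x y)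
            (trans (+-congʳ e) (+-identityˡ y))

        φ-chord : φ c₁₂ K.≈ KE.chord (φ e₁) (φ e₂) (φ e₃) (φ x₁) (φ x₁) (φ z)
        φ-chord = K.trans (+-homo _ _) (K.+-cong
            (K.trans (φ-sub _ _) (K.+-cong
              (K.trans (+-homo _ _) (K.+-cong (K.trans (+-homo _ _) (K.+-cong (*-homo _ _)
                 (K.trans (*-homo _ _) (K.*-congˡ φx₂≈))))
                     (K.trans (*-homo _ _) (K.*-cong φx₂≈ φx₂≈))))
              (K.-‿cong (K.trans (*-homo _ _) (K.*-cong (K.trans (*-homo _ _) (K.*-congʳ
                 (K.trans (+-homo _ _) (K.+-congʳ (+-homo _ _)))))
                 (K.trans (+-homo _ _) (K.+-congˡ φx₂≈)))))))
            (K.trans (*-homo _ _) (K.*-congʳ (K.trans (*-homo _ _) (K.*-congʳ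
              (K.trans (+-homo _ _) (K.+-cong
                  (K.trans (+-homo _ _) (K.+-cong (*-homo _ _) (*-homo _ _))) (*-homo _ _))))))))
          where φx₂≈ = K.sym φx₁≈φx₂

        -- By `chord-equation` the slope is both (y₁ + y₂) / (x₁ - x₂) and the divided difference
        -- over (y₁ - y₂) z. Both denominators vanish at t₀. If y₁ does not vanish there, the first
        -- numerator has value 2 y₁ ≠ 0; if it does, the second has the derivative at a simple root
        -- as its value.
        separated : ¬ ¬ (x₁ ≈ x₂ × y₁ ≈ y₂)
        separated ≢ = secant λ φy₁≈0 → vertical φy₁≈0
          where
          secant : ¬ φ y₁ K.≈ K.0# → ⊥
          secant φy₁≉0 = no-steep-line (y₁ + y₂) (x₁ - x₂) φ+≉0 (φ-sub≈0 φx₁≈φx₂) v≉0 (*-comm _ _)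
              chord-equation
            where
            φ+≉0 = KD.≉0-cong (K.sym (K.trans (+-homo _ _) (K.+-congˡ (K.sym φy₁≈φy₂))))
                (double-≉0 φy₁≉0)
            v≉0 : ¬ x₁ - x₂ ≈ 0#
            v≉0 e = [ φ≉0⇒≉0 φ+≉0 , [ (λ y≈ → ≢ (-≈0⇒≈ e , -≈0⇒≈ y≈)) , z≉0 ]′ ∘ R-integral _ _ ]′
              (R-integral _ _ (trans chord-equation (trans (*-congʳ e) (zeroˡ _))))

          vertical : φ y₁ K.≈ K.0# → ⊥
          vertical φy₁≈0 = no-steep-line c₁₂ ((y₁ - y₂) * z) φc≉0 (φ-*≈0ˡ z (φ-sub≈0 φy₁≈φy₂)) v≉0
            (trans (*-comm _ _) (trans (sym chord-equation) (*-comm _ _))) (*-comm _ _)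
            where
            φc≉0 : ¬ φ c₁₂ K.≈ K.0#
            φc≉0 = KD.≉0-cong (K.sym φ-chord)
                (KE.tangent-≉0 K-integral (difference≉0 e₁₂) (difference≉0 e₁₃) (difference≉0 e₂₃)
                    φz≉0
              (K.trans (K.sym (φ-cubic x₁ z))
                  (K.trans (⟦⟧-cong (sym on-curve₁)) (φ-*≈0ˡ z (φ-*≈0ˡ y₁ φy₁≈0)))))
            v≉0 : ¬ (y₁ - y₂) * z ≈ 0#
            v≉0 e = [ (λ y≈ → [ (λ x≈ → ≢ (-≈0⇒≈ x≈ , -≈0⇒≈ y≈)) , φ≉0⇒≉0 φc≉0 ]′
                (R-integral _ _ (trans (sym chord-equation) (trans (*-congˡ e) (zeroʳ _))))) , z≉0
                    ]′ (R-integral _ _ e)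

    -- Multiplying the first triple by Z₂ and the second by Z₁ gives both points the denominator Z₁
    -- Z₂, as `separated` requires.
    equal : ∀ {X₁ Y₁ Z₁ X₂ Y₂ Z₂} →
      Y₁ * Y₁ * Z₁ ≈ cubic e₁ e₂ e₃ X₁ Z₁ → Y₂ * Y₂ * Z₂ ≈ cubic e₁ e₂ e₃ X₂ Z₂ →
      ¬ φ Z₁ K.≈ K.0# → ¬ φ Z₂ K.≈ K.0# →
      φ Z₂ K.* φ X₁ K.≈ φ Z₁ K.* φ X₂ → φ Z₂ K.* φ Y₁ K.≈ φ Z₁ K.* φ Y₂ →
      ¬ ¬ (Z₂ * X₁ ≈ Z₁ * X₂ × Z₂ * Y₁ ≈ Z₁ * Y₂)
    equal {X₁} {Y₁} {Z₁} {X₂} {Y₂} {Z₂} eq₁ eq₂ φZ₁≉0 φZ₂≉0 φX≈ φY≈ =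
      separated (common Z₂ eq₁)
        (trans (*-congˡ (*-comm Z₂ Z₁)) (trans (common Z₁ eq₂) (cubic-cong refl (*-comm Z₁ Z₂))))
        (φ-*≉0 φZ₂≉0 φZ₁≉0) (homo φX≈) (homo φY≈)
      where
      common : ∀ w {X Y Z} → Y * Y * Z ≈ cubic e₁ e₂ e₃ X Z →
               w * Y * (w * Y) * (w * Z) ≈ cubic e₁ e₂ e₃ (w * X) (w * Z)
      common w {X} {Y} {Z} eq = trans
        (solve 3 (λ w Y Z → w :* Y :* (w :* Y) :* (w :* Z) := (w :* w :* w) :* (Y :* Y :* Z)) refl w
            Y Z)
        (trans (*-congˡ eq) (sym (cubic-scale w)))
      homo : ∀ {a b c d} → φ a K.* φ b K.≈ φ c K.* φ d → φ (a * b) K.≈ φ (c * d)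
      homo e = K.trans (*-homo _ _) (K.trans e (K.sym (*-homo _ _)))

-- Polynomials over a factorial domain

module Smoothness (R : CommutativeRing c ℓ) where
  open CommutativeRing R
  open RawSemiringDefinitions (RawRing.rawSemiring rawRing) using (_∣_; Prime)

  -- A unit times a product of primes. In a polynomial ring the nonzero constants have this form,
  -- and these are the denominators that Euclid's algorithm creates.
  data Smooth (x : Carrier) : Set (c ⊔ ℓ) where
    unit  : x ∣ 1# → Smooth x
    prime : ∀ {p y} → Prime p → Smooth y → x ≈ p * y → Smooth x

-- Euclid's lemma from Bezout identities with denominators

module Bezout (R : CommutativeRing c ℓ) where

  open CommutativeRing R
  open RawSemiringDefinitions (RawRing.rawSemiring rawRing) using (_∣_)
  open Smoothness R

  -- A greatest common divisor over the fraction field of the coefficients, with denominators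
  -- cleared: d is a combination of a and b, but divides them only after multiplication by n.
  record PseudoGcd (a b : Carrier) : Set (c ⊔ ℓ) where
    field
      n u v d    : Carrier
      smooth     : Smooth n
      d≉0        : ¬ d ≈ 0#
      combination : d ≈ u * a + v * b
      d∣na       : d ∣ n * a
      d∣nb       : d ∣ n * b

  open IntegerCoefficients R
  open SemiringDivisibility semiring hiding (_∣_; _,_)
  open SetoidReasoning setoid

  unit-* : ∀ {x y} → x ∣ 1# → y ∣ 1# → x * y ∣ 1#
  unit-* {x} {y} (x′ , x′x≈1) (y′ , y′y≈1) = x′ * y′ , trans
    (solve 4 (λ x y x′ y′ → (x′ :* y′) :* (x :* y) := (x′ :* x) :* (y′ :* y)) refl x y x′ y′)
    (trans (*-cong x′x≈1 y′y≈1) (*-identityˡ 1#))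

  smooth-unit-* : ∀ {x y} → x ∣ 1# → Smooth y → Smooth (x * y)
  smooth-unit-* x∣1 (unit y∣1)                = unit (unit-* x∣1 y∣1)
  smooth-unit-* x∣1 (prime p-prime y-smooth e) = prime p-prime (smooth-unit-* x∣1 y-smooth)
    (trans (*-congˡ e) (solve 3 (λ x p y → x :* (p :* y) := p :* (x :* y)) refl _ _ _))

  smooth-* : ∀ {x y} → Smooth x → Smooth y → Smooth (x * y)
  smooth-* (unit x∣1) y-smooth                 = smooth-unit-* x∣1 y-smooth
  smooth-* (prime p-prime x-smooth e) y-smooth = prime p-prime (smooth-* x-smooth y-smooth)
    (trans (*-congʳ e) (*-assoc _ _ _))

  pseudoGcd-step : ∀ {a b l q r} → Smooth l → l * a ≈ q * b + r → PseudoGcd b r → PseudoGcd a b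
  pseudoGcd-step {a} {b} {l} {q} {r} l-smooth la≈ G = record
    { n = n * l ; u = v * l ; v = u - v * q ; d = d
    ; smooth = smooth-* smooth l-smooth
    ; d≉0 = d≉0
    ; combination = begin
        d                                       ≈⟨ combination ⟩
        u * b + v * r                           ≈⟨ solve 5
            (λ u b v r q → u :* b :+ v :* r := v :* (q :* b :+ r) :+ (u :- v :* q) :* b) refl u b v
                r q ⟩
        v * (q * b + r) + (u - v * q) * b       ≈⟨ +-congʳ (*-congˡ la≈) ⟨
        v * (l * a) + (u - v * q) * b           ≈⟨ +-congʳ (*-assoc v l a) ⟨
        v * l * a + (u - v * q) * b             ∎
    ; d∣na = ∣-+ (∣ʳ-trans d∣na (x∣ʳyx (n * b) q)) d∣nb (begin
        q * (n * b) + n * r   ≈⟨ solve 4 (λ q n b r → q :* (n :* b) :+ n :* r := n :* (q :* b :+ r))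
            refl q n b r ⟩
        n * (q * b + r)       ≈⟨ *-congˡ la≈ ⟨
        n * (l * a)           ≈⟨ *-assoc n l a ⟨
        n * l * a             ∎)
    ; d∣nb = ∣ʳ-respʳ-≈ (solve 3 (λ l n b → l :* (n :* b) := n :* l :* b) refl l n b)
        (∣ʳ-trans d∣na (x∣ʳyx (n * b) l))
    }
    where
    open PseudoGcd G
    ∣-+ : ∀ {x y z w} → x ∣ y → x ∣ z → y + z ≈ w → x ∣ w
    ∣-+ {x} (k , e) (m , f) g = k + m , trans (distribʳ x k m) (trans (+-cong e f) g)

  pseudoGcd-base : ∀ {a b l q} → ¬ b ≈ 0# → Smooth l → l * a ≈ q * b → PseudoGcd a b
  pseudoGcd-base {a} {b} {l} {q} b≉0 l-smooth la≈ = record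
    { n = l ; u = 0# ; v = 1# ; d = b ; smooth = l-smooth ; d≉0 = b≉0
    ; combination = solve 2 (λ a b → b := con (0 , 0) :* a :+ con (1 , 0) :* b) refl a b
    ; d∣na = q , sym la≈ ; d∣nb = x∣ʳyx b l }

  division-step : ∀ {a a′ b s l q r β γ w} → l * a′ ≈ q * b + r → a′ ≈ β * a - γ * s → s ≈ w * b →
                  (l * β) * a ≈ (q + l * γ * w) * b + r
  division-step {a} {a′} {b} {s} {l} {q} {r} {β} {γ} {w} la′≈ a′≈ s≈ = begin
    (l * β) * a                                       ≈⟨ solve 5
        (λ l β a γ s → (l :* β) :* a := l :* (β :* a :- γ :* s) :+ l :* γ :* s) refl l β a γ s ⟩
    l * (β * a - γ * s) + l * γ * s                   ≈⟨ +-cong (trans (*-congˡ (sym a′≈)) la′≈)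
        (*-congˡ s≈) ⟩
    (q * b + r) + l * γ * (w * b)                     ≈⟨ solve 6
        (λ q b r l γ w → (q :* b :+ r) :+ l :* γ :* (w :* b) := (q :+ l :* γ :* w) :* b :+ r) refl q
            b r l γ w ⟩
    (q + l * γ * w) * b + r                           ∎

module EuclidsLemma (R : CommutativeRing c ℓ) (integral : Integral R)
  (_≟0 : ∀ x → Dec (CommutativeRing._≈_ R x (CommutativeRing.0# R)))
  (bezout : ∀ a {b} → ¬ CommutativeRing._≈_ R b (CommutativeRing.0# R) → Bezout.PseudoGcd R a b)
  where

  open CommutativeRing R
  open RawSemiringDefinitions (RawRing.rawSemiring rawRing) using (_∣_; Prime; Coprime)
  open Smoothness R
  open Bezout R using (module PseudoGcd)
  open Domain R integral
  open IntegerCoefficients R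
  open SemiringDivisibility semiring hiding (_∣_; _,_)
  open SemigroupDivisibility *-commutativeSemigroup using (x∣xy)
  open SetoidReasoning setoid

  private
    unit-cancel : ∀ {n d a} → n ∣ 1# → d ∣ n * a → d ∣ a
    unit-cancel {n} {d} {a} (n′ , n′n≈1) d∣na = ∣ʳ-respʳ-≈
      (trans (sym (*-assoc n′ n a)) (trans (*-congʳ n′n≈1) (*-identityˡ a)))
          (∣ʳ-trans d∣na (x∣ʳyx (n * a) n′))

    cancel-prime : ∀ {p x y z} → ¬ p ≈ 0# → p * x * y ≈ p * z → x * y ≈ z
    cancel-prime p≉0 e = cancelˡ _ p≉0 (trans (sym (*-assoc _ _ _)) e)

  -- Induction on the primes p of n, with k d = n a and l d = n b. Either p divides both k and l and
  -- cancels, or p divides d and is moved from d to m. When no prime is left, d divides a and b and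
  -- is a unit.
  smooth-multiple : ∀ {n a b d} → Smooth n → Coprime a b → d ∣ n * a → d ∣ n * b →
                    ∃[ m ] Smooth m × d ∣ m
  smooth-multiple (unit n∣1) a⊥b d∣na d∣nb =
    1# , unit ∣ʳ-refl , a⊥b (unit-cancel n∣1 d∣na) (unit-cancel n∣1 d∣nb)
  smooth-multiple {n} {a} {b} {d} (prime {p} {m} p-prime m-smooth n≈pm) a⊥b (k , kd≈na) (l , ld≈nb)
      =
    [ (λ p∣k → [ p∣k∧p∣l p∣k , p∣d ]′ (split-∣ p∣ld)) , p∣d ]′ (split-∣ p∣kd)
    where
    open Prime p-prime
    expand : ∀ {a} → n * a ≈ p * (m * a)
    expand = trans (*-congʳ n≈pm) (*-assoc p m _)
    p∣kd : p ∣ k * d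
    p∣kd = ∣ʳ-respʳ-≈ (sym (trans kd≈na expand)) (x∣xy p _)
    p∣ld : p ∣ l * d
    p∣ld = ∣ʳ-respʳ-≈ (sym (trans ld≈nb expand)) (x∣xy p _)
    p∣k∧p∣l : p ∣ k → p ∣ l → ∃[ m ] Smooth m × d ∣ m
    p∣k∧p∣l (k′ , k′p≈k) (l′ , l′p≈l) = smooth-multiple m-smooth a⊥b
      (k′ , cancel-prime p≉0 (trans (*-congʳ (trans (*-comm p k′) k′p≈k)) (trans kd≈na expand)))
      (l′ , cancel-prime p≉0 (trans (*-congʳ (trans (*-comm p l′) l′p≈l)) (trans ld≈nb expand)))
    p∣d : p ∣ d → ∃[ m ] Smooth m × d ∣ m
    p∣d (d′ , d′p≈d) = lift (smooth-multiple m-smooth a⊥b (k , divide kd≈na) (l , divide ld≈nb))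
      where
      divide : ∀ {k a} → k * d ≈ n * a → k * d′ ≈ m * a
      divide {k} e = cancelˡ p p≉0 (trans (solve 3 (λ p k d → p :* (k :* d) := k :* (d :* p)) refl p
          k d′)
        (trans (*-congˡ d′p≈d) (trans e expand)))
      lift : ∃[ m ] Smooth m × d′ ∣ m → ∃[ m ] Smooth m × d ∣ m
      lift (m′ , m′-smooth , (q , qd′≈m′)) = p * m′ , prime p-prime m′-smooth refl , q , (begin
        q * d         ≈⟨ *-congˡ d′p≈d ⟨
        q * (d′ * p)  ≈⟨ solve 3 (λ p q d → q :* (d :* p) := p :* (q :* d)) refl p q d′ ⟩
        p * (q * d′)  ≈⟨ *-congˡ qd′≈m′ ⟩
        p * m′        ∎)

  -- The primes p of n are removed one at a time. With k a = n c and l a = b c one gets b k = n l,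
  -- so p divides k a and b k. It cannot divide both a and b, hence it divides k and cancels.
  smooth-cancel : ∀ {n a b c} → ¬ a ≈ 0# → Smooth n → Coprime a b → a ∣ b * c → a ∣ n * c → a ∣ c
  smooth-cancel a≉0 (unit n∣1) a⊥b a∣bc a∣nc = unit-cancel n∣1 a∣nc
  smooth-cancel {n} {a} {b} {c} a≉0 (prime {p} {m} p-prime m-smooth n≈pm) a⊥b (l , la≈bc)
      (k , ka≈nc) =
    [ p∣k , (λ p∣a → [ (λ p∣b → ⊥-elim (p∤1 (a⊥b p∣a p∣b))) , p∣k ]′ (split-∣ p∣bk)) ]′
        (split-∣ p∣ka)
    where
    open Prime p-prime
    nx≈pmx : ∀ {x} → n * x ≈ p * (m * x)
    nx≈pmx = trans (*-congʳ n≈pm) (*-assoc p m _)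
    p∣ka : p ∣ k * a
    p∣ka = ∣ʳ-respʳ-≈ (sym (trans ka≈nc nx≈pmx)) (x∣xy p _)
    p∣bk : p ∣ b * k
    p∣bk = ∣ʳ-respʳ-≈ (sym (trans bk≈nl nx≈pmx)) (x∣xy p _)
      where
      bk≈nl : b * k ≈ n * l
      bk≈nl = cancelˡ a a≉0 (begin
        a * (b * k)   ≈⟨ solve 3 (λ a b k → a :* (b :* k) := b :* (k :* a)) refl a b k ⟩
        b * (k * a)   ≈⟨ *-congˡ ka≈nc ⟩
        b * (n * c)   ≈⟨ solve 3 (λ b n c → b :* (n :* c) := n :* (b :* c)) refl b n c ⟩
        n * (b * c)   ≈⟨ *-congˡ la≈bc ⟨
        n * (l * a)   ≈⟨ solve 3 (λ n l a → n :* (l :* a) := a :* (n :* l)) refl n l a ⟩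
        a * (n * l)   ∎)
    p∣k : p ∣ k → a ∣ c
    p∣k (k′ , k′p≈k) = smooth-cancel a≉0 m-smooth a⊥b (l , la≈bc)
      (k′ , cancel-prime p≉0 (trans (*-congʳ (trans (*-comm p k′) k′p≈k)) (trans ka≈nc nx≈pmx)))

  -- For d = u b + v a the pseudo-gcd, coprimality makes d divide a product m of primes. Then a
  -- divides m c, because it divides b c, and `smooth-cancel` removes m. If a = 0, coprimality makes
  -- b a unit.
  euclid : ∀ {a b c} → Coprime a b → a ∣ b * c → a ∣ c
  euclid {a} {b} {c} a⊥b a∣bc = cases (a ≟0)
    where
    cases : Dec (a ≈ 0#) → a ∣ c
    cases (yes a≈0) = ∣ʳ-respˡ-≈ (sym a≈0) (∣ʳ-respʳ-≈ (begin
        0#             ≈⟨ zeroʳ b′ ⟨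
        b′ * 0#        ≈⟨ *-congˡ (0∣x⇒x≈0 (∣ʳ-respˡ-≈ a≈0 a∣bc)) ⟨
        b′ * (b * c)   ≈⟨ *-assoc b′ b c ⟨
        b′ * b * c     ≈⟨ *-congʳ b′b≈1 ⟩
        1# * c         ≈⟨ *-identityˡ c ⟩
        c              ∎) ∣ʳ-refl)
      where
      b∣1 : b ∣ 1#
      b∣1 = a⊥b (∣ʳ-respʳ-≈ (sym a≈0) (b ∣0)) ∣ʳ-refl
      b′ = _∣ʳ_.quotient b∣1
      b′b≈1 = _∣ʳ_.equality b∣1
    cases (no a≉0) = smooth-cancel a≉0 (proj₁ (proj₂ multiple)) a⊥b a∣bc
        (∣-mc (proj₂ (proj₂ multiple)))
      where
      open PseudoGcd (bezout b a≉0)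
      multiple = smooth-multiple smooth a⊥b d∣nb d∣na
      ∣-mc : ∀ {m} → d ∣ m → a ∣ m * c
      ∣-mc {m} (q , qd≈m) = q * (u * _∣ʳ_.quotient a∣bc + v * c) , (begin
        q * (u * l + v * c) * a          ≈⟨ solve 6
            (λ q u l v c a → q :* (u :* l :+ v :* c) :* a := q :* (u :* (l :* a) :+ v :* (c :* a)))
                refl q u l v c a ⟩
        q * (u * (l * a) + v * (c * a))  ≈⟨ *-congˡ (+-congʳ (*-congˡ (_∣ʳ_.equality a∣bc))) ⟩
        q * (u * (b * c) + v * (c * a))  ≈⟨ solve 6
            (λ q u b c v a → q :* (u :* (b :* c) :+ v :* (c :* a)) := q :* (u :* b :+ v :* a) :* c)
                refl q u b c v a ⟩
        q * (u * b + v * a) * c          ≈⟨ *-congʳ (*-congˡ combination) ⟨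
        q * d * c                        ≈⟨ *-congʳ qd≈m ⟩
        m * c                            ∎)
        where l = _∣ʳ_.quotient a∣bc

record NormedFactorial (A : CommutativeRing c ℓ) : Set (c ⊔ ℓ) where
  open CommutativeRing A
  open RawSemiringDefinitions (RawRing.rawSemiring rawRing) using (_∣_; Prime)
  field
    _≟0         : ∀ x → Dec (x ≈ 0#)
    _∣?_        : ∀ x y → Dec (x ∣ y)
    integral    : Integral A
    1≉0         : ¬ 1# ≈ 0#
    ∥_∥         : Carrier → ℕ
    ∥∥-cong     : ∀ {x y} → x ≈ y → ∥ x ∥ ≡ ∥ y ∥
    ∥∥-*        : ∀ x y → ∥ x * y ∥ ≡ ∥ x ∥ ℕ.* ∥ y ∥
    ∥1∥≡1       : ∥ 1# ∥ ≡ 1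
    ∥∥-≉0       : ∀ {x} → ¬ x ≈ 0# → 1 ℕ.≤ ∥ x ∥
    ∥∥-unit     : ∀ {x} → ∥ x ∥ ≡ 1 → x ∣ 1#
    primeFactor : ∀ {x} → ¬ x ≈ 0# →
      x ∣ 1# ⊎ (∃[ p ] ∃[ m ] Prime p × x ≈ p * m × ∥ m ∥ ℕ.< ∥ x ∥)

-- Gauss's lemma, pseudo-division and the norm of a polynomial

module PolynomialDivisibility (A : CommutativeRing c ℓ) (A-factorial : NormedFactorial A) where

  open CommutativeRing A hiding (zero)
  open RawSemiringDefinitions (RawRing.rawSemiring rawRing) using (_∣_; Prime)
  open NormedFactorial A-factorial
  open Polynomial A
  open SemiringDivisibility semiring using (∣ʳ-respʳ-≈)
  private
    P : CommutativeRing c ℓ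
    P = polynomialRing
    module P = CommutativeRing P
    module D = Domain A integral
    open D using (*-≉0)
    module S = IntegerCoefficients A
    module PD = SemiringDivisibility P.semiring

  open RawSemiringDefinitions (RawRing.rawSemiring P.rawRing) using () renaming
      (_∣_ to _∣ₚ_; Coprime to Coprimeₚ)

  polynomial-integral : Integral P
  polynomial-integral = ⊛-integral _≟0 integral

  private module PDom = Domain P polynomial-integral

  const-⊛ : ∀ x f → const x ⊛ f ≋ scale x f
  const-⊛ x f = ≋-trans (⊕-cong (≋-refl {scale x f}) (∷-≋[] refl ≋-refl)) (⊕-identityʳ _)

  const-* : ∀ x y → const x ⊛ const y ≋ const (x * y)
  const-* x y = const-⊛ x (const y)

  const-cong : ∀ {x y} → x ≈ y → const x ≋ const y
  const-cong e = ∷-cong e ≋-refl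

  const-≉0 : ∀ {x} → ¬ x ≈ 0# → ¬ const x ≋ []
  const-≉0 x≉0 e = x≉0 (at e 0)

  const-∣⇒∣ : ∀ x {f} → const x ∣ₚ f → ∀ n → x ∣ coeff f n
  const-∣⇒∣ x {f} (q , e) n = coeff q n , trans (*-comm _ x)
    (trans (sym (coeff-scale x q n)) (at (≋-trans (≋-sym (const-⊛ x q))
        (≋-trans (⊛-comm (const x) q) e)) n))

  ∣⇒const-∣ : ∀ x f → (∀ n → x ∣ coeff f n) → const x ∣ₚ f
  ∣⇒const-∣ x []      h = [] , ≋-refl
  ∣⇒const-∣ x (a ∷ f) h with h 0 | ∣⇒const-∣ x f (λ n → h (suc n))
  ... | q , qx≈a | r , e = q ∷ r , ≋-trans (⊛-comm (q ∷ r) (const x)) (≋-trans (const-⊛ x (q ∷ r))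
    (∷-cong (trans (*-comm x q) qx≈a) (≋-trans (≋-sym (const-⊛ x r))
        (≋-trans (⊛-comm (const x) r) e))))

  private
    ∣-minus : ∀ {x y z} → x ∣ y + z → x ∣ y → x ∣ z
    ∣-minus {x} {y} {z} (p , e) (q , f) = p - q , trans
      (S.solve 3 (λ x p q → (p S.:- q) S.:* x S.:= p S.:* x S.:- q S.:* x) refl x p q)
      (trans (+-cong e (-‿cong f)) (S.solve 2 (λ y z → (y S.:+ z) S.:- y S.:= z) refl y z))

    ∣-multiple : ∀ {x y} z → x ∣ y → x ∣ y * z
    ∣-multiple {x} {y} z (q , e) = q * z , trans
        (S.solve 3 (λ q z x → q S.:* z S.:* x S.:= q S.:* x S.:* z) refl q z x) (*-congʳ e)

    coeff-⊛ˡ : ∀ a f g n → coeff ((a ∷ f) ⊛ g) (suc n) ≈ a * coeff g (suc n) + coeff (f ⊛ g) n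
    coeff-⊛ˡ a f g n = trans (coeff-⊕ (scale a g) _ (suc n)) (+-congʳ (coeff-scale a g (suc n)))

    coeff-⊛ʳ : ∀ f b g n → coeff (f ⊛ (b ∷ g)) (suc n) ≈ b * coeff f (suc n) + coeff (f ⊛ g) n
    coeff-⊛ʳ f b g n = trans (at (⊛-∷ f b g) (suc n))
        (trans (coeff-⊕ (scale b f) _ (suc n)) (+-congʳ (coeff-scale b f (suc n))))

  module _ {p : Carrier} (p-prime : Prime p) where

    open Prime p-prime

    private
      -- The lowest coefficient of the product is a b, so p divides b; its contribution can then be
      -- dropped, which leaves a shorter g.
      gauss-∤ : ∀ {a} f g → ¬ p ∣ a → (∀ n → p ∣ coeff ((a ∷ f) ⊛ g) n) → ∀ n → p ∣ coeff g n
      gauss-∤ f []      p∤a h n = 0# , zeroˡ p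
      gauss-∤ {a} f (b ∷ g) p∤a h n = go n
        where
        p∣b : p ∣ b
        p∣b = [ ⊥-elim ∘ p∤a , id ]′ (split-∣ (∣ʳ-respʳ-≈ (+-identityʳ (a * b)) (h 0)))
        go : ∀ n → p ∣ coeff (b ∷ g) n
        go zero    = p∣b
        go (suc n) = gauss-∤ f g p∤a (λ n → ∣-minus
            (∣ʳ-respʳ-≈ (coeff-⊛ʳ (a ∷ f) b g n) (h (suc n))) (∣-multiple _ p∣b)) n

      -- Gauss's lemma read from the constant term upwards: coefficients of f divisible by p are
      -- stripped until the first one that is not, where `gauss-∤` applies.
      gauss′ : ∀ f g → (∀ n → p ∣ coeff (f ⊛ g) n) → (∀ n → p ∣ coeff f n) ⊎ (∀ n → p ∣ coeff g n)
      gauss′ []      g h = inj₁ λ n → 0# , zeroˡ p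
      gauss′ (a ∷ f) g h = cases (p ∣? a)
        where
        cases : Dec (p ∣ a) → (∀ n → p ∣ coeff (a ∷ f) n) ⊎ (∀ n → p ∣ coeff g n)
        cases (no  p∤a) = inj₂ (gauss-∤ f g p∤a h)
        cases (yes p∣a) = map₁ (λ { h′ zero → p∣a ; h′ (suc n) → h′ n })
          (gauss′ f g λ n → ∣-minus (∣ʳ-respʳ-≈ (coeff-⊛ˡ a f g n) (h (suc n))) (∣-multiple _ p∣a))

    gauss : ∀ f g → const p ∣ₚ f ⊛ g → const p ∣ₚ f ⊎ const p ∣ₚ g
    gauss f g p∣fg = [ inj₁ ∘ ∣⇒const-∣ p f , inj₂ ∘ ∣⇒const-∣ p g ]′
        (gauss′ f g (const-∣⇒∣ p p∣fg))

  -- Degree less than n. Lists may end in zeros, so their length only bounds the degree, and the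
  -- exact degree is a relation that excludes zero.
  Below : ℕ → Poly → Set ℓ
  Below n f = ∀ i → coeff f (n ℕ.+ i) ≈ 0#

  record Degree (f : Poly) (n : ℕ) : Set ℓ where
    constructor degree
    field
      leading≉0 : ¬ coeff f n ≈ 0#
      above     : Below (suc n) f

  open Degree

  below-length : ∀ f → Below (length f) f
  below-length []      i = refl
  below-length (a ∷ f) i = below-length f i

  below-≤ : ∀ {m n} f → m ℕ.≤ n → Below m f → Below n f
  below-≤ {m} {n} f m≤n h i = ≡.subst (λ k → coeff f k ≈ 0#)
    (≡.trans (≡.sym (ℕₚ.+-assoc m (n ℕ.∸ m) i)) (≡.cong (ℕ._+ i) (ℕₚ.m+[n∸m]≡n m≤n)))
        (h (n ℕ.∸ m ℕ.+ i))

  below-degree : ∀ n f → Below n f → f ≋ [] ⊎ (∃[ m ] m ℕ.< n × Degree f m)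
  below-degree zero    f h = inj₁ (coeffwise h)
  below-degree (suc n) f h = cases (coeff f n ≟0)
    where
    cases : Dec (coeff f n ≈ 0#) → f ≋ [] ⊎ (∃[ m ] m ℕ.< suc n × Degree f m)
    cases (no  c≉0) = inj₂ (n , ℕₚ.≤-refl , degree c≉0 h)
    cases (yes c≈0) = map₂ (λ (m , m<n , d) → m , ℕₚ.m<n⇒m<1+n m<n , d) (below-degree n f λ
      { zero    → ≡.subst (λ k → coeff f k ≈ 0#) (≡.sym (ℕₚ.+-identityʳ n)) c≈0
      ; (suc i) → ≡.subst (λ k → coeff f k ≈ 0#) (≡.sym (ℕₚ.+-suc n i)) (h i) })

  zero-or-degree : ∀ f → f ≋ [] ⊎ (∃[ m ] Degree f m)
  zero-or-degree f = map₂ (λ (m , _ , d) → m , d) (below-degree (length f) f (below-length f))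

  degree-of : ∀ {f} → ¬ f ≋ [] → ∃[ m ] Degree f m
  degree-of {f} f≉0 = [ ⊥-elim ∘ f≉0 , id ]′ (zero-or-degree f)

  degree-≉0 : ∀ {f n} → Degree f n → ¬ f ≋ []
  degree-≉0 {n = n} d f≋0 = leading≉0 d (at f≋0 n)

  degree-cong : ∀ {f g n} → f ≋ g → Degree f n → Degree g n
  degree-cong {n = n} f≋g d = degree (λ e → leading≉0 d (trans (at f≋g n) e))
      (λ i → trans (sym (at f≋g _)) (above d i))

  degree-unique : ∀ {f m n} → Degree f m → Degree f n → m ≡ n
  degree-unique {f} {m} {n} d e = ℕₚ.≤-antisym (bound e d) (bound d e)
    where
    bound : ∀ {m n} → Degree f m → Degree f n → n ℕ.≤ m
    bound {m} {n} d e = ℕₚ.≮⇒≥ λ m<n → leading≉0 e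
      (≡.subst (λ k → coeff f k ≈ 0#) (ℕₚ.m+[n∸m]≡n m<n) (above d (n ℕ.∸ suc m)))

  coeff-⊛-degree : ∀ f g {m n} → Below (suc m) f → Below (suc n) g →
    coeff (f ⊛ g) (m ℕ.+ n) ≈ coeff f m * coeff g n × Below (suc (m ℕ.+ n)) (f ⊛ g)
  coeff-⊛-degree []      g f↓ g↓ = sym (zeroˡ _) , λ i → refl
  coeff-⊛-degree (a ∷ f) g {zero} {n} f↓ g↓ =
    trans (at product n) (coeff-scale a g n) ,
    λ i → trans (at product _) (trans (coeff-scale a g _) (trans (*-congˡ (g↓ i)) (zeroʳ a)))
    where
    product : (a ∷ f) ⊛ g ≋ scale a g
    product = ≋-trans (⊛-congʳ {a ∷ f} {const a} g (∷-cong refl (coeffwise f↓))) (const-⊛ a g)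
  coeff-⊛-degree (a ∷ f) g {suc m} {n} f↓ g↓ =
    trans (step (m ℕ.+ n) (m , ≡.cong suc (ℕₚ.+-comm m n))) (proj₁ rec) ,
    λ i → trans (step (suc (m ℕ.+ n ℕ.+ i)) (suc m ℕ.+ i , ≡.cong suc (reorder i))) (proj₂ rec i)
    where
    rec = coeff-⊛-degree f g f↓ g↓
    step : ∀ k → (∃[ i ] suc k ≡ suc n ℕ.+ i) → coeff ((a ∷ f) ⊛ g) (suc k) ≈ coeff (f ⊛ g) k
    step k (i , e) = trans (coeff-⊛ˡ a f g k) (trans
      (+-congʳ (trans (*-congˡ (≡.subst (λ j → coeff g j ≈ 0#) (≡.sym e) (g↓ i))) (zeroʳ a)))
          (+-identityˡ _))
    reorder : ∀ i → suc (m ℕ.+ n ℕ.+ i) ≡ n ℕ.+ (suc m ℕ.+ i)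
    reorder i = ≡.trans (≡.cong (ℕ._+ i) (≡.trans (≡.cong suc (ℕₚ.+-comm m n))
        (≡.sym (ℕₚ.+-suc n m)))) (ℕₚ.+-assoc n (suc m) i)

  degree-⊛ : ∀ {f g m n} → Degree f m → Degree g n → Degree (f ⊛ g) (m ℕ.+ n)
  degree-⊛ {f} {g} {m} {n} d e = degree
    (λ z → *-≉0 (leading≉0 d) (leading≉0 e) (trans (sym (proj₁ product)) z)) (proj₂ product)
    where
    product = coeff-⊛-degree f g {m} {n} (above d) (above e)

  shift : ℕ → Poly → Poly
  shift zero    f = f
  shift (suc k) f = 0# ∷ shift k f

  shift-⊛ : ∀ k f → shift k f ≋ shift k (const 1#) ⊛ f
  shift-⊛ zero    f = ≋-sym (⊛-identityˡ f)
  shift-⊛ (suc k) f = ≋-trans (∷-cong refl (shift-⊛ k f))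
    (≋-sym (≋-trans (⊕-cong {q = 0# ∷ (shift k (const 1#) ⊛ f)} (scale-0 f) ≋-refl) ≋-refl))

  coeff-shift : ∀ k f n → coeff (shift k f) (k ℕ.+ n) ≡ coeff f n
  coeff-shift zero    f n = ≡.refl
  coeff-shift (suc k) f n = coeff-shift k f n

  open Smoothness P
  open Bezout P

  const-prime : ∀ {p} → Prime p → RawSemiringDefinitions.Prime (RawRing.rawSemiring P.rawRing)
      (const p)
  const-prime p-prime = record
    { p≉0 = const-≉0 p≉0
    ; p∤1 = λ p∣1 → p∤1 (const-∣⇒∣ _ p∣1 0)
    ; split-∣ = λ {f} {g} → gauss p-prime f g }
    where open Prime p-prime

  const-unit : ∀ {x} → x ∣ 1# → const x ∣ₚ const 1#
  const-unit {x} (q , qx≈1) = const q , ≋-trans (const-* q x) (const-cong qx≈1)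

  const-smooth : ∀ {x} → ¬ x ≈ 0# → Smooth (const x)
  const-smooth {x} x≉0 = <-rec (λ n → ∀ {x} → ∥ x ∥ ≡ n → ¬ x ≈ 0# → Smooth (const x)) go _ ≡.refl
      x≉0
    where
    go : ∀ n → (∀ {m} → m ℕ.< n → ∀ {x} → ∥ x ∥ ≡ m → ¬ x ≈ 0# → Smooth (const x)) →
         ∀ {x} → ∥ x ∥ ≡ n → ¬ x ≈ 0# → Smooth (const x)
    go n rec {x} ≡.refl x≉0 = [ unit ∘ const-unit , (λ (p , m , p-prime , x≈pm , m<x) →
      prime (const-prime p-prime) (rec m<x ≡.refl (D.≉0ʳ (D.≉0-cong x≈pm x≉0)))
        (≋-trans (const-cong x≈pm) (≋-sym (const-* p m)))) ]′ (primeFactor x≉0)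

  record PseudoDivision (a b : Poly) (m : ℕ) : Set (c ⊔ ℓ) where
    field
      l         : Carrier
      q r       : Poly
      l≉0       : ¬ l ≈ 0#
      equation  : const l ⊛ a ≋ q ⊛ b ⊕ r
      remainder : Below m r

  -- Division without inverting the leading coefficient β of b: if γ is the coefficient of tⁿ in a,
  -- then β a - γ tᵏ b with k = n - m has lower degree, and β is collected in the multiplier l.
  pseudo-divide : ∀ n a {b m} → Degree b m → Below n a → PseudoDivision a b m
  pseudo-divide zero a {b} {m} b-degree a↓ = record
    { l = 1# ; q = [] ; r = a ; l≉0 = 1≉0 ; equation = ⊛-identityˡ a ; remainder = below-≤ a z≤n a↓
        }
  pseudo-divide (suc n) a {b} {m} b-degree a↓ = cases (m ℕₚ.≤? n)
    where
    cases : Dec (m ℕ.≤ n) → PseudoDivision a b m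
    cases (no  m≰n) = record
      { l = 1# ; q = [] ; r = a ; l≉0 = 1≉0 ; equation = ⊛-identityˡ a ; remainder = below-≤ a
          (ℕₚ.≰⇒> m≰n) a↓ }
    cases (yes m≤n) = record
      { l = l * β ; q = q ⊕ const l ⊛ const γ ⊛ w ; r = r ; l≉0 = *-≉0 l≉0 (leading≉0 b-degree)
      ; equation = ≋-trans (⊛-congʳ a (≋-sym (const-* l β))) 
          (division-step {a} {a′} {b} {shift k b} {const l} {q} {r} {const β} {const γ} {w} equation
              ≋-refl (shift-⊛ k b))
      ; remainder = remainder }
      where
      k = n ℕ.∸ m
      w = shift k (const 1#)
      β = coeff b m
      γ = coeff a n
      a′ = const β ⊛ a ⊕ (⊖ (const γ ⊛ shift k b))
      coeff-a′ : ∀ i → coeff a′ i ≈ β * coeff a i - γ * coeff (shift k b) i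
      coeff-a′ i = trans (coeff-⊕ (const β ⊛ a) _ i)
          (+-cong (trans (at (const-⊛ β a) i) (coeff-scale β a i))
        (trans (coeff-⊖ (const γ ⊛ shift k b) i)
            (-‿cong (trans (at (const-⊛ γ (shift k b)) i) (coeff-scale γ (shift k b) i)))))
      coeff-top : ∀ i → coeff (shift k b) (n ℕ.+ i) ≈ coeff b (m ℕ.+ i)
      coeff-top i = reflexive (≡.trans (≡.cong (λ j → coeff (shift k b) j)
        (≡.trans (≡.cong (ℕ._+ i) (≡.sym (ℕₚ.m∸n+n≡m m≤n))) (ℕₚ.+-assoc k m i)))
            (coeff-shift k b (m ℕ.+ i)))
      a′↓ : Below n a′
      a′↓ zero = trans (coeff-a′ (n ℕ.+ 0)) (trans (+-cong
          (*-congˡ (reflexive (≡.cong (coeff a) (ℕₚ.+-identityʳ n))))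
          (-‿cong (*-congˡ (trans (coeff-top 0)
              (reflexive (≡.cong (coeff b) (ℕₚ.+-identityʳ m)))))))
        (trans (+-congʳ (*-comm β γ)) (-‿inverseʳ _)))
      a′↓ (suc i) = trans (coeff-a′ (n ℕ.+ suc i)) (trans (+-cong
          (trans (*-congˡ (trans (reflexive (≡.cong (coeff a) (ℕₚ.+-suc n i))) (a↓ i))) (zeroʳ β))
          (-‿cong (trans (*-congˡ (trans (coeff-top (suc i))
              (trans (reflexive (≡.cong (coeff b) (ℕₚ.+-suc m i))) (above b-degree i))))
                  (zeroʳ γ))))
        (-‿inverseʳ 0#))
      open PseudoDivision (pseudo-divide n a′ b-degree a′↓)

  bezout : ∀ a {b} → ¬ b ≋ [] → PseudoGcd a b
  bezout a b≉0 = <-rec (λ m → ∀ a {b} → Degree b m → PseudoGcd a b) go _ a (proj₂ (degree-of b≉0))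
    where
    go : ∀ m → (∀ {k} → k ℕ.< m → ∀ a {b} → Degree b k → PseudoGcd a b) → ∀ a {b} → Degree b m →
        PseudoGcd a b
    go m rec a {b} b-degree =
      [ (λ r≋0 → pseudoGcd-base {q = q} (degree-≉0 b-degree) (const-smooth l≉0)
                   (≋-trans equation (≋-trans (⊕-cong ≋-refl r≋0) (⊕-identityʳ (q ⊛ b)))))
      , (λ (k , k<m , r-degree) → pseudoGcd-step {q = q} {r = r} (const-smooth l≉0) equation
          (rec k<m b r-degree))
      ]′ (below-degree m r remainder)
      where
      open PseudoDivision (pseudo-divide (length a) a b-degree (below-length a))

  _≟[] : ∀ f → Dec (f ≋ [])
  f ≟[] = [ yes , (λ (_ , d) → no (degree-≉0 d)) ]′ (zero-or-degree f)

  open EuclidsLemma P polynomial-integral _≟[] bezout using (euclid)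

  -- The factor 2ᵐ makes the norm equal to 1 at the units only.

  size : ℕ → Poly → ℕ
  size m f = ∥ coeff f m ∥ ℕ.* 2 ℕ.^ m

  Norm : Poly → ℕ → Set ℓ
  Norm f n = ∃[ m ] Degree f m × n ≡ size m f

  norm : ∀ {f} → ¬ f ≋ [] → ∃[ n ] Norm f n
  norm f≉0 = let (m , d) = degree-of f≉0 in _ , m , d , ≡.refl

  size-⊛ : ∀ {f g m n} → Degree f m → Degree g n → size (m ℕ.+ n) (f ⊛ g) ≡ size m f ℕ.* size n g
  size-⊛ {f} {g} {m} {n} d e = ≡.trans
    (≡.cong₂ ℕ._*_ (≡.trans (∥∥-cong (proj₁ (coeff-⊛-degree f g {m} {n} (above d) (above e))))
        (∥∥-* _ _)) (ℕₚ.^-distribˡ-+-* 2 m n))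
    (ℕₚ.[m*n]*[o*p]≡[m*o]*[n*p] ∥ coeff f m ∥ ∥ coeff g n ∥ (2 ℕ.^ m) (2 ℕ.^ n))

  size-cong : ∀ {f g m n} → f ≋ g → Degree f m → Degree g n → size m f ≡ size n g
  size-cong {m = m} f≋g d e with ≡.refl ← degree-unique (degree-cong f≋g d) e =
    ≡.cong (ℕ._* 2 ℕ.^ m) (∥∥-cong (at f≋g m))

  size≥1 : ∀ {f m} → Degree f m → 1 ℕ.≤ size m f
  size≥1 {m = m} d = ℕₚ.*-mono-≤ (∥∥-≉0 (leading≉0 d)) (ℕₚ.m^n>0 2 m)

  size≡1⇒unit : ∀ {f m} → Degree f m → size m f ≡ 1 → f ∣ₚ const 1#
  size≡1⇒unit {f} {zero} d e = PD.∣ʳ-respˡ-≈ (≋-sym f≋const)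
    (const-unit (∥∥-unit (ℕₚ.m*n≡1⇒m≡1 _ 1 e)))
    where
    f≋const : f ≋ const (coeff f 0)
    f≋const .at zero    = refl
    f≋const .at (suc n) = above d n
  size≡1⇒unit {f} {suc m} d e = contradiction
      (ℕₚ.m*n≡1⇒m≡1 2 (2 ℕ.^ m) (ℕₚ.m*n≡1⇒n≡1 ∥ coeff f (suc m) ∥ (2 ℕ.^ suc m) e)) λ ()

  degree-factors : ∀ {f g n} → ¬ f ⊛ g ≋ [] → Degree (f ⊛ g) n →
    ∃[ i ] ∃[ j ] Degree f i × Degree g j × i ℕ.+ j ≡ n
  degree-factors {f} {g} fg≉0 d =
    let (i , di) = degree-of {f} (PDom.≉0ˡ {f} {g} fg≉0)
        (j , dj) = degree-of {g} (PDom.≉0ʳ {f} {g} fg≉0)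
    in i , j , di , dj , degree-unique (degree-⊛ di dj) d

  -- The bound does not depend on the factor q. It is what makes one denominator serve for the
  -- values of all cofactors.
  factor-below : ∀ {f} → ¬ f ≋ [] → ∃[ n ] (∀ q z → q ⊛ z ≋ f → Below n q)
  factor-below {f} f≉0 = let (m , df) = degree-of f≉0 in suc m , λ q z qz≋f →
    let dqz = degree-cong (≋-sym qz≋f) df
        (i , j , dq , _ , i+j≡m) = degree-factors {q} {z} (degree-≉0 dqz) dqz
    in below-≤ q (s≤s (≡.subst (i ℕ.≤_) i+j≡m (ℕₚ.m≤m+n i j))) (above dq)

  unit⇒size≡1 : ∀ {f m} → Degree f m → f ∣ₚ const 1# → size m f ≡ 1
  unit⇒size≡1 {f} {m} d (q , qf≋1) = ℕₚ.m*n≡1⇒n≡1 (size j q) (size m f)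
      (≡.trans (≡.sym (size-⊛ dq d))
    (≡.trans (size-cong {n = 0} qf≋1 (degree-⊛ dq d) (degree 1≉0 λ _ → refl))
        (≡.trans (ℕₚ.*-identityʳ _) ∥1∥≡1)))
    where
    q≉0 : ¬ q ≋ []
    q≉0 q≋0 = 1≉0 (sym (at (≋-trans (≋-sym (⊛-congʳ f q≋0)) qf≋1) 0))
    j = proj₁ (degree-of q≉0)
    dq = proj₂ (degree-of q≉0)

  -- Being a unit is decidable for a nonzero polynomial: it means size 1.
  unit-stable : ∀ {f} → ¬ ¬ (f ∣ₚ const 1#) → f ∣ₚ const 1#
  unit-stable {f} ¬¬f∣1 = [ (λ f≋0 → ⊥-elim (¬¬f∣1 λ (q , qf≋1) →
        1≉0 (sym (at (≋-trans (≋-sym (≋-trans (⊛-congˡ q f≋0) (⊛-zeroʳ q))) qf≋1) 0))))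
    , (λ (m , d) → cases d (size m f ℕₚ.≟ 1)) ]′ (zero-or-degree f)
    where
    cases : ∀ {m} → Degree f m → Dec (size m f ≡ 1) → f ∣ₚ const 1#
    cases d (yes e) = size≡1⇒unit d e
    cases d (no ≢1) = ⊥-elim (¬¬f∣1 (≢1 ∘ unit⇒size≡1 d))

  norm-< : ∀ {f g k n} → f ≋ k ⊛ g → ¬ k ∣ₚ const 1# → Norm f n → ∃[ m ] m ℕ.< n × Norm g m
  norm-< {f} {g} {k} f≋kg k∤1 (m , df , ≡.refl) =
    let (i , j , dk , dg , _) = degree-factors (degree-≉0 dkg) dkg in
    size j g , (begin-strict
      size j g                 <⟨ ℕₚ.m<m*n (size j g) (size i k) {{ℕ.>-nonZero (size≥1 dg)}}
          (ℕₚ.≤∧≢⇒< (size≥1 dk) (λ e → k∤1 (size≡1⇒unit dk (≡.sym e)))) ⟩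
      size j g ℕ.* size i k    ≡⟨ ℕₚ.*-comm (size j g) (size i k) ⟩
      size i k ℕ.* size j g    ≡⟨ size-⊛ dk dg ⟨
      size (i ℕ.+ j) (k ⊛ g)   ≡⟨ size-cong (≋-sym f≋kg) (degree-⊛ dk dg) df ⟩
      size m f                 ∎) , j , dg , ≡.refl
    where
    dkg = degree-cong f≋kg df
    open ℕₚ.≤-Reasoning

  polynomial-factorial : FactorialDomain P
  polynomial-factorial = record
    { integral = polynomial-integral ; unit-stable = unit-stable ; euclid = euclid
    ; Norm = Norm ; norm = norm ; norm-< = norm-< }

-- Polynomials with coefficients in a field of fractions

record Fractions (A : CommutativeRing c ℓ) (K : CommutativeRing c′ ℓ′)
  (ι : CommutativeRing.Carrier A → CommutativeRing.Carrier K) : Set (c ⊔ ℓ ⊔ c′ ⊔ ℓ′) where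
  private
    module A = CommutativeRing A
    module K = CommutativeRing K
  field
    ι-hom       : RingMorphisms.IsRingHomomorphism A.rawRing K.rawRing ι
    ι-injective : ∀ {x y} → ι x K.≈ ι y → x A.≈ y
    clear       : ∀ x → ∃[ e ] ∃[ n ] ¬ e A.≈ A.0# × ι e K.* x K.≈ ι n

module CoefficientMap {A : CommutativeRing c ℓ} {K : CommutativeRing c′ ℓ′}
  {ι : CommutativeRing.Carrier A → CommutativeRing.Carrier K}
  (ι-hom : RingMorphisms.IsRingHomomorphism (CommutativeRing.rawRing A) (CommutativeRing.rawRing K)
      ι)
  where

  private
    module A = CommutativeRing A
    module K = CommutativeRing K
  open RingMorphisms.IsRingHomomorphism ι-hom
  private
    module A[t] = Polynomial A
    module K[t] = Polynomial K
    module A[t]-ring = CommutativeRing A[t].polynomialRing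
    module K[t]-ring = CommutativeRing K[t].polynomialRing
    module KS = IntegerCoefficients K

  coeff-map : ∀ f n → K[t].coeff (map ι f) n K.≈ ι (A[t].coeff f n)
  coeff-map []      n       = K.sym 0#-homo
  coeff-map (a ∷ f) zero    = K.refl
  coeff-map (a ∷ f) (suc n) = coeff-map f n

  map-cong : ∀ {f g} → f A[t].≋ g → map ι f K[t].≋ map ι g
  map-cong {f} {g} e = K[t].coeffwise λ n →
    K.trans (coeff-map f n) (K.trans (⟦⟧-cong (A[t].at e n)) (K.sym (coeff-map g n)))

  map-⊕ : ∀ f g → map ι (f A[t].⊕ g) K[t].≋ map ι f K[t].⊕ map ι g
  map-⊕ []      g       = K[t].≋-refl
  map-⊕ (a ∷ f) []      = K[t].≋-refl
  map-⊕ (a ∷ f) (b ∷ g) = K[t].∷-cong (+-homo a b) (map-⊕ f g)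

  map-⊖ : ∀ f → map ι (A[t].⊖ f) K[t].≋ K[t].⊖ map ι f
  map-⊖ []      = K[t].≋-refl
  map-⊖ (a ∷ f) = K[t].∷-cong (-‿homo a) (map-⊖ f)

  map-scale : ∀ a f → map ι (A[t].scale a f) K[t].≋ K[t].scale (ι a) (map ι f)
  map-scale a []      = K[t].≋-refl
  map-scale a (b ∷ f) = K[t].∷-cong (*-homo a b) (map-scale a f)

  map-⊛ : ∀ f g → map ι (f A[t].⊛ g) K[t].≋ map ι f K[t].⊛ map ι g
  map-⊛ []      g = K[t].≋-refl
  map-⊛ (a ∷ f) g = K[t].≋-trans (map-⊕ (A[t].scale a g) (A.0# ∷ (f A[t].⊛ g)))
    (K[t].⊕-cong (map-scale a g) (K[t].∷-cong 0#-homo (map-⊛ f g)))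

  map-isRingHomomorphism : RingMorphisms.IsRingHomomorphism A[t]-ring.rawRing K[t]-ring.rawRing
      (map ι)
  map-isRingHomomorphism = record
    { isSemiringHomomorphism = record
      { isNearSemiringHomomorphism = record
        { +-isMonoidHomomorphism = record
          { isMagmaHomomorphism = record
            { isRelHomomorphism = record { cong = map-cong }
            ; homo = map-⊕
            }
          ; ε-homo = K[t].≋-refl
          }
        ; *-homo = map-⊛
        }
      ; 1#-homo = K[t].∷-cong 1#-homo K[t].≋-refl
      }
    ; -‿homo = map-⊖
    }

  module _ (ι-injective : ∀ {x y} → ι x K.≈ ι y → x A.≈ y) where

    map-injective : ∀ {f g} → map ι f K[t].≋ map ι g → f A[t].≋ g
    map-injective {f} {g} e = A[t].coeffwise λ n →
      ι-injective (K.trans (K.sym (coeff-map f n)) (K.trans (K[t].at e n) (coeff-map g n)))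

    square-clear : ∀ {a c e r} → r K.* r K.≈ ι a → ι e K.* r K.≈ ι c → a A.* (e A.* e) A.≈ c A.* c
    square-clear {a} {c} {e} {r} r²≈ er≈ = ι-injective (K.trans (*-homo _ _)
      (K.trans (K.*-cong (K.sym r²≈) (*-homo e e))
      (K.trans (KS.solve 2 (λ r e → (r KS.:* r) KS.:* (e KS.:* e) KS.:= (e KS.:* r) KS.:*
          (e KS.:* r)) K.refl r (ι e))
      (K.trans (K.*-cong er≈ er≈) (K.sym (*-homo c c))))))

  module _ (clear : ∀ x → ∃[ e ] ∃[ n ] ¬ e A.≈ A.0# × ι e K.* x K.≈ ι n)
    (*-≉0 : ∀ {x y} → ¬ x A.≈ A.0# → ¬ y A.≈ A.0# → ¬ x A.* y A.≈ A.0#)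
    (1≉0 : ¬ A.1# A.≈ A.0#) where

    clear-polynomial : ∀ f → ∃[ e ] ∃[ g ] ¬ e A.≈ A.0# × K[t].scale (ι e) f K[t].≋ map ι g
    clear-polynomial []      = A.1# , [] , 1≉0 , K[t].≋-refl
    clear-polynomial (x ∷ f) =
      let (d , n , d≉0 , dx≈n) = clear x
          (e , g , e≉0 , ef≋g) = clear-polynomial f
      in e A.* d , (e A.* n) ∷ A[t].scale d g , *-≉0 e≉0 d≉0 , K[t].∷-cong
        (K.trans (K.*-congʳ (*-homo e d)) (K.trans (K.*-assoc _ _ _)
            (K.trans (K.*-congˡ dx≈n) (K.sym (*-homo e n)))))
        (K[t].≋-trans (K[t].scale-cong (K.trans (*-homo e d) (K.*-comm (ι e) (ι d))) K[t].≋-refl)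
          (K[t].≋-trans (K[t].scale-scale (ι d) (ι e) f)
              (K[t].≋-trans (K[t].scale-cong K.refl ef≋g) (K[t].≋-sym (map-scale d g)))))

    private
      rescale : ∀ {d e k f g} → d A.* e A.≈ k → K[t].scale (ι e) f K[t].≋ map ι g →
                K[t].scale (ι k) f K[t].≋ map ι (A[t].scale d g)
      rescale {d} {e} {k} {f} {g} de≈k ef≋g = K[t].≋-trans
        (K[t].scale-cong (K.trans (⟦⟧-cong (A.sym de≈k)) (*-homo d e)) K[t].≋-refl)
        (K[t].≋-trans (K[t].scale-scale (ι d) (ι e) f)
        (K[t].≋-trans (K[t].scale-cong K.refl ef≋g) (K[t].≋-sym (map-scale d g))))

    clear-three : ∀ X Y Z → ∃[ e ] ∃[ X′ ] ∃[ Y′ ] ∃[ Z′ ] ¬ e A.≈ A.0# ×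
      K[t].scale (ι e) X K[t].≋ map ι X′ × K[t].scale (ι e) Y K[t].≋ map ι Y′ × K[t].scale (ι e) Z
          K[t].≋ map ι Z′
    clear-three X Y Z =
      let (d , X′ , d≉0 , X≋) = clear-polynomial X
          (e , Y′ , e≉0 , Y≋) = clear-polynomial Y
          (f , Z′ , f≉0 , Z≋) = clear-polynomial Z
      in d A.* (e A.* f) , A[t].scale (e A.* f) X′ , A[t].scale (d A.* f) Y′ , A[t].scale (d A.* e)
          Z′ ,
        *-≉0 d≉0 (*-≉0 e≉0 f≉0) , rescale (A.*-comm _ _) X≋ ,
        rescale (A.trans (A.*-assoc d f e) (A.*-congˡ (A.*-comm f e))) Y≋ , rescale
            (A.*-assoc d e f) Z≋

  module IntegralValues {a b : A.Carrier} {t : K.Carrier} (bt≈a : ι b K.* t K.≈ ι a) where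

    power : ℕ → A.Carrier
    power zero    = A.1#
    power (suc n) = b A.* power n

    -- For t = a / b the power bⁿ clears the value of every polynomial of degree below n, by
    -- Horner's scheme.
    integral-value : ∀ n f → (∀ i → A[t].coeff f (n ℕ.+ i) A.≈ A.0#) →
                     ∃[ z ] ι (power n) K.* K[t].eval t (map ι f) K.≈ ι z
    integral-value zero    f       f↓ = A.0# , K.trans (K.*-congˡ
      (K[t].eval-≋[] t (map ι f) (K[t].coeffwise λ n → K.trans (coeff-map f n)
          (K.trans (⟦⟧-cong (f↓ n)) 0#-homo))))
      (K.trans (K.zeroʳ _) (K.sym 0#-homo))
    integral-value (suc n) []      f↓ = A.0# , K.trans (K.zeroʳ _) (K.sym 0#-homo)
    integral-value (suc n) (x ∷ f) f↓ = let (z , e) = integral-value n f f↓ in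
      b A.* power n A.* x A.+ a A.* z , K.trans
        (K.trans (K.*-congʳ (*-homo _ _)) (KS.solve 5
            (λ b B x t E → b KS.:* B KS.:* (x KS.:+ t KS.:* E) KS.:= b KS.:* B KS.:* x KS.:+
                (b KS.:* t) KS.:* (B KS.:* E)) K.refl _ _ _ _ _))
        (K.trans (K.+-cong (K.trans (K.*-congʳ (K.sym (*-homo _ _))) (K.sym (*-homo _ _)))
            (K.trans (K.*-cong bt≈a e) (K.sym (*-homo _ _)))) (K.sym (+-homo _ _)))

module QuadrupleMap {A : CommutativeRing c ℓ} {K : CommutativeRing c′ ℓ′}
  {ι : CommutativeRing.Carrier A → CommutativeRing.Carrier K}
  (ι-hom : RingMorphisms.IsRingHomomorphism (CommutativeRing.rawRing A) (CommutativeRing.rawRing K)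
      ι)
  where

  private
    module A = CommutativeRing A
    module K = CommutativeRing K
  open RingMorphisms.IsRingHomomorphism ι-hom
  private
    module AQ = Quadruple A
    module KQ = Quadruple K

  quadrupleⁿ-homo : ∀ n x → ι (AQ.quadrupleⁿ n x) K.≈ KQ.quadrupleⁿ n (ι x)
  quadrupleⁿ-homo zero    x = K.refl
  quadrupleⁿ-homo (suc n) x = K.trans (+-homo _ _)
      (K.trans (K.+-cong (+-homo _ _) (+-homo _ _)) (KQ.quadruple-cong (quadrupleⁿ-homo n x)))

-- The discriminant and the distinctness of the roots

module Discriminant (K : CommutativeRing c ℓ) where
  open CommutativeRing K
  open IntegerCoefficients K using (solve; _:=_; _:+_; _:*_; _:-_; :-_; con; Expression)
  open Multiples semiring using (×-congʳ)

  record _≈ᵂ_ (V W : WeierstrassCurve K) : Set ℓ where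
    private
      module V = WeierstrassCurve V
      module W = WeierstrassCurve W
    field
      a₁≈ : V.a₁ ≈ W.a₁
      a₂≈ : V.a₂ ≈ W.a₂
      a₃≈ : V.a₃ ≈ W.a₃
      a₄≈ : V.a₄ ≈ W.a₄
      a₆≈ : V.a₆ ≈ W.a₆

  Δ-cong : ∀ {V W} → V ≈ᵂ W → Weierstrass.Δ V ≈ Weierstrass.Δ W
  Δ-cong {V} {W} e = +-cong (+-cong (+-cong
      (-‿cong (*-cong (*-cong b₂≈ b₂≈) b₈≈))
      (-‿cong (×-congʳ 8 (*-cong (*-cong b₄≈ b₄≈) b₄≈))))
      (-‿cong (×-congʳ 27 (*-cong b₆≈ b₆≈))))
      (×-congʳ 9 (*-cong (*-cong b₂≈ b₄≈) b₆≈))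
    where
    open _≈ᵂ_ e
    module V = Weierstrass V
    module W = Weierstrass W
    b₂≈ : V.b₂ ≈ W.b₂
    b₂≈ = +-cong (*-cong a₁≈ a₁≈) (×-congʳ 4 a₂≈)
    b₄≈ : V.b₄ ≈ W.b₄
    b₄≈ = +-cong (×-congʳ 2 a₄≈) (*-cong a₁≈ a₃≈)
    b₆≈ : V.b₆ ≈ W.b₆
    b₆≈ = +-cong (*-cong a₃≈ a₃≈) (×-congʳ 4 a₆≈)
    b₈≈ : V.b₈ ≈ W.b₈
    b₈≈ = +-cong (+-cong (+-cong (+-cong (*-cong (*-cong a₁≈ a₁≈) a₆≈) (×-congʳ 4 (*-cong a₂≈ a₆≈)))
      (-‿cong (*-cong (*-cong a₁≈ a₃≈) a₄≈))) (*-cong (*-cong a₂≈ a₃≈) a₃≈))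
          (-‿cong (*-cong a₄≈ a₄≈))

  double-root : ∀ e f → Weierstrass.Δ (fromRoots K e e f) ≈ 0#
  double-root e f = solve 2 (λ e f →
    let 0:    = con (0 , 0)
        a₂ = :- (e :+ e :+ f)
        a₄ = e :* e :+ e :* f :+ e :* f
        a₆ = :- (e :* e :* f)
        b₂ = 0: :* 0: :+ times 4 a₂
        b₄ = times 2 a₄ :+ 0: :* 0:
        b₆ = 0: :* 0: :+ times 4 a₆
        b₈ = 0: :* 0: :* a₆ :+ times 4 (a₂ :* a₆) :- 0: :* 0: :* a₄ :+ a₂ :* 0: :* 0: :- a₄ :* a₄
    in (:- (b₂ :* b₂ :* b₈)) :- times 8 (b₄ :* b₄ :* b₄) :- times 27 (b₆ :* b₆) :+ times 9
        (b₂ :* b₄ :* b₆) := 0:)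
    refl e f
    where
    -- Unfolds exactly as the multiples in `Δ` do, so that the expression denotes the discriminant
    -- itself.
    times : ∀ {k} → ℕ → Expression k → Expression k
    times zero    p = con (0 , 0)
    times (suc n) p = p :+ times n p

  -- The coefficients are symmetric in the roots, so any two equal roots may be moved to the first
  -- two places, where `double-root` applies.
  distinct-roots : ∀ {e₁ e₂ e₃} → ¬ Weierstrass.Δ (fromRoots K e₁ e₂ e₃) ≈ 0# →
                   ¬ e₁ ≈ e₂ × ¬ e₁ ≈ e₃ × ¬ e₂ ≈ e₃
  distinct-roots {e₁} {e₂} {e₃} Δ≉0 =
    (λ e₁≈e₂ → Δ≉0 (trans (Δ-cong record
      { a₁≈ = refl ; a₃≈ = refl
      ; a₂≈ = -‿cong (+-congʳ (+-congʳ e₁≈e₂))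
      ; a₄≈ = +-cong (+-cong (*-congʳ e₁≈e₂) (*-congʳ e₁≈e₂)) refl
      ; a₆≈ = -‿cong (*-congʳ (*-congʳ e₁≈e₂)) }) (double-root e₂ e₃))) ,
    (λ e₁≈e₃ → Δ≉0 (trans (Δ-cong record
      { a₁≈ = refl ; a₃≈ = refl
      ; a₂≈ = trans (-‿cong (+-congʳ (+-congʳ e₁≈e₃)))
          (solve 2 (λ e f → :- (e :+ f :+ e) := :- (e :+ e :+ f)) refl e₃ e₂)
      ; a₄≈ = trans (+-cong (+-cong (*-congʳ e₁≈e₃) (*-congʳ e₁≈e₃)) refl)
          (solve 2 (λ e f → e :* f :+ e :* e :+ f :* e := e :* e :+ e :* f :+ e :* f) refl e₃ e₂)
      ; a₆≈ = trans (-‿cong (*-congʳ (*-congʳ e₁≈e₃)))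
          (solve 2 (λ e f → :- (e :* f :* e) := :- (e :* e :* f)) refl e₃ e₂) })
              (double-root e₃ e₂))) ,
    (λ e₂≈e₃ → Δ≉0 (trans (Δ-cong record
      { a₁≈ = refl ; a₃≈ = refl
      ; a₂≈ = trans (-‿cong (+-congʳ (+-congˡ e₂≈e₃)))
          (solve 2 (λ e f → :- (f :+ e :+ e) := :- (e :+ e :+ f)) refl e₃ e₁)
      ; a₄≈ = trans (+-cong (+-cong (*-congˡ e₂≈e₃) refl) (*-congʳ e₂≈e₃))
          (solve 2 (λ e f → f :* e :+ f :* e :+ e :* e := e :* e :+ e :* f :+ e :* f) refl e₃ e₁)
      ; a₆≈ = trans (-‿cong (*-congʳ (*-congˡ e₂≈e₃)))
          (solve 2 (λ e f → :- (f :* e :* e) := :- (e :* e :* f)) refl e₃ e₁) })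
              (double-root e₃ e₁)))

-- Powers of 4 among the values of the divisors of a polynomial

module Unboundedness {A : CommutativeRing c ℓ} {K : CommutativeRing c′ ℓ′}
  (A-factorial : NormedFactorial A) (K-integral : Integral K)
  {ι : CommutativeRing.Carrier A → CommutativeRing.Carrier K}
  (fractions : Fractions A K ι)
  (∥∥-quadruple : ∀ x → NormedFactorial.∥_∥ A-factorial (Quadruple.quadruple A x) ≡ 4 ℕ.*
      NormedFactorial.∥_∥ A-factorial x)
  (t : CommutativeRing.Carrier K)
  where

  private
    module A = CommutativeRing A
    module K = CommutativeRing K
    module A[t] = Polynomial A
    module K[t] = Polynomial K
    module AQ = Quadruple A

  open NormedFactorial A-factorial renaming (integral to A-integral)
  open PolynomialDivisibility A A-factorial using (factor-below)
  open Fractions fractions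
  open RingMorphisms.IsRingHomomorphism ι-hom
  open CoefficientMap {A = A} {K = K} ι-hom
  open QuadrupleMap {A = A} {K = K} ι-hom
  open Quadruple K
  open RawSemiringDefinitions (RawRing.rawSemiring (CommutativeRing.rawRing A[t].polynomialRing))
      using (_∣_)
  private
    module AD = Domain A A-integral
    module KD = Domain K K-integral
    module KS = IntegerCoefficients K

  φ : A[t].Poly → K.Carrier
  φ f = K[t].eval t (map ι f)

  -- A linear lower bound for 4ⁿ, enough to exceed a fixed number.
  quadrupleⁿ-grows : ∀ n {x} → ¬ x A.≈ A.0# → suc n ℕ.≤ ∥ AQ.quadrupleⁿ n x ∥
  quadrupleⁿ-grows zero    x≉0 = ∥∥-≉0 x≉0
  quadrupleⁿ-grows (suc n) {x} x≉0 = begin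
    suc (suc n)                          ≤⟨ s≤s (ℕₚ.m≤n+m (suc n) n) ⟩
    suc n ℕ.+ suc n                      ≤⟨ ℕₚ.+-monoʳ-≤ (suc n) (ℕₚ.m≤m+n (suc n) _) ⟩
    4 ℕ.* suc n                          ≤⟨ ℕₚ.*-monoʳ-≤ 4 (quadrupleⁿ-grows n x≉0) ⟩
    4 ℕ.* ∥ AQ.quadrupleⁿ n x ∥          ≡⟨ ∥∥-quadruple (AQ.quadrupleⁿ n x) ⟨
    ∥ AQ.quadrupleⁿ (suc n) x ∥          ∎
    where open ℕₚ.≤-Reasoning

  ι-≉0 : ∀ {x} → ¬ x A.≈ A.0# → ¬ ι x K.≈ K.0#
  ι-≉0 x≉0 ιx≈0 = x≉0 (ι-injective (K.trans ιx≈0 (K.sym 0#-homo)))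

  ι-≉0⁻¹ : ∀ {x} → ¬ ι x K.≈ K.0# → ¬ x A.≈ A.0#
  ι-≉0⁻¹ ιx≉0 x≈0 = ιx≉0 (K.trans (⟦⟧-cong x≈0) 0#-homo)

  φ-cong : ∀ {f g} → f A[t].≋ g → φ f K.≈ φ g
  φ-cong e = K[t].eval-cong t (map-cong e)

  φ-⊛ : ∀ f g → φ (f A[t].⊛ g) K.≈ φ f K.* φ g
  φ-⊛ f g = K.trans (K[t].eval-cong t (map-⊛ f g)) (K[t].eval-⊛ t (map ι f) (map ι g))

  -- The value at t of the cofactor of z is φ f / (4ⁿ y), but its
  -- denominator is bounded.

  unbounded : ∀ {f y} → ¬ φ f K.≈ K.0# → ¬ y K.≈ K.0# →
    ¬ (∀ n → ¬ ¬ (∃[ z ] z ∣ f × φ z K.≈ quadrupleⁿ n y))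
  -- Here e clears the denominator of y and w is the value of f cleared by bᵐ. If f = q z with φ z =
  -- 4ⁿ y, then e w = ζ 4ⁿ c₀ with ζ and c₀ nonzero integral elements. For n equal to the absolute
  -- value of e w the right side is already too large.
  unbounded {f} {y} φf≉0 y≉0 h = h ∥ e A.* w ∥ contradiction′
    where
    f≉0 : ¬ f A[t].≋ []
    f≉0 f≋0 = φf≉0 (φ-cong f≋0)
    m = proj₁ (factor-below f≉0)
    below = proj₂ (factor-below f≉0)
    t-clear = clear t
    b = proj₁ t-clear
    open IntegralValues {proj₁ (proj₂ t-clear)} {b} {t} (proj₂ (proj₂ (proj₂ t-clear)))
    B = power m
    power-≉0 : ∀ n → ¬ power n A.≈ A.0#
    power-≉0 zero    1≈0 = φf≉0 (K.trans (K.sym (K.*-identityˡ _))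
        (K.trans (K.*-congʳ (K.trans (K.sym 1#-homo) (K.trans (⟦⟧-cong 1≈0) 0#-homo))) (K.zeroˡ _)))
    power-≉0 (suc n) = AD.*-≉0 (proj₁ (proj₂ (proj₂ t-clear))) (power-≉0 n)
    y-clear = clear y
    e = proj₁ y-clear
    c₀ = proj₁ (proj₂ y-clear)
    e≉0 = proj₁ (proj₂ (proj₂ y-clear))
    ey≈c : ι e K.* y K.≈ ι c₀
    ey≈c = proj₂ (proj₂ (proj₂ y-clear))
    c≉0 : ¬ c₀ A.≈ A.0#
    c≉0 = ι-≉0⁻¹ (KD.≉0-cong ey≈c (KD.*-≉0 (ι-≉0 e≉0) y≉0))
    f-value = integral-value m f (below f (A[t].const A.1#)
        (CommutativeRing.*-identityʳ A[t].polynomialRing f))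
    w = proj₁ f-value
    ew≉0 : ¬ e A.* w A.≈ A.0#
    ew≉0 = AD.*-≉0 e≉0 (ι-≉0⁻¹ (KD.≉0-cong (proj₂ f-value) (KD.*-≉0 (ι-≉0 (power-≉0 m)) φf≉0)))
    N = ∥ e A.* w ∥
    contradiction′ : ¬ (∃[ z ] z ∣ f × φ z K.≈ quadrupleⁿ N y)
    contradiction′ (z , (q , qz≋f) , φz≈) = ℕₚ.<-irrefl ≡.refl (begin-strict
      N                                        <⟨ quadrupleⁿ-grows N c≉0 ⟩
      ∥ AQ.quadrupleⁿ N c₀ ∥                   ≤⟨ ℕₚ.m≤n*m _ ∥ ζ ∥ {{ℕ.>-nonZero (∥∥-≉0 ζ≉0)}} ⟩
      ∥ ζ ∥ ℕ.* ∥ AQ.quadrupleⁿ N c₀ ∥         ≡⟨ ∥∥-* ζ _ ⟨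
      ∥ ζ A.* AQ.quadrupleⁿ N c₀ ∥             ≡⟨ ∥∥-cong ew≈ ⟨
      N                                        ∎)
      where
      open ℕₚ.≤-Reasoning
      q-value = integral-value m q (below q z qz≋f)
      ζ = proj₁ q-value
      ew≈ : e A.* w A.≈ ζ A.* AQ.quadrupleⁿ N c₀
      ew≈ = ι-injective (K.trans (*-homo e w) (K.trans (K.*-congˡ (K.trans (K.sym (proj₂ f-value))
        (K.*-congˡ (K.trans (φ-cong (A[t].≋-sym qz≋f)) (K.trans (φ-⊛ q z) (K.*-congˡ φz≈))))))
        (K.trans (KS.solve 4 (λ e B q y → e KS.:* (B KS.:* (q KS.:* y)) KS.:= (B KS.:* q) KS.:*
            (e KS.:* y)) K.refl _ _ _ _)
        (K.trans (K.*-cong (proj₂ q-value) (K.trans (*-quadrupleⁿ N (ι e) y)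
            (K.trans (quadrupleⁿ-cong N ey≈c) (K.sym (quadrupleⁿ-homo N c₀)))))
          (K.sym (*-homo ζ _))))))
      ζ≉0 : ¬ ζ A.≈ A.0#
      ζ≉0 = AD.≉0ˡ (AD.≉0-cong ew≈ ew≉0)

-- Ratios of projective coordinates

module ProjectiveCoordinates (F : CommutativeRing c ℓ) where
  open CommutativeRing F
  open IntegerCoefficients F
  open CubicExpansion F
  open Cubic F
  open SetoidReasoning setoid

  homogeneous⇒cubic : ∀ e₁ e₂ e₃ X Y Z → Weierstrass.Homogeneous (fromRoots F e₁ e₂ e₃) X Y Z →
                      Y * Y * Z ≈ cubic e₁ e₂ e₃ X Z
  homogeneous⇒cubic e₁ e₂ e₃ X Y Z h = begin
    Y * Y * Z                                              ≈⟨ solve 3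
        (λ X Y Z → Y :* Y :* Z := Y :* Y :* Z :+ con (0 , 0) :* X :* Y :* Z :+ con (0 , 0) :* Y :* Z
            :* Z) refl X Y Z ⟩
    Y * Y * Z + 0# * X * Y * Z + 0# * Y * Z * Z            ≈⟨ h ⟩
    X * X * X + - s * X * X * Z + t * X * Z * Z + - p * Z * Z * Z
      ≈⟨ solve 5 (λ s t p X Z → X :* X :* X :+ (:- s) :* X :* X :* Z :+ t :* X :* Z :* Z :+ (:- p)
          :* Z :* Z :* Z := X :* X :* X :- s :* X :* X :* Z :+ t :* X :* Z :* Z :- p :* Z :* Z :* Z)
              refl s t p X Z ⟩
    X * X * X - s * X * X * Z + t * X * Z * Z - p * Z * Z * Z   ≈⟨ cubic-expand e₁ e₂ e₃ X Z ⟨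
    cubic e₁ e₂ e₃ X Z                                     ∎
    where
    s = s₁ e₁ e₂ e₃
    t = s₂ e₁ e₂ e₃
    p = s₃ e₁ e₂ e₃

  rescale-ratio : ∀ {k x X Z X′ Z′} → X ≈ x * Z → X′ ≈ k * X → Z′ ≈ k * Z → X′ ≈ x * Z′
  rescale-ratio {k} {x} {X} {Z} {X′} {Z′} X≈ X′≈ Z′≈ = begin
    X′            ≈⟨ X′≈ ⟩
    k * X         ≈⟨ *-congˡ X≈ ⟩
    k * (x * Z)   ≈⟨ solve 3 (λ k x Z → k :* (x :* Z) := x :* (k :* Z)) refl k x Z ⟩
    x * (k * Z)   ≈⟨ *-congˡ Z′≈ ⟨
    x * Z′        ∎

  ratios-equal : ∀ {x₁ X₁ Z₁ w₁ x₂ X₂ Z₂ w₂} → Z₁ * w₁ ≈ 1# → Z₂ * w₂ ≈ 1# →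
                 X₁ ≈ x₁ * Z₁ → X₂ ≈ x₂ * Z₂ → Z₂ * X₁ ≈ Z₁ * X₂ → x₁ ≈ x₂
  ratios-equal {x₁} {X₁} {Z₁} {w₁} {x₂} {X₂} {Z₂} {w₂} u₁ u₂ X₁≈ X₂≈ e = begin
    x₁                                   ≈⟨ pad x₁ ⟩
    x₁ * ((Z₁ * w₁) * (Z₂ * w₂))         ≈⟨ solve 5
        (λ x z w z′ w′ → x :* ((z :* w) :* (z′ :* w′)) := (z′ :* (x :* z)) :* (w :* w′)) refl x₁ Z₁
            w₁ Z₂ w₂ ⟩
    (Z₂ * (x₁ * Z₁)) * (w₁ * w₂)         ≈⟨ *-congʳ
        (trans (*-congˡ (sym X₁≈)) (trans e (*-congˡ X₂≈))) ⟩
    (Z₁ * (x₂ * Z₂)) * (w₁ * w₂)         ≈⟨ solve 5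
        (λ x z w z′ w′ → (z :* (x :* z′)) :* (w :* w′) := x :* ((z :* w) :* (z′ :* w′))) refl x₂ Z₁
            w₁ Z₂ w₂ ⟩
    x₂ * ((Z₁ * w₁) * (Z₂ * w₂))         ≈⟨ pad x₂ ⟨
    x₂                                   ∎
    where
    pad : ∀ x → x ≈ x * ((Z₁ * w₁) * (Z₂ * w₂))
    pad x = sym (trans (*-congˡ (trans (*-cong u₁ u₂) (*-identityˡ 1#))) (*-identityʳ x))

  cross-scale : ∀ {x z w x′ z′ w′ k k′ X X′ Z Z′} → z * w ≈ 1# → z′ * w′ ≈ 1# → x * w ≈ x′ * w′ →
    X ≈ k * x → Z ≈ k * z → X′ ≈ k′ * x′ → Z′ ≈ k′ * z′ → Z′ * X ≈ Z * X′
  cross-scale {x} {z} {w} {x′} {z′} {w′} {k} {k′} {X} {X′} {Z} {Z′} u u′ e X≈ Z≈ X′≈ Z′≈ = begin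
    Z′ * X                            ≈⟨ *-cong Z′≈ X≈ ⟩
    (k′ * z′) * (k * x)               ≈⟨ *-congˡ (*-congˡ (sym (trans (*-congˡ u) (*-identityʳ x))))
        ⟩
    (k′ * z′) * (k * (x * (z * w)))   ≈⟨ solve 6
        (λ k′ z′ k x z w → (k′ :* z′) :* (k :* (x :* (z :* w))) := (k :* z) :*
            (k′ :* (z′ :* (x :* w)))) refl k′ z′ k x z w ⟩
    (k * z) * (k′ * (z′ * (x * w)))   ≈⟨ *-congˡ
        (*-congˡ (trans (*-congˡ e) (trans (solve 3 (λ z x w → z :* (x :* w) := x :* (z :* w)) refl
            z′ x′ w′) (trans (*-congˡ u′) (*-identityʳ x′))))) ⟩
    (k * z) * (k′ * x′)               ≈⟨ *-cong Z≈ X′≈ ⟨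
    Z * X′                            ∎

-- Integer and rational coefficients

open import Defs

ℤ-ring ℚ-ring : CommutativeRing 0ℓ 0ℓ
ℤ-ring = ℤₚ.+-*-commutativeRing
ℚ-ring = ℚₚ.+-*-commutativeRing

module ℤ-divisibility = RawSemiringDefinitions
    (RawRing.rawSemiring (CommutativeRing.rawRing ℤ-ring))
open ℤ-divisibility using () renaming (_∣_ to _∣ℤ_; Prime to Primeℤ)

signed⇒∣ : ∀ {x y} → x ℤ∣.∣ y → x ∣ℤ y
signed⇒∣ (ℤ∣.divides q y≡qx) = q , ≡.sym y≡qx

∣⇒signed : ∀ {x y} → x ∣ℤ y → x ℤ∣.∣ y
∣⇒signed (q , qx≡y) = ℤ∣.divides q (≡.sym qx≡y)

_∣ℤ?_ : ∀ x y → Dec (x ∣ℤ y)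
x ∣ℤ? y = map′ signed⇒∣ ∣⇒signed (x ℤ∣.∣? y)

ℤ-integral : ∀ x y → x ℤ.* y ≡ 0ℤ → x ≡ 0ℤ ⊎ y ≡ 0ℤ
ℤ-integral x y = ℤₚ.i*j≡0⇒i≡0∨j≡0 x

∣∣-≢0 : ∀ {x} → x ≢ 0ℤ → 1 ℕ.≤ ℤ.∣ x ∣
∣∣-≢0 {x} x≢0 = ℕₚ.n≢0⇒n>0 (x≢0 ∘ ℤₚ.∣i∣≡0⇒i≡0)

∣∣-unit : ∀ {x} → ℤ.∣ x ∣ ≡ 1 → x ∣ℤ 1ℤ
∣∣-unit {x} e = signed⇒∣ (ℤ∣.∣ᵤ⇒∣ (ℕ∣.∣-reflexive e))

+-prime : ∀ {p} → ℕ.Prime p → Primeℤ (+ p)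
+-prime {p} p-prime = record
  { p≉0 = λ e → ℕ.≢-nonZero⁻¹ p {{ℕ.prime⇒nonZero p-prime}} (ℤₚ.+-injective e)
  ; p∤1 = λ p∣1 → ℕ.nonTrivial⇒≢1 {{ℕ.prime⇒nonTrivial p-prime}} (ℕ∣.∣1⇒≡1 (ℤ∣.∣⇒∣ᵤ (∣⇒signed p∣1)))
  ; split-∣ = λ {x} {y} p∣xy → ⊎-map (signed⇒∣ ∘ ℤ∣.∣ᵤ⇒∣) (signed⇒∣ ∘ ℤ∣.∣ᵤ⇒∣)
      (ℕ.euclidsLemma ℤ.∣ x ∣ ℤ.∣ y ∣ p-prime
          (≡.subst (p ℕ∣.∣_) (ℤₚ.abs-* x y) (ℤ∣.∣⇒∣ᵤ (∣⇒signed p∣xy))))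
  }

private
  natural-factor : ∀ n → .{{ℕ.NonZero n}} → n ≡ 1 ⊎ (∃[ p ] ∃[ m ] ℕ.Prime p × n ≡ p ℕ.* m)
  natural-factor n with factorise n
  ... | record { factors = [] ; isFactorisation = e } = inj₁ e
  ... | record { factors = p ∷ ps ; isFactorisation = e ; factorsPrime = p-prime ∷ _ } = inj₂
      (p , _ , p-prime , e)

primeFactor : ∀ {x} → x ≢ 0ℤ → x ∣ℤ 1ℤ ⊎ (∃[ p ] ∃[ m ] Primeℤ p × x ≡ p ℤ.* m × ℤ.∣ m ∣ ℕ.< ℤ.∣ x
    ∣)
primeFactor {x} x≢0 = ⊎-map ∣∣-unit (λ (p , m , p-prime , e) → + p , factor p-prime e)
  (natural-factor ℤ.∣ x ∣ {{ℕ.>-nonZero (∣∣-≢0 x≢0)}})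
  where
  factor : ∀ {p m} → ℕ.Prime p → ℤ.∣ x ∣ ≡ p ℕ.* m → ∃[ m ] Primeℤ (+ p) × x ≡ + p ℤ.* m × ℤ.∣ m ∣
      ℕ.< ℤ.∣ x ∣
  factor {p} {m} p-prime e = q , +-prime p-prime , x≡pq , (begin-strict
      ℤ.∣ q ∣               <⟨ ℕₚ.m<m*n ℤ.∣ q ∣ p {{ℕ.>-nonZero (∣∣-≢0 q≢0)}}
          (ℕ.nonTrivial⇒n>1 p {{ℕ.prime⇒nonTrivial p-prime}}) ⟩
      ℤ.∣ q ∣ ℕ.* p         ≡⟨ ℤₚ.abs-* q (+ p) ⟨
      ℤ.∣ q ℤ.* + p ∣       ≡⟨ ≡.cong ℤ.∣_∣ (ℤ∣._∣_.equality p∣x) ⟨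
      ℤ.∣ x ∣               ∎)
    where
    open ℕₚ.≤-Reasoning
    p∣x : (+ p) ℤ∣.∣ x
    p∣x = ℤ∣.∣ᵤ⇒∣ (ℕ∣.divides m (≡.trans e (ℕₚ.*-comm p m)))
    q = ℤ∣._∣_.quotient p∣x
    x≡pq : x ≡ + p ℤ.* q
    x≡pq = ≡.trans (ℤ∣._∣_.equality p∣x) (ℤₚ.*-comm q (+ p))
    q≢0 : q ≢ 0ℤ
    q≢0 q≡0 = x≢0 (≡.trans x≡pq (≡.trans (≡.cong (+ p ℤ.*_) q≡0) (ℤₚ.*-zeroʳ (+ p))))

∣∣-double : ∀ x → ℤ.∣ x ℤ.+ x ∣ ≡ 2 ℕ.* ℤ.∣ x ∣
∣∣-double x = ≡.trans (≡.cong ℤ.∣_∣ (≡.trans (≡.sym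
    (≡.cong₂ ℤ._+_ (ℤₚ.*-identityˡ x) (ℤₚ.*-identityˡ x))) (≡.sym (ℤₚ.*-distribʳ-+ x 1ℤ 1ℤ))))
        (ℤₚ.abs-* (+ 2) x)

∣∣-quadruple : ∀ x → ℤ.∣ (x ℤ.+ x) ℤ.+ (x ℤ.+ x) ∣ ≡ 4 ℕ.* ℤ.∣ x ∣
∣∣-quadruple x = ≡.trans (∣∣-double (x ℤ.+ x))
    (≡.trans (≡.cong (2 ℕ.*_) (∣∣-double x)) (≡.sym (ℕₚ.*-assoc 2 2 ℤ.∣ x ∣)))

ι : ℤ → ℚ
ι z = z ℚ./ 1

private
  toℚᵘ-ι : ∀ z → ℚ.toℚᵘ (ι z) ≃ mkℚᵘ z 0
  toℚᵘ-ι z = ℚₚ.toℚᵘ-fromℚᵘ (mkℚᵘ z 0)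

ι-injective : ∀ {x y} → ι x ≡ ι y → x ≡ y
ι-injective {x} {y} e with ℚᵘₚ.≃-trans (ℚᵘₚ.≃-sym (toℚᵘ-ι x))
    (ℚᵘₚ.≃-trans (ℚᵘₚ.≃-reflexive (≡.cong ℚ.toℚᵘ e)) (toℚᵘ-ι y))
... | *≡* x1≡y1 = ≡.trans (≡.sym (ℤₚ.*-identityʳ x)) (≡.trans x1≡y1 (ℤₚ.*-identityʳ y))

ι-+ : ∀ x y → ι (x ℤ.+ y) ≡ ι x ℚ.+ ι y
ι-+ x y = ℚₚ.toℚᵘ-injective (ℚᵘₚ.≃-trans (toℚᵘ-ι (x ℤ.+ y))
  (ℚᵘₚ.≃-trans (*≡* (≡.cong (ℤ._* 1ℤ) (≡.sym (≡.cong₂ ℤ._+_ (ℤₚ.*-identityʳ x)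
      (ℤₚ.*-identityʳ y)))))
  (ℚᵘₚ.≃-trans (ℚᵘₚ.+-cong (ℚᵘₚ.≃-sym (toℚᵘ-ι x)) (ℚᵘₚ.≃-sym (toℚᵘ-ι y)))
      (ℚᵘₚ.≃-sym (ℚₚ.toℚᵘ-homo-+ (ι x) (ι y))))))

ι-* : ∀ x y → ι (x ℤ.* y) ≡ ι x ℚ.* ι y
ι-* x y = ℚₚ.toℚᵘ-injective (ℚᵘₚ.≃-trans (toℚᵘ-ι (x ℤ.* y))
  (ℚᵘₚ.≃-trans (*≡* ≡.refl)
  (ℚᵘₚ.≃-trans (ℚᵘₚ.*-cong (ℚᵘₚ.≃-sym (toℚᵘ-ι x)) (ℚᵘₚ.≃-sym (toℚᵘ-ι y)))
      (ℚᵘₚ.≃-sym (ℚₚ.toℚᵘ-homo-* (ι x) (ι y))))))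

ι-neg : ∀ x → ι (ℤ.- x) ≡ ℚ.- ι x
ι-neg x = ℚₚ.toℚᵘ-injective (ℚᵘₚ.≃-trans (toℚᵘ-ι (ℤ.- x))
  (ℚᵘₚ.≃-trans (ℚᵘₚ.-‿cong (ℚᵘₚ.≃-sym (toℚᵘ-ι x))) (ℚᵘₚ.≃-sym (ℚₚ.toℚᵘ-homo‿- (ι x)))))

ι-isRingHomomorphism : RingMorphisms.IsRingHomomorphism (CommutativeRing.rawRing ℤ-ring)
    (CommutativeRing.rawRing ℚ-ring) ι
ι-isRingHomomorphism = record
  { isSemiringHomomorphism = record
    { isNearSemiringHomomorphism = record
      { +-isMonoidHomomorphism = record
        { isMagmaHomomorphism = record
          { isRelHomomorphism = record { cong = ≡.cong ι } ; homo = ι-+ }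
        ; ε-homo = ≡.refl
        }
      ; *-homo = ι-*
      }
    ; 1#-homo = ≡.refl
    }
  ; -‿homo = ι-neg
  }

clear : ∀ x → ∃[ e ] ∃[ n ] e ≢ 0ℤ × ι e ℚ.* x ≡ ι n
clear x@record{} = ↧ x , ↥ x , (λ ()) , ℚₚ.toℚᵘ-injective (ℚᵘₚ.≃-trans (ℚₚ.toℚᵘ-homo-* (ι (↧ x)) x)
  (ℚᵘₚ.≃-trans (ℚᵘₚ.*-cong (toℚᵘ-ι (↧ x)) (ℚᵘₚ.≃-refl {ℚ.toℚᵘ x}))
  (ℚᵘₚ.≃-trans (*≡* (≡.trans (ℤₚ.*-identityʳ _)
      (≡.trans (ℤₚ.*-comm (↧ x) (↥ x)) (≡.cong (↥ x ℤ.*_)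
          (≡.cong +_ (≡.sym (ℕₚ.+-identityʳ (↧ₙ x))))))))
   (ℚᵘₚ.≃-sym (toℚᵘ-ι (↥ x))))))

ℤ-factorial : NormedFactorial ℤ-ring
ℤ-factorial = record
  { _≟0 = ℤₚ._≟ 0ℤ ; _∣?_ = _∣ℤ?_ ; integral = ℤ-integral ; 1≉0 = λ ()
  ; ∥_∥ = ℤ.∣_∣ ; ∥∥-cong = ≡.cong ℤ.∣_∣ ; ∥∥-* = ℤₚ.abs-* ; ∥1∥≡1 = ≡.refl
  ; ∥∥-≉0 = ∣∣-≢0 ; ∥∥-unit = ∣∣-unit ; primeFactor = primeFactor }

ℚ-fractions : Fractions ℤ-ring ℚ-ring ι
ℚ-fractions = record { ι-hom = ι-isRingHomomorphism ; ι-injective = ι-injective ; clear = clear }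

ℚ-field : Field ℚ-ring
ℚ-field = record { integral = ℚ-integral ; inverse = ℚ-inverse ; 2≉0 = λ () }

module ℤ[t]-divisibility = PolynomialDivisibility ℤ-ring ℤ-factorial

ℤ[t]-factorial : FactorialDomain ℤ[t]-ring
ℤ[t]-factorial = ℤ[t]-divisibility.polynomial-factorial

module ℤ→ℚ = CoefficientMap {A = ℤ-ring} {K = ℚ-ring} ι-isRingHomomorphism

-- Specialization of integer polynomials at t₀

module Evaluation (t₀ : ℚ) where

  φ : ℤ[t] → ℚ
  φ f = f ⟨ t₀ ⟩

  φ-isRingHomomorphism : RingMorphisms.IsRingHomomorphism (CommutativeRing.rawRing ℤ[t]-ring)
      (CommutativeRing.rawRing ℚ-ring) φ
  φ-isRingHomomorphism = Composition.isRingHomomorphism ≡.trans ℤ→ℚ.map-isRingHomomorphism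
      (ℚ[t].eval-isRingHomomorphism t₀)

  module ℤ[t]-factorization = Factorization ℤ[t]-ring ℤ[t]-factorial
  module Values             = Unboundedness ℤ-factorial ℚ-integral ℚ-fractions ∣∣-quadruple t₀
  module ℤ[t]-descent       = Descent ℤ[t]-ring ℤ[t]-factorial ℚ-ring ℚ-field φ φ-isRingHomomorphism
  module ℤ[t]-separation    = Separation ℤ[t]-ring ℤ[t]-divisibility.polynomial-integral ℚ-ring
      ℚ-field φ φ-isRingHomomorphism

  -- The value of a constant is the constant itself, so a = (c / e)² in ℚ, and integral closedness
  -- yields a root in ℤ[t].
  constant-square : ∀ {h a} → h ℤ[t].≋ ℤ[t].const a → IsSquare (φ h) → ¬ ¬
      (∃[ w ] w ℤ[t].⊛ w ℤ[t].≋ h)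
  constant-square {h} {a} h≋a (r , r²≡φh) =
    let (e , c , e≢0 , er≡c) = clear r
        aee≡cc : a ℤ.* (e ℤ.* e) ≡ c ℤ.* c
        aee≡cc = ℤ→ℚ.square-clear ι-injective {a} {c} {e} {r} (≡.trans r²≡φh φh≡a) er≡c
    in ℤ[t]-factorization.integral-square {h} {ℤ[t].const c} {ℤ[t].const e}
        (ℤ[t]-divisibility.const-≉0 e≢0)
      (ℤ[t].≋-trans (ℤ[t].⊛-cong h≋a (const-* e e)) (ℤ[t].≋-trans (const-* a (e ℤ.* e))
        (ℤ[t].≋-trans (ℤ[t]-divisibility.const-cong aee≡cc) (ℤ[t].≋-sym (const-* c c)))))
    where
    const-* = ℤ[t]-divisibility.const-*
    φh≡a : φ h ≡ ι a
    φh≡a = ≡.trans (ℚ[t].eval-cong t₀ (ℤ→ℚ.map-cong h≋a)) (ℚ[t].eval-const t₀ (ι a))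

  open CommutativeRing ℤ[t]-ring

  squares-reflected : ∀ N →
    (∀ h → ℤ[t].NonConstant h → SquareFree h → h ∣ N → ¬ IsSquare (h ⟨ t₀ ⟩)) →
    ℤ[t]-descent.SquaresReflected N
  squares-reflected N non-square h h-sf h∣N φh-square = do
    -- `NonConstant` is a negation, so refuting it is precisely the doubly negated existence of the
    -- constant.
    (a , h≋a) ← λ nonconstant → non-square h nonconstant h-sf h∣N φh-square
    constant-square h≋a φh-square

  -- The coordinates C multiplied by a common denominator.

  record Model (e₁ e₂ e₃ : ℤ[t]) {x y : ℚ⟨t⟩} (C : Coordinates t₀ x y) : Set where
    open Coordinates C using () renaming (X to X₀; Y to Y₀; Z to Z₀)
    field
      X Y Z    : ℤ[t]
      scalar   : ℚ
      scalar≢0 : scalar ≢ 0ℚ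
      X-eq     : ℚ[t]→ℚ⟨t⟩ (ℤ[t]→ℚ[t] X) ℚ⟨t⟩.≃ x ℚ⟨t⟩.⊠ ℚ[t]→ℚ⟨t⟩ (ℤ[t]→ℚ[t] Z)
      Y-eq     : ℚ[t]→ℚ⟨t⟩ (ℤ[t]→ℚ[t] Y) ℚ⟨t⟩.≃ y ℚ⟨t⟩.⊠ ℚ[t]→ℚ⟨t⟩ (ℤ[t]→ℚ[t] Z)
      φX≡      : φ X ≡ scalar ℚ.* ℚ[t].eval t₀ X₀
      φY≡      : φ Y ≡ scalar ℚ.* ℚ[t].eval t₀ Y₀
      φZ≡      : φ Z ≡ scalar ℚ.* ℚ[t].eval t₀ Z₀
      Z≉0      : ¬ Z ≈ 0#
      equation : Y * Y * Z ≈ Cubic.cubic ℤ[t]-ring e₁ e₂ e₃ X Z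

  model : ∀ e₁ e₂ e₃ {x y} → Equation (overℚ⟨t⟩ (curve e₁ e₂ e₃)) x y → (C : Coordinates t₀ x y) →
      Model e₁ e₂ e₃ C
  model e₁ e₂ e₃ {x} {y} eq C =
    let (e , X , Y , Z , e≢0 , X≋ , Y≋ , Z≋) = ℤ→ℚ.clear-three clear (Domain.*-≉0 ℤ-ring ℤ-integral)
          (λ ()) C.X C.Y C.Z
    in from-integral {e} {X} {Y} {Z} e≢0 X≋ Y≋ Z≋
    where
    module C = Coordinates C
    W = curve e₁ e₂ e₃
    E : ℤ[t] → ℚ⟨t⟩
    E f = ℚ⟨t⟩.embed (ℤ[t]→ℚ[t] f)
    scale-embed : ∀ {e f g} → ℚ[t].scale (ι e) f ℚ[t].≋ ℤ[t]→ℚ[t] g →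
                  ℚ⟨t⟩.embed (ℤ[t]→ℚ[t] g) ℚ⟨t⟩.≃ ℚ⟨t⟩.embed (ℚ[t].const (ι e)) ℚ⟨t⟩.⊠ ℚ⟨t⟩.embed f
    scale-embed {e} {f} {g} ef≋g = ℚ⟨t⟩.≃-trans {E g} {ℚ⟨t⟩.embed (ℚ[t].const (ι e) ℚ[t].⊛ f)}
        (ℚ⟨t⟩.embed-cong (ℚ[t].≋-trans (ℚ[t].≋-sym ef≋g) (ℚ[t].≋-sym const-⊛)))
      (RingMorphisms.IsRingHomomorphism.*-homo ℚ⟨t⟩.embed-isRingHomomorphism (ℚ[t].const (ι e)) f)
      where
      const-⊛ : ℚ[t].const (ι e) ℚ[t].⊛ f ℚ[t].≋ ℚ[t].scale (ι e) f
      const-⊛ = ℚ[t].≋-trans (ℚ[t].⊕-cong ℚ[t].≋-refl (ℚ[t].∷-≋[] ≡.refl ℚ[t].≋-refl))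
          (ℚ[t].⊕-identityʳ (ℚ[t].scale (ι e) f))
    rescaled : ∀ {e V₀ Z₀ V Z} v → ℚ⟨t⟩.embed V₀ ℚ⟨t⟩.≃ v ℚ⟨t⟩.⊠ ℚ⟨t⟩.embed Z₀ →
      ℚ[t].scale (ι e) V₀ ℚ[t].≋ ℤ[t]→ℚ[t] V → ℚ[t].scale (ι e) Z₀ ℚ[t].≋ ℤ[t]→ℚ[t] Z →
      ℚ⟨t⟩.embed (ℤ[t]→ℚ[t] V) ℚ⟨t⟩.≃ v ℚ⟨t⟩.⊠ ℚ⟨t⟩.embed (ℤ[t]→ℚ[t] Z)
    rescaled {e} {V₀} {Z₀} {V} {Z} v V-eq V≋ Z≋ = ProjectiveCoordinates.rescale-ratio ℚ⟨t⟩-ring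
      {ℚ⟨t⟩.embed (ℚ[t].const (ι e))} {v} {ℚ⟨t⟩.embed V₀} {ℚ⟨t⟩.embed Z₀} {E V} {E Z} V-eq
      (scale-embed {e} {V₀} {V} V≋) (scale-embed {e} {Z₀} {Z} Z≋)
    evaluated : ∀ {e f g} → ℚ[t].scale (ι e) f ℚ[t].≋ ℤ[t]→ℚ[t] g → φ g ≡ ι e ℚ.* ℚ[t].eval t₀ f
    evaluated {e} {f} ef≋g = ≡.trans (ℚ[t].eval-cong t₀ (ℚ[t].≋-sym ef≋g))
        (ℚ[t].eval-scale t₀ (ι e) f)
    unscale : ∀ {k f} → k ≢ 0ℚ → ℚ[t].scale k f ℚ[t].≋ [] → f ℚ[t].≋ []
    unscale {k} {f} k≢0 kf≋0 = ℚ[t].coeffwise λ n → [ ⊥-elim ∘ k≢0 , id ]′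
      (ℚ-integral k _ (≡.trans (≡.sym (ℚ[t].coeff-scale k f n)) (ℚ[t].at kf≋0 n)))
    from-integral : ∀ {e X Y Z} → e ≢ 0ℤ → ℚ[t].scale (ι e) C.X ℚ[t].≋ ℤ[t]→ℚ[t] X →
      ℚ[t].scale (ι e) C.Y ℚ[t].≋ ℤ[t]→ℚ[t] Y → ℚ[t].scale (ι e) C.Z ℚ[t].≋ ℤ[t]→ℚ[t] Z → Model e₁
          e₂ e₃ C
    from-integral {e} {X} {Y} {Z} e≢0 X≋ Y≋ Z≋ = record
      { X = X ; Y = Y ; Z = Z ; scalar = ι e
      ; scalar≢0 = e≢0 ∘ ι-injective
      ; X-eq = X-eq
      ; Y-eq = Y-eq
      ; φX≡ = evaluated {e} {C.X} {X} X≋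
      ; φY≡ = evaluated {e} {C.Y} {Y} Y≋
      ; φZ≡ = evaluated {e} {C.Z} {Z} Z≋
      ; Z≉0 = λ Z≋0 → C.Z≉0 (unscale (e≢0 ∘ ι-injective) (ℚ[t].≋-trans Z≋ (ℤ→ℚ.map-cong Z≋0)))
      ; equation = ProjectiveCoordinates.homogeneous⇒cubic ℤ[t]-ring e₁ e₂ e₃ X Y Z
          (homogeneous-unmap {K = ℤ[t]-ring} {L = ℚ[t]-ring} ℤ→ℚ.map-isRingHomomorphism
              (fromRoots ℤ[t]-ring e₁ e₂ e₃)
            (ℤ→ℚ.map-injective ι-injective) X Y Z
            (homogeneous-unmap {K = ℚ[t]-ring} {L = ℚ⟨t⟩-ring} ℚ⟨t⟩.embed-isRingHomomorphism W
                ℚ⟨t⟩.embed-injective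
              (ℤ[t]→ℚ[t] X) (ℤ[t]→ℚ[t] Y) (ℤ[t]→ℚ[t] Z)
              (Homogenization.homogenize (overℚ⟨t⟩ W) x y (E X) (E Y) (E Z) eq X-eq Y-eq)))
      }
      where
      X-eq : E X ℚ⟨t⟩.≃ x ℚ⟨t⟩.⊠ E Z
      X-eq = rescaled {e} {C.X} {C.Z} {X} {Z} x C.X-eq X≋ Z≋
      Y-eq : E Y ℚ⟨t⟩.≃ y ℚ⟨t⟩.⊠ E Z
      Y-eq = rescaled {e} {C.Y} {C.Z} {Y} {Z} y C.Y-eq Y≋ Z≋

  module Roots (e₁ e₂ e₃ : ℤ[t])
    (elliptic : IsElliptic (specialize t₀ (curve e₁ e₂ e₃))) where

    open RingMorphisms.IsRingHomomorphism φ-isRingHomomorphism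
    open Discriminant ℚ-ring

    φ-fromRoots : specialize t₀ (curve e₁ e₂ e₃) ≈ᵂ fromRoots ℚ-ring (φ e₁) (φ e₂) (φ e₃)
    φ-fromRoots = record
      { a₁≈ = ≡.refl
      ; a₂≈ = ≡.trans (-‿homo (e₁ + e₂ + e₃))
          (≡.cong ℚ.-_ (≡.trans (+-homo (e₁ + e₂) e₃) (≡.cong (ℚ._+ φ e₃) (+-homo e₁ e₂))))
      ; a₃≈ = ≡.refl
      ; a₄≈ = ≡.trans (+-homo (e₁ * e₂ + e₁ * e₃) (e₂ * e₃)) (≡.cong₂ ℚ._+_
                (≡.trans (+-homo (e₁ * e₂) (e₁ * e₃)) (≡.cong₂ ℚ._+_ (*-homo e₁ e₂) (*-homo e₁ e₃)))
                    (*-homo e₂ e₃))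
      ; a₆≈ = ≡.trans (-‿homo (e₁ * e₂ * e₃))
          (≡.cong ℚ.-_ (≡.trans (*-homo (e₁ * e₂) e₃) (≡.cong (ℚ._* φ e₃) (*-homo e₁ e₂))))
      }

    distinct : φ e₁ ≢ φ e₂ × φ e₁ ≢ φ e₃ × φ e₂ ≢ φ e₃
    distinct = distinct-roots (λ Δ≡0 → elliptic (≡.trans (Δ-cong φ-fromRoots) Δ≡0))

    φ-difference : ∀ e f → φ e ≢ φ f → φ (e - f) ≢ 0ℚ
    φ-difference e f φe≢φf φe-f≡0 = φe≢φf (GroupProperties.x∙y⁻¹≈ε⇒x≈y
        (CommutativeRing.+-group ℚ-ring) (φ e) (φ f)
      (≡.trans (≡.sym (≡.trans (+-homo e (- f)) (≡.cong (φ e ℚ.+_) (-‿homo f)))) φe-f≡0))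

    e₁₂ = φ-difference e₁ e₂ (proj₁ distinct)
    e₁₃ = φ-difference e₁ e₃ (proj₁ (proj₂ distinct))
    e₂₃ = φ-difference e₂ e₃ (proj₂ (proj₂ distinct))

module _ (V : WeierstrassCurve ℚ-ring) where

  open Weierstrass V using (_≈ₚ_; Homogeneous)

  fromProjective-O : ∀ X Y Z (h : Homogeneous X Y Z) → O ≈ₚ fromProjective V X Y Z h ⊎
      fromProjective V X Y Z h ≈ₚ O → Z ≡ 0ℚ
  fromProjective-O X Y Z h e with Z ℚₚ.≟ 0ℚ
  ... | yes Z≡0 = Z≡0
  ... | no  Z≢0 = [ (λ ()) , (λ ()) ]′ e

  -- w = 1 / Z and w′ = 1 / Z′.

  SameAffine : (X Y Z X′ Y′ Z′ : ℚ) → Set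
  SameAffine X Y Z X′ Y′ Z′ =
    ∃[ w ] ∃[ w′ ] Z ℚ.* w ≡ 1ℚ × Z′ ℚ.* w′ ≡ 1ℚ × X ℚ.* w ≡ X′ ℚ.* w′ × Y ℚ.* w ≡ Y′ ℚ.* w′

  fromProjective-≈ : ∀ X Y Z X′ Y′ Z′ (h : Homogeneous X Y Z) (h′ : Homogeneous X′ Y′ Z′) →
    fromProjective V X Y Z h ≈ₚ fromProjective V X′ Y′ Z′ h′ → Z ≡ 0ℚ ⊎ SameAffine X Y Z X′ Y′ Z′
  fromProjective-≈ X Y Z X′ Y′ Z′ h h′ e with Z ℚₚ.≟ 0ℚ | Z′ ℚₚ.≟ 0ℚ
  fromProjective-≈ X Y Z X′ Y′ Z′ h h′ e                        | yes Z≡0 | _       = inj₁ Z≡0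
  fromProjective-≈ X Y Z X′ Y′ Z′ h h′ ()                       | no Z≢0  | yes _
  fromProjective-≈ X Y Z X′ Y′ Z′ h h′ (Weierstrass.affine p q) | no Z≢0  | no Z′≢0 =
    inj₂ (_ , _ , proj₂ (ℚ-inverse Z≢0) , proj₂ (ℚ-inverse Z′≢0) , p , q)

-- Injectivity of the specialization map

module Injectivity (e₁ e₂ e₃ : ℤ[t]) (t₀ : ℚ)
  (elliptic : IsElliptic (specialize t₀ (curve e₁ e₂ e₃)))
  (no-pole : ∀ {a d y} → ¬ d ℤ[t].≋ [] → y ℤ[t].⊛ y ℤ[t].≋ d ℤ[t].⊛ Cubic.cubic ℤ[t]-ring e₁ e₂ e₃ a
      d →
    a ⟨ t₀ ⟩ ≢ 0ℚ → d ⟨ t₀ ⟩ ≢ 0ℚ)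
  where

  open CommutativeRing ℤ[t]-ring
  open Evaluation t₀
  open Roots e₁ e₂ e₃ elliptic

  private
    E  = curve e₁ e₂ e₃
    E₀ = specialize t₀ E

  module _ {x y : ℚ⟨t⟩} (eq : Equation (overℚ⟨t⟩ E) x y) (C : Coordinates t₀ x y) where

    open Coordinates C using (regular) renaming (X to X₀; Y to Y₀; Z to Z₀)
    open Model (model e₁ e₂ e₃ eq C)

    -- The model differs from the given coordinates by one nonzero scalar, so the vanishing of Z at
    -- t₀ and the regularity of the triple pass between the two.
    no-kernel : ℚ[t].eval t₀ Z₀ ≢ 0ℚ
    no-kernel Z₀≡0 = ℤ[t]-separation.no-kernel {e₁} {e₂} {e₃} e₁₂ e₁₃ e₂₃
        (λ {a} {d} {y} → no-pole {a} {d} {y}) {X} {Y} {Z} Z≉0 equation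
            (≡.trans φZ≡ (≡.trans (≡.cong (scalar ℚ.*_) Z₀≡0) (ℚₚ.*-zeroʳ scalar)))
      λ (φX≡0 , φY≡0 , _) → regular (unscale φX≡ φX≡0 , unscale φY≡ φY≡0 , Z₀≡0)
      where
      unscale : ∀ {p q} → p ≡ scalar ℚ.* q → p ≡ 0ℚ → q ≡ 0ℚ
      unscale e p≡0 = [ ⊥-elim ∘ scalar≢0 , id ]′ (ℚ-integral scalar _ (≡.trans (≡.sym e) p≡0))

    φZ≢0 : φ Z ≢ 0ℚ
    φZ≢0 φZ≡0 = [ scalar≢0 , no-kernel ]′ (ℚ-integral scalar _ (≡.trans (≡.sym φZ≡) φZ≡0))

    Z-inverse : ∃[ w ] ℚ[t]→ℚ⟨t⟩ (ℤ[t]→ℚ[t] Z) ℚ⟨t⟩.⊠ w ℚ⟨t⟩.≃ ℚ⟨t⟩.embed (ℚ[t].const 1ℚ)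
    Z-inverse = ℚ⟨t⟩.⊠-inverse _ λ Z≃0 → Z≉0 (ℤ→ℚ.map-injective ι-injective
        (ℚ⟨t⟩.embed-injective Z≃0))

  module _ {x₁ y₁ x₂ y₂ : ℚ⟨t⟩}
    (eq₁ : Equation (overℚ⟨t⟩ E) x₁ y₁) (C₁ : Coordinates t₀ x₁ y₁)
    (eq₂ : Equation (overℚ⟨t⟩ E) x₂ y₂) (C₂ : Coordinates t₀ x₂ y₂) where

    private
      module C₁ = Coordinates C₁
      module C₂ = Coordinates C₂
      module M₁ = Model (model e₁ e₂ e₃ eq₁ C₁)
      module M₂ = Model (model e₁ e₂ e₃ eq₂ C₂)
      value = ℚ[t].eval t₀

      ratio : ∀ {v₁ v₂} V₁ V₂ → ℚ[t]→ℚ⟨t⟩ (ℤ[t]→ℚ[t] V₁) ℚ⟨t⟩.≃ v₁ ℚ⟨t⟩.⊠ ℚ[t]→ℚ⟨t⟩ (ℤ[t]→ℚ[t] M₁.Z)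
          →
        ℚ[t]→ℚ⟨t⟩ (ℤ[t]→ℚ[t] V₂) ℚ⟨t⟩.≃ v₂ ℚ⟨t⟩.⊠ ℚ[t]→ℚ⟨t⟩ (ℤ[t]→ℚ[t] M₂.Z) →
        ¬ ¬ (M₂.Z * V₁ ≈ M₁.Z * V₂) → v₁ ℚ⟨t⟩.≃ v₂
      ratio {v₁} {v₂} V₁ V₂ V₁-eq V₂-eq e = ProjectiveCoordinates.ratios-equal ℚ⟨t⟩-ring
        {v₁} {embed V₁} {embed M₁.Z} {proj₁ inverse₁} {v₂} {embed V₂} {embed M₂.Z} {proj₁ inverse₂}
        (proj₂ inverse₁) (proj₂ inverse₂) V₁-eq V₂-eq
        (ℚ⟨t⟩.≃-trans {embed M₂.Z ℚ⟨t⟩.⊠ embed V₁} {embed (M₂.Z * V₁)}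
            (ℚ⟨t⟩.≃-sym (embed-* M₂.Z V₁))
          (ℚ⟨t⟩.≃-trans {embed (M₂.Z * V₁)} {embed (M₁.Z * V₂)}
              (ℚ⟨t⟩.embed-cong (ℤ→ℚ.map-cong stable)) (embed-* M₁.Z V₂)))
        where
        embed : ℤ[t] → ℚ⟨t⟩
        embed f = ℚ[t]→ℚ⟨t⟩ (ℤ[t]→ℚ[t] f)
        inverse₁ = Z-inverse eq₁ C₁
        inverse₂ = Z-inverse eq₂ C₂
        embed-* : ∀ f g → embed (f * g) ℚ⟨t⟩.≃ embed f ℚ⟨t⟩.⊠ embed g
        embed-* f g = ℚ⟨t⟩.≃-trans {embed (f * g)} {ℚ[t]→ℚ⟨t⟩ (ℤ[t]→ℚ[t] f ℚ[t].⊛ ℤ[t]→ℚ[t] g)}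
            (ℚ⟨t⟩.embed-cong (ℤ→ℚ.map-⊛ f g))
          (RingMorphisms.IsRingHomomorphism.*-homo ℚ⟨t⟩.embed-isRingHomomorphism (ℤ[t]→ℚ[t] f)
              (ℤ[t]→ℚ[t] g))
        stable : M₂.Z * V₁ ≈ M₁.Z * V₂
        -- The double negation of the descent ends here: equality of integers is decidable, so the
        -- identity holds coefficient by coefficient.
        stable = ℤ[t].coeffwise λ n → decidable-stable (_ ℤₚ.≟ _) (¬¬-map (λ e → ℤ[t].at e n) e)

    same-point : SameAffine (specialize t₀ E) (value C₁.X) (value C₁.Y) (value C₁.Z) (value C₂.X)
        (value C₂.Y) (value C₂.Z) →
                 x₁ ℚ⟨t⟩.≃ x₂ × y₁ ℚ⟨t⟩.≃ y₂
    same-point (w , w′ , zw≡1 , z′w′≡1 , x≡ , y≡) =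
      ratio M₁.X M₂.X M₁.X-eq M₂.X-eq (¬¬-map proj₁ equal) , ratio M₁.Y M₂.Y M₁.Y-eq M₂.Y-eq
          (¬¬-map proj₂ equal)
      where
      equal : ¬ ¬ (M₂.Z * M₁.X ≈ M₁.Z * M₂.X × M₂.Z * M₁.Y ≈ M₁.Z * M₂.Y)
      equal = ℤ[t]-separation.equal {e₁} {e₂} {e₃} e₁₂ e₁₃ e₂₃ (λ {a} {d} {y} → no-pole {a} {d} {y})
          {M₁.X} {M₁.Y} {M₁.Z} {M₂.X} {M₂.Y} {M₂.Z} M₁.equation M₂.equation (φZ≢0 eq₁ C₁)
              (φZ≢0 eq₂ C₂)
        (ProjectiveCoordinates.cross-scale ℚ-ring {k = M₁.scalar} {k′ = M₂.scalar} zw≡1 z′w′≡1 x≡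
            M₁.φX≡ M₁.φZ≡ M₂.φX≡ M₂.φZ≡)
        (ProjectiveCoordinates.cross-scale ℚ-ring {k = M₁.scalar} {k′ = M₂.scalar} zw≡1 z′w′≡1 y≡
            M₁.φY≡ M₁.φZ≡ M₂.φY≡ M₂.φZ≡)

  module _ {x y : ℚ⟨t⟩} (eq : Equation (overℚ⟨t⟩ E) x y) (C : Coordinates t₀ x y) where

    open Coordinates C
    private value = ℚ[t].eval t₀

    evaluate-≢O : ¬ (Weierstrass._≈ₚ_ E₀ O (evaluate E {t₀} {x} {y} eq C) ⊎ Weierstrass._≈ₚ_ E₀
        (evaluate E {t₀} {x} {y} eq C) O)
    evaluate-≢O = no-kernel {x} {y} eq C ∘ fromProjective-O E₀ (value X) (value Y) (value Z)
        (specialized-equation E {t₀} {x} {y} eq C)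

  evaluate-injective : ∀ {x₁ y₁ x₂ y₂}
    (eq₁ : Equation (overℚ⟨t⟩ E) x₁ y₁) (C₁ : Coordinates t₀ x₁ y₁)
    (eq₂ : Equation (overℚ⟨t⟩ E) x₂ y₂) (C₂ : Coordinates t₀ x₂ y₂) →
    Weierstrass._≈ₚ_ E₀ (evaluate E {t₀} {x₁} {y₁} eq₁ C₁) (evaluate E {t₀} {x₂} {y₂} eq₂ C₂) →
    x₁ ℚ⟨t⟩.≃ x₂ × y₁ ℚ⟨t⟩.≃ y₂
  evaluate-injective {x₁} {y₁} {x₂} {y₂} eq₁ C₁ eq₂ C₂ e =
    [ ⊥-elim ∘ no-kernel {x₁} {y₁} eq₁ C₁ , same-point {x₁} {y₁} {x₂} {y₂} eq₁ C₁ eq₂ C₂ ]′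
      (fromProjective-≈ E₀ (value C₁.X) (value C₁.Y) (value C₁.Z) (value C₂.X) (value C₂.Y)
          (value C₂.Z)
        (specialized-equation E {t₀} {x₁} {y₁} eq₁ C₁)
            (specialized-equation E {t₀} {x₂} {y₂} eq₂ C₂) e)
    where
    module C₁ = Coordinates C₁
    module C₂ = Coordinates C₂
    value = ℚ[t].eval t₀

  σ-injective : ∀ P Q → Weierstrass._≈ₚ_ E₀ (σ E t₀ P) (σ E t₀ Q) →
                Weierstrass._≈ₚ_ (overℚ⟨t⟩ E) P Q
  σ-injective O                 O                 _ = Weierstrass.O≈O
  σ-injective O                 (affine x y eq)   e = ⊥-elim
      (evaluate-≢O {x} {y} eq (coordinates t₀ x y) (inj₁ e))
  σ-injective (affine x y eq)   O                 e = ⊥-elim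
      (evaluate-≢O {x} {y} eq (coordinates t₀ x y) (inj₂ e))
  σ-injective (affine x y eq) (affine x′ y′ eq′) e =
    let (x≃x′ , y≃y′) = evaluate-injective {x} {y} {x′} {y′} eq (coordinates t₀ x y) eq′
          (coordinates t₀ x′ y′) e
    in Weierstrass.affine x≃x′ y≃y′

theorem2p2 : (let open CommutativeRing ℤ[t]-ring) →
    (e₁ e₂ e₃ : ℤ[t]) →
    let E = curve e₁ e₂ e₃ in
    IsElliptic (overℚ⟨t⟩ E) →
    ¬ ConstantCurve (overℚ⟨t⟩ E) →
    (t₀ : ℚ) →
    IsElliptic (specialize t₀ E) →
    (∀ (h : ℤ[t]) → ℤ[t].NonConstant h → SquareFree h →
    h ∣ (e₁ - e₂) * (e₁ - e₃) ⊎ h ∣ (e₂ - e₁) * (e₂ - e₃) ⊎ h ∣ (e₃ - e₁) * (e₃ - e₂) →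
    ¬ IsSquare (h ⟨ t₀ ⟩)) →
    Injective (Weierstrass._≈ₚ_ (overℚ⟨t⟩ E)) (Weierstrass._≈ₚ_ (specialize t₀ E)) (σ E t₀)
theorem2p2 e₁ e₂ e₃ _ _ t₀ elliptic non-square {P} {Q} =
  Injectivity.σ-injective e₁ e₂ e₃ t₀ elliptic (λ {a} {d} {y} → no-pole {a} {d} {y}) P Q
  where
  open Evaluation t₀
  open Roots e₁ e₂ e₃ elliptic
  no-pole : ∀ {a d y} → ¬ d ℤ[t].≋ [] → y ℤ[t].⊛ y ℤ[t].≋ d ℤ[t].⊛ Cubic.cubic ℤ[t]-ring e₁ e₂ e₃ a d →
            a ⟨ t₀ ⟩ ≢ 0ℚ → d ⟨ t₀ ⟩ ≢ 0ℚ
  no-pole {a} {d} {y} = ℤ[t]-descent.no-pole {e₁} {e₂} {e₃}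
    (squares-reflected _ λ h nc sf h∣ → non-square h nc sf (inj₁ h∣))
    (squares-reflected _ λ h nc sf h∣ → non-square h nc sf (inj₂ (inj₁ h∣)))
    (squares-reflected _ λ h nc sf h∣ → non-square h nc sf (inj₂ (inj₂ h∣)))
    (λ {f} {z} → Values.unbounded {f} {z}) e₁₂ e₁₃ {a} {d} {y}
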